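{- Let $A,B\in\mathcal A_n$. The following are equivalent: (1) $A\le B$ in ASM order; (2) the Laurent polynomial $\mathbf x^A-\mathbf x^B$ is $q$TNN; (3) $\mathbf x^A-\mathbf x^B$ has the $q$SFL property.
   Context: $\mathcal A_n$ is the set of $n\times n$ alternating sign matrices (entries in $\{ -1,0,1\}$, partial row and column sums in $\{0,1\}$, full row and column sums $1$). Corner sum matrix $\widetilde A(i,j)=\sum_{p\le i,q\le j}a_{pq}$. ASM order: $A\le B$ iff $\widetilde A(i,j)\ge\widetilde B(i,j)$ for all $i,j\in[n]$. Let $x=(x_{ij})_{i,j=1}^n$ be a matrix of commuting indeterminates; for $A\in\mathcal A_n$, $\mathbf x^A=\prod_{i,j}x_{ij}^{a_{ij}}$. For a real $n\times n$ matrix $M=(m_{ij})$ and real $q>0$, $M_q=(q^{(i-j)^2/2}m_{ij})$; similarly $x_q=(x_{ij,q})$ with $x_{ij,q}=q^{(i-j)^2/2}x_{ij}$, and for a rational function $g$, $g(x_q)$ (resp. $g(M_q)$) means $g$ evaluated at these entries. A real matrix $M$ is locally TNN at $q_0>0$ if all minors (determinants of square submatrices) of $M_{q_0}$ are nonnegative. A rational function $g(x)$ is locally TNN at $q_0$ if $g(M_{q_0})\ge0$ for every real $n\times n$ matrix $M$ that is locally TNN at $q_0$ and for which $g(M_{q_0})$ is defined; $g$ is $q$TNN if it is locally TNN at every $q_0>0$. Let $\Delta_1(x),\dots,\Delta_m(x)$ be all minors of $x$. $g$ has the $q$SFL property if there are polynomials $F,G\in\mathbb R[x]$ with: $g=F/G$;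 $F=\sum c_{i_1\cdots i_k}\Delta_{i_1}(x)\cdots\Delta_{i_k}(x)$ with nonnegative integer coefficients $c$; $G=\prod_j\Delta_j(x)^{d_j}$ with nonnegative integers $d_j$; and $g(x_q)=F(x_q)/G(x_q)$ is a polynomial in $q$ (with coefficients rational functions in the $x_{ij}$). -}

module Defs where

open import Algebra.Apartness.Bundles using (HeytingField)
open import Algebra.Bundles using (CommutativeRing; module Semiring)
import Algebra.Definitions.RawMonoid as RawMonoidOps
import Algebra.Definitions.RawSemiring as RawSemiringOps
open import Data.Fin.Base as Fin using (Fin; zero; suc; toℕ; punchIn)
open import Data.Integer.Base as ℤ using (ℤ; 0ℤ; 1ℤ; -1ℤ)
open import Data.List.Base as List using (List; []; _∷_)
open import Data.Nat.Base as ℕ using (ℕ; zero; suc; ∣_-_∣)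
open import Data.Product.Base using (Σ-syntax; ∃-syntax; _×_; _,_)
open import Data.Sum.Base using (_⊎_)
open import Data.Vec.Functional using (Vector; foldr)
open import Level using (_⊔_) renaming (suc to lsuc)
open import Relation.Binary.Core using (Rel; _Preserves_⟶_)
open import Relation.Binary.PropositionalEquality using (_≡_)
open import Relation.Binary.Structures using (IsStrictPartialOrder)
open import Relation.Nullary.Negation using (¬_)

Matrix : ∀ {a} → Set a → ℕ → Set a
Matrix A n = Vector (Vector A n) n

open RawMonoidOps ℤ.+-0-rawMonoid using () renaming (sum to ∑)

-- partialSum f i = f 0 + ⋯ + f i, with the i-th term included.
partialSum : ∀ {n} → Vector ℤ n → Fin n → ℤ
partialSum f zero    = f zero
partialSum f (suc i) = f zero ℤ.+ partialSum (λ j → f (suc j)) i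

record ASM (n : ℕ) : Set where
  field
    entry       : Matrix ℤ n
    entry-range : ∀ i j → entry i j ≡ -1ℤ ⊎ entry i j ≡ 0ℤ ⊎ entry i j ≡ 1ℤ
    row-partial : ∀ i j → partialSum (entry i) j ≡ 0ℤ ⊎ partialSum (entry i) j ≡ 1ℤ
    col-partial : ∀ i j → partialSum (λ p → entry p j) i ≡ 0ℤ
                        ⊎ partialSum (λ p → entry p j) i ≡ 1ℤ
    row-sum     : ∀ i → ∑ (entry i) ≡ 1ℤ
    col-sum     : ∀ j → ∑ (λ p → entry p j) ≡ 1ℤ

cornerSum : ∀ {n} → ASM n → Fin n → Fin n → ℤ
cornerSum A i j = partialSum (λ p → partialSum (ASM.entry A p) j) i

infix 4 _≤ASM_

_≤ASM_ : ∀ {n} → ASM n → ASM n → Set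
A ≤ASM B = ∀ i j → cornerSum A i j ℤ.≥ cornerSum B i j

-- Row and column sets of a square submatrix, listed increasingly.
record MinorIndex (n : ℕ) : Set where
  field
    {size-1} : ℕ
    rows     : Fin (suc size-1) → Fin n
    cols     : Fin (suc size-1) → Fin n
    rows-inc : rows Preserves Fin._<_ ⟶ Fin._<_
    cols-inc : cols Preserves Fin._<_ ⟶ Fin._<_

module Determinant {a ℓ} (R : CommutativeRing a ℓ) where
  open CommutativeRing R using (Carrier; semiring; _*_; -_; 1#)
  open RawSemiringOps (Semiring.rawSemiring semiring) using (sum; _^_)

  -- Laplace expansion along the first row.
  det : ∀ {k} → Matrix Carrier k → Carrier
  det {zero}  M = 1#
  det {suc k} M =
    sum λ j → ((- 1#) ^ toℕ j) * (M zero j * det λ r c → M (suc r) (punchIn j c))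

  minor : ∀ {n} → Matrix Carrier n → MinorIndex n → Carrier
  minor M Δ = det λ r c → M (rows r) (cols c)
    where open MinorIndex Δ

-- The real numbers, axiomatised as a Cauchy complete Archimedean ordered
-- field.  Classically ℝ is the only model up to isomorphism; apartness and
-- strict order are primitive so that constructive reals are models as well.
record Reals c ℓ₁ ℓ₂ : Set (lsuc (c ⊔ ℓ₁ ⊔ ℓ₂)) where
  field
    heytingField : HeytingField c ℓ₁ ℓ₂

  open HeytingField heytingField public

  commutativeRing : CommutativeRing c ℓ₁
  commutativeRing = record { isCommutativeRing = isCommutativeRing }

  open RawSemiringOps (Semiring.rawSemiring (CommutativeRing.semiring commutativeRing)) public
    using (_^_) renaming (_×_ to _·_)

  infix 4 _<_ _≤_

  field
    _<_                  : Rel Carrier ℓ₂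
    isStrictPartialOrder : IsStrictPartialOrder _≈_ _<_
    <⇒#                  : ∀ {x y} → x < y → x # y
    #⇒<                  : ∀ {x y} → x # y → x < y ⊎ y < x
    +-monoʳ-<            : ∀ x {y z} → y < z → x + y < x + z
    *-pos                : ∀ {x y} → 0# < x → 0# < y → 0# < x * y
    archimedean          : ∀ x → ∃[ k ] x < k · 1#

  _≤_ : Rel Carrier ℓ₂
  x ≤ y = ¬ (y < x)

  -- The condition is symmetric in j and k, so it bounds |s j - s k|.
  Cauchy : (ℕ → Carrier) → Set (c ⊔ ℓ₂)
  Cauchy s = ∀ ε → 0# < ε →
    ∃[ N ] (∀ j k → N ℕ.≤ j → N ℕ.≤ k → s j - s k < ε)

  _ConvergesTo_ : (ℕ → Carrier) → Carrier → Set (c ⊔ ℓ₂)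
  s ConvergesTo l = ∀ ε → 0# < ε →
    ∃[ N ] (∀ k → N ℕ.≤ k → s k - l < ε × l - s k < ε)

  field
    complete : ∀ s → Cauchy s → ∃[ l ] s ConvergesTo l

    -- Positive square roots exist and are unique by the axioms above; the
    -- operation is a field only to give access to half-integral powers.
    √        : ∀ {q} → 0# < q → Carrier
    √-pos    : ∀ {q} (q>0 : 0# < q) → 0# < √ q>0
    √-square : ∀ {q} (q>0 : 0# < q) → √ q>0 * √ q>0 ≈ q

module RationalFunctions {c ℓ₁ ℓ₂} (ℝ : Reals c ℓ₁ ℓ₂) where
  private module ℝ = Reals ℝ
  open ℝ using () renaming (Carrier to R)

  -- The polynomial ring ℝ[x], presented as the free commutative ℝ-algebra
  -- on the n² generators x i j: terms modulo the congruence _≋_ generated by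
  -- the commutative ring laws and the requirement that con be a ring
  -- homomorphism.

  infixl 6 _⊕_
  infixl 7 _⊗_

  data Poly (n : ℕ) : Set c where
    con     : R → Poly n
    x       : Fin n → Fin n → Poly n
    _⊕_ _⊗_ : Poly n → Poly n → Poly n
    ⊝_      : Poly n → Poly n

  infix 4 _≋_

  data _≋_ {n : ℕ} : Rel (Poly n) (c ⊔ ℓ₁) where
    ≋-refl      : ∀ {P} → P ≋ P
    ≋-sym       : ∀ {P Q} → P ≋ Q → Q ≋ P
    ≋-trans     : ∀ {P Q S} → P ≋ Q → Q ≋ S → P ≋ S
    ⊕-cong      : ∀ {P P′ Q Q′} → P ≋ P′ → Q ≋ Q′ → P ⊕ Q ≋ P′ ⊕ Q′
    ⊗-cong      : ∀ {P P′ Q Q′} → P ≋ P′ → Q ≋ Q′ → P ⊗ Q ≋ P′ ⊗ Q′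
    ⊝-cong      : ∀ {P P′} → P ≋ P′ → ⊝ P ≋ ⊝ P′
    con-cong    : ∀ {a b} → a ℝ.≈ b → con a ≋ con b
    con-+       : ∀ a b → con (a ℝ.+ b) ≋ con a ⊕ con b
    con-*       : ∀ a b → con (a ℝ.* b) ≋ con a ⊗ con b
    ⊕-assoc     : ∀ P Q S → (P ⊕ Q) ⊕ S ≋ P ⊕ (Q ⊕ S)
    ⊕-comm      : ∀ P Q → P ⊕ Q ≋ Q ⊕ P
    ⊕-identityˡ : ∀ P → con ℝ.0# ⊕ P ≋ P
    ⊝-inverseˡ  : ∀ P → ⊝ P ⊕ P ≋ con ℝ.0#
    ⊗-assoc     : ∀ P Q S → (P ⊗ Q) ⊗ S ≋ P ⊗ (Q ⊗ S)
    ⊗-comm      : ∀ P Q → P ⊗ Q ≋ Q ⊗ P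
    ⊗-identityˡ : ∀ P → con ℝ.1# ⊗ P ≋ P
    ⊗-distribˡ  : ∀ P Q S → P ⊗ (Q ⊕ S) ≋ (P ⊗ Q) ⊕ (P ⊗ S)

  ℝ[x] : ℕ → CommutativeRing c (c ⊔ ℓ₁)
  ℝ[x] n = record
    { Carrier = Poly n ; _≈_ = _≋_ ; _+_ = _⊕_ ; _*_ = _⊗_ ; -_ = ⊝_
    ; 0# = con ℝ.0# ; 1# = con ℝ.1#
    ; isCommutativeRing = record
      { isRing = record
        { +-isAbelianGroup = record
          { isGroup = record
            { isMonoid = record
              { isSemigroup = record
                { isMagma = record
                  { isEquivalence = record
                    { refl = ≋-refl ; sym = ≋-sym ; trans = ≋-trans }
                  ; ∙-cong = ⊕-cong }
                ; assoc = ⊕-assoc }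
              ; identity = ⊕-identityˡ
                         , λ P → ≋-trans (⊕-comm P _) (⊕-identityˡ P) }
            ; inverse = ⊝-inverseˡ
                      , λ P → ≋-trans (⊕-comm P _) (⊝-inverseˡ P)
            ; ⁻¹-cong = ⊝-cong }
          ; comm = ⊕-comm }
        ; *-cong = ⊗-cong
        ; *-assoc = ⊗-assoc
        ; *-identity = ⊗-identityˡ
                     , λ P → ≋-trans (⊗-comm P _) (⊗-identityˡ P)
        ; distrib = ⊗-distribˡ
                  , λ P Q S → ≋-trans (⊗-comm (Q ⊕ S) P)
                      (≋-trans (⊗-distribˡ P Q S)
                               (⊕-cong (⊗-comm P Q) (⊗-comm P S))) }
      ; *-comm = ⊗-comm } }

  module _ {n : ℕ} where
    open CommutativeRing (ℝ[x] n) public using () renaming (0# to 0ₚ; 1# to 1ₚ)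
    open RawSemiringOps (Semiring.rawSemiring (CommutativeRing.semiring (ℝ[x] n))) public
      using () renaming (_^_ to _^ₚ_; _×_ to _·ₚ_)

  eval : ∀ {n} → Poly n → Matrix R n → R
  eval (con a) M = a
  eval (x i j) M = M i j
  eval (P ⊕ Q) M = eval P M ℝ.+ eval Q M
  eval (P ⊗ Q) M = eval P M ℝ.* eval Q M
  eval (⊝ P)   M = ℝ.- eval P M

  _[_] : ∀ {n} → Poly n → Matrix (Poly n) n → Poly n
  con a   [ σ ] = con a
  x i j   [ σ ] = σ i j
  (P ⊕ Q) [ σ ] = (P [ σ ]) ⊕ (Q [ σ ])
  (P ⊗ Q) [ σ ] = (P [ σ ]) ⊗ (Q [ σ ])
  (⊝ P)   [ σ ] = ⊝ (P [ σ ])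

  -- Formal quotients of polynomials.  Those with nonzero den represent the elements
  -- of ℝ(x), and on these _≃_ is equality in ℝ(x); they are closed under the
  -- operations below because ℝ[x] is an integral domain.

  infix 7 _/_

  record Frac (n : ℕ) : Set c where
    constructor _/_
    field
      num den : Poly n

  open Frac public

  Nonzero : ∀ {n} → Poly n → Set (c ⊔ ℓ₁)
  Nonzero P = ¬ (P ≋ 0ₚ)

  RatFun : ℕ → Set (c ⊔ ℓ₁)
  RatFun n = Σ[ g ∈ Frac n ] Nonzero (den g)

  infix  4 _≃_
  infixl 6 _+ᶠ_ _-ᶠ_
  infixl 7 _*ᶠ_

  _≃_ : ∀ {n} → Rel (Frac n) (c ⊔ ℓ₁)
  g ≃ h = num g ⊗ den h ≋ num h ⊗ den g

  1ᶠ : ∀ {n} → Frac n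
  1ᶠ = 1ₚ / 1ₚ

  _+ᶠ_ _-ᶠ_ _*ᶠ_ : ∀ {n} → Frac n → Frac n → Frac n
  g +ᶠ h = (num g ⊗ den h ⊕ num h ⊗ den g) / (den g ⊗ den h)
  g -ᶠ h = (num g ⊗ den h ⊕ ⊝ (num h ⊗ den g)) / (den g ⊗ den h)
  g *ᶠ h = (num g ⊗ num h) / (den g ⊗ den h)

  ∏ᶠ : ∀ {n k} → Vector (Frac n) k → Frac n
  ∏ᶠ = foldr _*ᶠ_ 1ᶠ

  power : ∀ {n} → Poly n → ℤ → Frac n
  power P (ℤ.+ k)    = (P ^ₚ k) / 1ₚ
  power P ℤ.-[1+ k ] = 1ₚ / (P ^ₚ suc k)

  x^_ : ∀ {n} → ASM n → Frac n
  x^ A = ∏ᶠ λ i → ∏ᶠ λ j → power (x i j) (ASM.entry A i j)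

  -- q^((i-j)²/2), written as a power of √q.
  weight : ∀ {n q} → ℝ.0# ℝ.< q → Fin n → Fin n → R
  weight q>0 i j = ℝ.√ q>0 ℝ.^ (∣ toℕ i - toℕ j ∣ ℕ.^ 2)

  scale : ∀ {n q} → ℝ.0# ℝ.< q → Matrix R n → Matrix R n
  scale q>0 M i j = weight q>0 i j ℝ.* M i j

  x_q : ∀ {n q} → ℝ.0# ℝ.< q → Matrix (Poly n) n
  x_q q>0 i j = con (weight q>0 i j) ⊗ x i j

  -- g is defined at M, with value v: some representative P/Q of g has Q(M)
  -- invertible, and v = P(M)/Q(M).
  _at_is_ : ∀ {n} → Frac n → Matrix R n → R → Set (c ⊔ ℓ₁ ⊔ ℓ₂)
  _at_is_ {n} g M v = Σ[ P ∈ Poly n ] Σ[ Q ∈ Poly n ]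
    (g ≃ P / Q) × (eval Q M ℝ.# ℝ.0#) × (v ℝ.* eval Q M ℝ.≈ eval P M)

  LocallyTNN-matrix : ∀ {n q₀} → ℝ.0# ℝ.< q₀ → Matrix R n → Set ℓ₂
  LocallyTNN-matrix q₀>0 M = ∀ Δ → ℝ.0# ℝ.≤ minor (scale q₀>0 M) Δ
    where open Determinant ℝ.commutativeRing

  LocallyTNN : ∀ {n q₀} → ℝ.0# ℝ.< q₀ → Frac n → Set (c ⊔ ℓ₁ ⊔ ℓ₂)
  LocallyTNN q₀>0 g = ∀ M → LocallyTNN-matrix q₀>0 M →
    ∀ v → g at scale q₀>0 M is v → ℝ.0# ℝ.≤ v

  qTNN : ∀ {n} → Frac n → Set (c ⊔ ℓ₁ ⊔ ℓ₂)
  qTNN g = ∀ {q₀} (q₀>0 : ℝ.0# ℝ.< q₀) → LocallyTNN q₀>0 g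

  Δ⟨_⟩ : ∀ {n} → MinorIndex n → Poly n
  Δ⟨_⟩ {n} = Determinant.minor (ℝ[x] n) x

  ∑ₚ ∏ₚ : ∀ {n} → List (Poly n) → Poly n
  ∑ₚ = List.foldr _⊕_ 0ₚ
  ∏ₚ = List.foldr _⊗_ 1ₚ

  -- ∑ c · Δ_{i₁} ⋯ Δ_{iₖ}, for a list of pairs (c , [i₁ , … , iₖ]).
  minorSum : ∀ {n} → List (ℕ × List (MinorIndex n)) → Poly n
  minorSum ts = ∑ₚ (List.map (λ (c , Δs) → c ·ₚ ∏ₚ (List.map Δ⟨_⟩ Δs)) ts)

  -- ∏ Δ_j ^ d_j, for a list of pairs (j , d_j).
  minorProduct : ∀ {n} → List (MinorIndex n × ℕ) → Poly n
  minorProduct ds = ∏ₚ (List.map (λ (Δ , d) → Δ⟨ Δ ⟩ ^ₚ d) ds)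

  -- h₀ + h₁ q + h₂ q² + ⋯ by Horner's rule.
  polynomialIn : ∀ {n} → R → List (RatFun n) → Frac n
  polynomialIn q []             = 0ₚ / 1ₚ
  polynomialIn q ((h , _) ∷ hs) = h +ᶠ (con q / 1ₚ) *ᶠ polynomialIn q hs

  record qSFL {n} (g : Frac n) : Set (c ⊔ ℓ₁ ⊔ ℓ₂) where
    field
      F G           : Poly n
      G-nonzero     : Nonzero G
      g≃F/G         : g ≃ F / G
      F-terms       : List (ℕ × List (MinorIndex n))
      F-sum         : F ≋ minorSum F-terms
      G-factors     : List (MinorIndex n × ℕ)
      G-product     : G ≋ minorProduct G-factors
      q-coeffs      : List (RatFun n)
      -- The coefficients do not depend on q; the identity holds in ℝ(x) for
      -- every real q > 0.
      q-polynomial  : ∀ {q} (q>0 : ℝ.0# ℝ.< q) →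
        (F [ x_q q>0 ]) / (G [ x_q q>0 ]) ≃ polynomialIn q q-coeffs

{-# OPTIONS --safe #-}

-- Write x^A - x^B = (x^α - x^β) / x^δ with nonnegative exponent matrices α, β, δ.  By
-- two-dimensional summation by parts, α - β is the combination of the matrices
-- e(i,j) + e(i+1,j+1) - e(i+1,j) - e(i,j+1) with the differences of corner sums as
-- multiplicities.  If A ≤ B, then x^K (x^α - x^β) for a suitable monomial x^K is therefore
-- x^β times a difference of products in which every factor x(i,j) x(i+1,j+1) dominates
-- x(i+1,j) x(i,j+1) by an adjacent minor; such a difference is a sum of products of entries
-- and 2×2 minors, whence qSFL.  The same exchange changes Σ E(i,j) (i-j)² by an even number,
-- and comparing A with the identity matrix shows that the powers of q are natural.
--
-- At a totally nonnegative matrix where the denominator may vanish, qTNN follows by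
-- perturbing to a positive matrix N with nonnegative 2×2 minors, multiplying on both sides by
-- the kernel ε^|i-j| and letting ε tend to 0.
--
-- Conversely, if the corner sum of A at (r , s) is smaller than that of B, the matrix with
-- entries t^(ij + W [i ≤ r] [j ≤ s]) is totally positive for large t, and for large W it gives
-- x^A a smaller value than x^B.  This contradicts both qTNN and qSFL.

module Submission where

open import Defs
open import Algebra.Bundles using (CommutativeMonoid; CommutativeRing; module Semiring)
import Algebra.Definitions.RawMonoid as RawMonoidOps
import Algebra.Definitions.RawSemiring as RawSemiringOps
import Algebra.Properties.CommutativeMonoid.Mult as Mult
import Algebra.Properties.CommutativeMonoid.Sum as Sum
import Algebra.Properties.Ring
import Algebra.Properties.Semiring.Exp
import Algebra.Properties.Semiring.Mult
import Algebra.Properties.Semiring.Mult.TCOptimised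
import Algebra.Properties.Semiring.Sum
import Algebra.Solver.Ring
open import Algebra.Solver.Ring.AlmostCommutativeRing using (fromCommutativeRing; _-Raw-AlmostCommutative⟶_)
open import Data.Fin.Base as Fin using (Fin; zero; suc; toℕ; punchIn; inject₁)
import Data.Fin.Properties as Finₚ
open import Data.Integer.Base as ℤ using (ℤ; +_; 0ℤ; 1ℤ; -1ℤ)
import Data.Integer.Properties as ℤₚ
open import Data.Integer.Tactic.RingSolver using () renaming (solve-∀ to solveℤ)
open import Data.List.Base as List using (List; []; _∷_; _++_)
open import Data.Maybe.Base using (Maybe; just; nothing)
open import Data.Nat.Base as ℕ using (ℕ; zero; suc; ∣_-_∣)
import Data.Nat.Properties as ℕₚ
open import Data.Nat.Tactic.RingSolver using () renaming (solve-∀ to solveℕ)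
open import Data.Product.Base using (Σ-syntax; ∃-syntax; _×_; _,_; proj₁; proj₂)
open import Data.Sum.Base using (_⊎_; inj₁; inj₂; [_,_]′)
open import Data.Vec.Functional using (Vector; foldr)
open import Function.Base using (_∘_)
open import Function.Bundles using (_⇔_; mk⇔)
open import Level using (_⊔_)
open import Relation.Binary.Definitions using (tri<; tri≈; tri>)
open import Relation.Binary.PropositionalEquality as ≡ using (_≡_)
open import Relation.Binary.Structures using (IsStrictPartialOrder)
open import Relation.Nullary.Decidable using (yes; no; decidable-stable)
open import Relation.Nullary.Negation using (¬_; contradiction)

-- The reals are constructive: signs are not decidable, `_≤_` negates the reversed strict order, and
-- the value of a fraction may come from any representative `P / Q`. Nonnegativity is therefore
-- proved by refuting a strict inequality, and auxiliary objects need to exist only up to double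
-- negation. What has to be produced outright for qSFL comes from exact integer combinatorics.
--
-- The monomial x^K appears because the exchange is an identity of sums,
-- `α + antidiagonal D = β + diagonal D`: `α` itself need not contain the diagonal positions that
-- would be traded. With K = `antidiagonal D` it becomes x^K (x^α - x^β) = x^β (x^(diagonal D) -
-- x^K).
--
-- The forward direction uses entries and 2×2 minors only, so the perturbation has to preserve no
-- more than those. Minors of all sizes matter in the converse, where an explicit base t = n² + 1
-- makes the diagonal term dominate every Laplace expansion.

-- Padded matrices and monomials with matrix exponents.

data End : Set where
  front back : End

-- Padding at the back keeps `d i` at `inject₁ i`, padding at the front moves it to `suc i`, so the
-- difference of the two is a discrete derivative.
pad : ∀ {a} {A : Set a} {m} → End → A → Vector A m → Vector A (suc m)
pad               front o d zero    = o
pad               front o d (suc i) = d i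
pad {m = zero}    back  o d i       = o
pad {m = suc m}   back  o d zero    = d zero
pad {m = suc m}   back  o d (suc i) = pad back o (d ∘ suc) i

embed : ∀ {m} → End → Fin m → Fin (suc m)
embed front = suc
embed back  = inject₁

pad-map₂ : ∀ {a b c} {A : Set a} {B : Set b} {C : Set c} (f : A → B → C) {m} e o o′
           (d : Vector A m) (d′ : Vector B m) i →
           f (pad e o d i) (pad e o′ d′ i) ≡ pad e (f o o′) (λ i → f (d i) (d′ i)) i
pad-map₂ f             front o o′ d d′ zero    = ≡.refl
pad-map₂ f             front o o′ d d′ (suc i) = ≡.refl
pad-map₂ f {m = zero}  back  o o′ d d′ i       = ≡.refl
pad-map₂ f {m = suc m} back  o o′ d d′ zero    = ≡.refl
pad-map₂ f {m = suc m} back  o o′ d d′ (suc i) = pad-map₂ f back o o′ (d ∘ suc) (d′ ∘ suc) i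

pad-map : ∀ {a b} {A : Set a} {B : Set b} (f : A → B) {m} e o (d : Vector A m) i →
          f (pad e o d i) ≡ pad e (f o) (f ∘ d) i
pad-map f e o d = pad-map₂ (λ x _ → f x) e o o d d

pad-cong : ∀ {a} {A : Set a} {m} e (o : A) {d d′ : Vector A m} → (∀ i → d i ≡ d′ i) →
           ∀ i → pad e o d i ≡ pad e o d′ i
pad-cong             front o d≗d′ zero    = ≡.refl
pad-cong             front o d≗d′ (suc i) = d≗d′ i
pad-cong {m = zero}  back  o d≗d′ i       = ≡.refl
pad-cong {m = suc m} back  o d≗d′ zero    = d≗d′ zero
pad-cong {m = suc m} back  o d≗d′ (suc i) = pad-cong back o (d≗d′ ∘ suc) i

padMatrix : ∀ {a} {A : Set a} {m} → End → End → A → Matrix A m → Matrix A (suc m)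
padMatrix e e′ o D i j = pad e′ o (λ j′ → pad e o (λ i′ → D i′ j′) i) j

-- `D i j` counts copies of the adjacent 2×2 block with upper left position (i , j); its two
-- diagonal or its two antidiagonal positions are collected into one exponent matrix.
diagonal antidiagonal : ∀ {m} → Matrix ℕ m → Matrix ℕ (suc m)
diagonal     D i j = padMatrix back  back 0 D i j ℕ.+ padMatrix front front 0 D i j
antidiagonal D i j = padMatrix front back 0 D i j ℕ.+ padMatrix back  front 0 D i j

-- The combination of the y i j with multiplicities E i j; in a multiplicative monoid it
-- is the monomial y^E.
module Combination {a ℓ} (M : CommutativeMonoid a ℓ) where
  open CommutativeMonoid M
  open Sum M using (sum; sum-cong-≋; ∑-distrib-+; ∑-comm; sum-replicate-zero) public
  open Mult M using () renaming (_×_ to _×ₘ_)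
  open import Relation.Binary.Reasoning.Setoid setoid

  combination : ∀ {n} → Matrix ℕ n → Matrix Carrier n → Carrier
  combination E y = sum λ i → sum λ j → E i j ×ₘ y i j

  combination-cong : ∀ {n} {E E′ : Matrix ℕ n} {y y′ : Matrix Carrier n} →
    (∀ i j → E i j ≡ E′ i j) → (∀ i j → y i j ≈ y′ i j) → combination E y ≈ combination E′ y′
  combination-cong E≗E′ y≈y′ =
    sum-cong-≋ λ i → sum-cong-≋ λ j → Mult.×-cong M (E≗E′ i j) (y≈y′ i j)

  sum-∙ : ∀ {n} (f g h : Vector Carrier n) → (∀ i → f i ≈ g i ∙ h i) → sum f ≈ sum g ∙ sum h
  sum-∙ {n} f g h f≈ = trans (sum-cong-≋ {n} {f} f≈) (∑-distrib-+ g h)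

  combination-+ : ∀ {n} (E E′ : Matrix ℕ n) y →
    combination (λ i j → E i j ℕ.+ E′ i j) y ≈ combination E y ∙ combination E′ y
  combination-+ E E′ y = sum-∙ _ (λ i → sum λ j → E i j ×ₘ y i j) _ λ i →
    sum-∙ _ (λ j → E i j ×ₘ y i j) _ λ j → Mult.×-homo-+ M (y i j) (E i j) (E′ i j)

  combination-∙ : ∀ {n} (E : Matrix ℕ n) y z →
    combination E (λ i j → y i j ∙ z i j) ≈ combination E y ∙ combination E z
  combination-∙ E y z = sum-∙ _ (λ i → sum λ j → E i j ×ₘ y i j) _ λ i →
    sum-∙ _ (λ j → E i j ×ₘ y i j) _ λ j → Mult.×-distrib-+ M (y i j) (z i j) (E i j)

  combination-pure : ∀ {n} (E : Matrix ℕ n) y → (∀ i j → E i j ×ₘ y i j ≈ ε) →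
    combination E y ≈ ε
  combination-pure {n} E y hyp = trans
    (sum-cong-≋ {n} λ i → trans (sum-cong-≋ {n} (hyp i)) (sum-replicate-zero n))
    (sum-replicate-zero n)

  sum-pad : ∀ {m} e (d : Vector ℕ m) (y : Vector Carrier (suc m)) →
    sum (λ i → pad e 0 d i ×ₘ y i) ≈ sum (λ i → d i ×ₘ y (embed e i))
  sum-pad             front d y = identityˡ _
  sum-pad {zero}      back  d y = identityˡ _
  sum-pad {suc m}     back  d y = ∙-congˡ (sum-pad back (d ∘ suc) (y ∘ suc))

  combination-pad : ∀ {m} e e′ (D : Matrix ℕ m) y →
    combination (padMatrix e e′ 0 D) y ≈ combination D (λ i j → y (embed e i) (embed e′ j))
  combination-pad e e′ D y = begin
    _ ≈⟨ (sum-cong-≋ λ i → sum-pad e′ (λ j → pad e 0 (λ i → D i j) i) (y i)) ⟩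
    _ ≈⟨ ∑-comm (λ i j → pad e 0 (λ i → D i j) i ×ₘ y i (embed e′ j)) ⟩
    _ ≈⟨ (sum-cong-≋ λ j → sum-pad e (λ i → D i j) (λ i → y i (embed e′ j))) ⟩
    _ ≈⟨ ∑-comm (λ j i → D i j ×ₘ y (embed e i) (embed e′ j)) ⟩
    _ ∎

  combination-diagonal : ∀ {m} (D : Matrix ℕ m) y →
    combination (diagonal D) y
      ≈ combination D (λ i j → y (inject₁ i) (inject₁ j) ∙ y (suc i) (suc j))
  combination-diagonal D y = begin
    _ ≈⟨ combination-+ (padMatrix back back 0 D) (padMatrix front front 0 D) y ⟩
    _ ≈⟨ ∙-cong (combination-pad back back D y) (combination-pad front front D y) ⟩
    _ ≈⟨ sym (combination-∙ D _ _) ⟩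
    _ ∎

  combination-antidiagonal : ∀ {m} (D : Matrix ℕ m) y →
    combination (antidiagonal D) y
      ≈ combination D (λ i j → y (suc i) (inject₁ j) ∙ y (inject₁ i) (suc j))
  combination-antidiagonal D y = begin
    _ ≈⟨ combination-+ (padMatrix front back 0 D) (padMatrix back front 0 D) y ⟩
    _ ≈⟨ ∙-cong (combination-pad front back D y) (combination-pad back front D y) ⟩
    _ ≈⟨ sym (combination-∙ D _ _) ⟩
    _ ∎

module _ {a ℓ b ℓ′} (M : CommutativeMonoid a ℓ) (N : CommutativeMonoid b ℓ′) where
  private
    module M = CommutativeMonoid M
    module N = CommutativeMonoid N

  open Mult M using () renaming (_×_ to _×₁_)
  open Mult N using () renaming (_×_ to _×₂_)
  open Combination M using () renaming (sum to sum₁; combination to combination₁)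
  open Combination N using () renaming (sum to sum₂; combination to combination₂)

  module _ (f : M.Carrier → N.Carrier) (f-ε : f M.ε N.≈ N.ε)
           (f-∙ : ∀ x y → f (x M.∙ y) N.≈ f x N.∙ f y) where

    homo-sum : ∀ {n} (v : Vector M.Carrier n) (w : Vector N.Carrier n) →
      (∀ i → f (v i) N.≈ w i) → f (sum₁ v) N.≈ sum₂ w
    homo-sum {zero}  v w hyp = f-ε
    homo-sum {suc n} v w hyp =
      N.trans (f-∙ _ _) (N.∙-cong (hyp zero) (homo-sum (v ∘ suc) (w ∘ suc) (hyp ∘ suc)))

    homo-× : ∀ k x → f (k ×₁ x) N.≈ k ×₂ f x
    homo-× zero    x = f-ε
    homo-× (suc k) x = N.trans (f-∙ _ _) (N.∙-congˡ (homo-× k x))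

    -- Used for evaluation of monomials, for substitution into them, and for exponentials from (ℕ,
    -- +), which turn weighted sums of exponents into values of monomials.
    homo-combination : ∀ {n} (E : Matrix ℕ n) y →
      f (combination₁ E y) N.≈ combination₂ E (λ i j → f (y i j))
    homo-combination E y =
      homo-sum _ _ λ i → homo-sum _ _ λ j → homo-× (E i j) (y i j)

-- Partial sums and summation by parts.

open Sum ℤₚ.+-0-commutativeMonoid using ()
  renaming (sum to ∑; sum-cong-≗ to ∑-cong; ∑-distrib-+ to ∑-distrib; sum-replicate-zero to ∑-zero)

partialSum-cong : ∀ {n} {f g : Vector ℤ n} → (∀ i → f i ≡ g i) → ∀ i → partialSum f i ≡ partialSum g i
partialSum-cong f≗g zero    = f≗g zero
partialSum-cong f≗g (suc i) = ≡.cong₂ ℤ._+_ (f≗g zero) (partialSum-cong (f≗g ∘ suc) i)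

partialSum-- : ∀ {n} (f g : Vector ℤ n) i →
  partialSum (λ i → f i ℤ.- g i) i ≡ partialSum f i ℤ.- partialSum g i
partialSum-- f g zero    = ≡.refl
partialSum-- f g (suc i) rewrite partialSum-- (f ∘ suc) (g ∘ suc) i =
  lemma (f zero) (g zero) (partialSum (f ∘ suc) i) (partialSum (g ∘ suc) i)
  where
  lemma : ∀ a b c d → a ℤ.- b ℤ.+ (c ℤ.- d) ≡ a ℤ.+ c ℤ.- (b ℤ.+ d)
  lemma = solveℤ

partialSum-mono : ∀ {n} (f g : Vector ℤ n) i → (∀ p → p Fin.≤ i → f p ℤ.≤ g p) →
  partialSum f i ℤ.≤ partialSum g i
partialSum-mono f g zero    f≤g = f≤g zero ℕ.z≤n
partialSum-mono f g (suc i) f≤g = ℤₚ.+-mono-≤ (f≤g zero ℕ.z≤n)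
  (partialSum-mono (f ∘ suc) (g ∘ suc) i λ p p≤i → f≤g (suc p) (ℕ.s≤s p≤i))

partialSum-+ : ∀ {n} (f g : Vector ℤ n) i →
  partialSum (λ i → f i ℤ.+ g i) i ≡ partialSum f i ℤ.+ partialSum g i
partialSum-+ f g zero    = ≡.refl
partialSum-+ f g (suc i) rewrite partialSum-+ (f ∘ suc) (g ∘ suc) i =
  lemma (f zero) (g zero) (partialSum (f ∘ suc) i) (partialSum (g ∘ suc) i)
  where
  lemma : ∀ a b c d → a ℤ.+ b ℤ.+ (c ℤ.+ d) ≡ a ℤ.+ c ℤ.+ (b ℤ.+ d)
  lemma = solveℤ

partialSum-comm : ∀ {k n} (c : Fin k → Vector ℤ n) i j →
  partialSum (λ p → partialSum (c p) j) i ≡ partialSum (λ q → partialSum (λ p → c p q) i) j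
partialSum-comm c i zero    = ≡.refl
partialSum-comm c i (suc j) = ≡.trans
  (partialSum-+ (λ p → c p zero) (λ p → partialSum (c p ∘ suc) j) i)
  (≡.cong (λ t → partialSum (λ p → c p zero) i ℤ.+ t) (partialSum-comm (λ p → c p ∘ suc) i j))

∑-partialSum : ∀ {k n} (c : Fin k → Vector ℤ n) j →
  ∑ (λ p → partialSum (c p) j) ≡ partialSum (λ q → ∑ λ p → c p q) j
∑-partialSum c zero    = ≡.refl
∑-partialSum c (suc j) = ≡.trans
  (∑-distrib (λ p → c p zero) (λ p → partialSum (c p ∘ suc) j))
  (≡.cong (λ t → ∑ (λ p → c p zero) ℤ.+ t) (∑-partialSum (λ p → c p ∘ suc) j))

partialSum-zero : ∀ {n} (f : Vector ℤ n) → (∀ i → f i ≡ 0ℤ) → ∀ i → partialSum f i ≡ 0ℤ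
partialSum-zero f f≡0 zero    = f≡0 zero
partialSum-zero f f≡0 (suc i) = ≡.cong₂ ℤ._+_ (f≡0 zero) (partialSum-zero (f ∘ suc) (f≡0 ∘ suc) i)

-- Summation by parts, with z the sum of the entries before c.
difference-of-partialSums : ∀ {m} (c : Vector ℤ (suc m)) z (s : Vector ℤ m) →
  (∀ j → s j ≡ z ℤ.+ partialSum c (inject₁ j)) → z ℤ.+ ∑ c ≡ 0ℤ →
  ∀ j → c j ≡ pad back 0ℤ s j ℤ.- pad front z s j
difference-of-partialSums {zero}  c z s s≡ total zero =
  ≡.trans (lemma z (c zero)) (≡.cong (ℤ._- z) total)
  where
  lemma : ∀ z c → c ≡ z ℤ.+ (c ℤ.+ 0ℤ) ℤ.- z
  lemma = solveℤ
difference-of-partialSums {suc m} c z s s≡ total zero rewrite s≡ zero = lemma z (c zero)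
  where
  lemma : ∀ z c → c ≡ z ℤ.+ c ℤ.- z
  lemma = solveℤ
difference-of-partialSums {suc m} c z s s≡ total (suc j) = ≡.trans
  (difference-of-partialSums (c ∘ suc) (z ℤ.+ c zero) (s ∘ suc)
    (λ j → ≡.trans (s≡ (suc j)) (≡.sym (ℤₚ.+-assoc z _ _)))
    (≡.trans (ℤₚ.+-assoc z _ _) total) j)
  (≡.cong (λ t → pad back 0ℤ (s ∘ suc) j ℤ.- t) (shift j))
  where
  -- The recursive call starts from `z` plus the first entry, which is `s zero`.
  shift : ∀ j → pad front (z ℤ.+ c zero) (s ∘ suc) j ≡ s j
  shift zero    = ≡.sym (s≡ zero)
  shift (suc j) = ≡.refl

module _ {m} (c : Matrix ℤ (suc m)) (rows : ∀ i → ∑ (c i) ≡ 0ℤ) (cols : ∀ j → ∑ (λ i → c i j) ≡ 0ℤ) where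
  private
    S : Fin (suc m) → Fin m → ℤ
    S i j = partialSum (c i) (inject₁ j)

    D : Matrix ℤ m
    D i j = partialSum (λ p → partialSum (c p) (inject₁ j)) (inject₁ i)

    by-rows : ∀ i j → c i j ≡ pad back 0ℤ (S i) j ℤ.- pad front 0ℤ (S i) j
    by-rows i = difference-of-partialSums (c i) 0ℤ (S i) (λ j → ≡.sym (ℤₚ.+-identityˡ _))
                  (≡.trans (ℤₚ.+-identityˡ _) (rows i))

    by-cols : ∀ j i → S i j ≡ pad back 0ℤ (λ i → D i j) i ℤ.- pad front 0ℤ (λ i → D i j) i
    by-cols j = difference-of-partialSums (λ i → S i j) 0ℤ (λ i → D i j) (λ i → ≡.sym (ℤₚ.+-identityˡ _))
      (≡.trans (ℤₚ.+-identityˡ _)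
        (≡.trans (∑-partialSum c (inject₁ j)) (partialSum-zero _ cols (inject₁ j))))

    pad-cols : ∀ e i j → pad e 0ℤ (S i) j ≡ padMatrix back e 0ℤ D i j ℤ.- padMatrix front e 0ℤ D i j
    pad-cols e i j = ≡.trans (pad-cong e 0ℤ (λ j → by-cols j i) j) (≡.sym (pad-map₂ ℤ._-_ e 0ℤ 0ℤ _ _ j))

  -- Zero row sums express `c` through its row prefixes, and zero column sums express these through
  -- corner sums. Corners reaching the last row or column vanish, so `D` is one smaller in each
  -- direction.
  mixed-difference-of-cornerSums : ∀ i j → c i j ≡
    (padMatrix back back 0ℤ D i j ℤ.+ padMatrix front front 0ℤ D i j) ℤ.-
    (padMatrix front back 0ℤ D i j ℤ.+ padMatrix back front 0ℤ D i j)
  mixed-difference-of-cornerSums i j = ≡.trans (by-rows i j) (≡.trans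
    (≡.cong₂ ℤ._-_ (pad-cols back i j) (pad-cols front i j))
    (lemma (padMatrix back back 0ℤ D i j) _ _ _))
    where
    lemma : ∀ a b c d → (a ℤ.- b) ℤ.- (c ℤ.- d) ≡ (a ℤ.+ d) ℤ.- (b ℤ.+ c)
    lemma = solveℤ

padMatrix-+ : ∀ {m} e e′ (D : Matrix ℕ m) i j →
  + padMatrix e e′ 0 D i j ≡ padMatrix e e′ 0ℤ (λ i j → + D i j) i j
padMatrix-+ e e′ D i j = ≡.trans (pad-map +_ e′ 0 _ j) (pad-cong e′ 0ℤ (λ j → pad-map +_ e 0 _ i) j)

padMatrix-cong : ∀ {a} {A : Set a} {m} e e′ (o : A) {D D′ : Matrix A m} → (∀ i j → D i j ≡ D′ i j) →
  ∀ i j → padMatrix e e′ o D i j ≡ padMatrix e e′ o D′ i j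
padMatrix-cong e e′ o D≗D′ i j = pad-cong e′ o (λ j → pad-cong e o (λ i → D≗D′ i j) i) j

-- Nonnegative corner sums are natural multiplicities; carrying the subtracted terms to the other
-- side leaves an identity in ℕ.
exchange : ∀ {m} (α β : Matrix ℕ (suc m)) → let c = λ i j → + α i j ℤ.- + β i j in
  (∀ i → ∑ (c i) ≡ 0ℤ) → (∀ j → ∑ (λ i → c i j) ≡ 0ℤ) →
  (∀ i j → 0ℤ ℤ.≤ partialSum (λ p → partialSum (c p) j) i) →
  Σ[ D ∈ Matrix ℕ m ] (∀ i j → α i j ℕ.+ antidiagonal D i j ≡ β i j ℕ.+ diagonal D i j)
exchange {m} α β rows cols corner≥0 = D , λ i j → ℤₚ.+-injective (from-difference (+ α i j) (+ β i j)
    (+ diagonal D i j) (+ antidiagonal D i j)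
    (≡.trans (mixed-difference-of-cornerSums c rows cols i j)
      (≡.sym (≡.cong₂ ℤ._-_ (≡.cong₂ ℤ._+_ (to-ℕ back back i j) (to-ℕ front front i j))
                          (≡.cong₂ ℤ._+_ (to-ℕ front back i j) (to-ℕ back front i j))))))
  where
  c : Matrix ℤ (suc m)
  c i j = + α i j ℤ.- + β i j

  Dℤ : Matrix ℤ m
  Dℤ i j = partialSum (λ p → partialSum (c p) (inject₁ j)) (inject₁ i)

  D : Matrix ℕ m
  D i j = ℤ.∣ Dℤ i j ∣

  to-ℕ : ∀ e e′ i j → + padMatrix e e′ 0 D i j ≡ padMatrix e e′ 0ℤ Dℤ i j
  to-ℕ e e′ i j = ≡.trans (padMatrix-+ e e′ D i j)
    (padMatrix-cong e e′ 0ℤ (λ i j → ℤₚ.0≤i⇒+∣i∣≡i (corner≥0 (inject₁ i) (inject₁ j))) i j)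

  from-difference : ∀ a b u v → a ℤ.- b ≡ u ℤ.- v → a ℤ.+ v ≡ b ℤ.+ u
  from-difference a b u v eq = ≡.trans (l₁ a b v) (≡.trans (≡.cong (λ t → t ℤ.+ b ℤ.+ v) eq) (l₂ b u v))
    where
    l₁ : ∀ a b v → a ℤ.+ v ≡ a ℤ.- b ℤ.+ b ℤ.+ v
    l₁ = solveℤ
    l₂ : ∀ b u v → u ℤ.- v ℤ.+ b ℤ.+ v ≡ b ℤ.+ u
    l₂ = solveℤ

-- Exchanges between matrices with unit line sums, and their effect on the power of q.

open Combination ℕₚ.+-0-commutativeMonoid using ()
  renaming ( combination to weighted; combination-+ to weighted-+; combination-cong to weighted-cong
           ; combination-∙ to weighted-∙; combination-pure to weighted-zero
           ; combination-diagonal to weighted-diagonal; combination-antidiagonal to weighted-antidiagonal)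

∑-- : ∀ {n} (f g : Vector ℤ n) → ∑ (λ i → f i ℤ.- g i) ≡ ∑ f ℤ.- ∑ g
∑-- {zero}  f g = ≡.refl
∑-- {suc n} f g rewrite ∑-- (f ∘ suc) (g ∘ suc) =
  lemma (f zero) (g zero) (∑ (f ∘ suc)) (∑ (g ∘ suc))
  where
  lemma : ∀ a b c d → a ℤ.- b ℤ.+ (c ℤ.- d) ≡ a ℤ.+ c ℤ.- (b ℤ.+ d)
  lemma = solveℤ

corner : ∀ {n} → Matrix ℤ n → Matrix ℤ n
corner c i j = partialSum (λ p → partialSum (c p) j) i

corner-cong : ∀ {n} {c d : Matrix ℤ n} → (∀ i j → c i j ≡ d i j) → ∀ i j → corner c i j ≡ corner d i j
corner-cong c≗d i j = partialSum-cong (λ p → partialSum-cong (c≗d p) j) i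

corner-- : ∀ {n} (a b : Matrix ℤ n) i j →
  corner (λ i j → a i j ℤ.- b i j) i j ≡ corner a i j ℤ.- corner b i j
corner-- a b i j = ≡.trans (partialSum-cong (λ p → partialSum-- (a p) (b p) j) i) (partialSum-- _ _ i)

Doubly1 : ∀ {n} → Matrix ℤ n → Set
Doubly1 a = (∀ i → ∑ (a i) ≡ 1ℤ) × (∀ j → ∑ (λ i → a i j) ≡ 1ℤ)

-- Stated for integer matrices and for any `α`, `β` representing the difference, because it is
-- applied both to a pair of alternating sign matrices and to the identity against one of them.
exchange-doubly1 : ∀ {m} (a b : Matrix ℤ (suc m)) → Doubly1 a → Doubly1 b →
  (∀ i j → corner b i j ℤ.≤ corner a i j) →
  (α β : Matrix ℕ (suc m)) → (∀ i j → + α i j ℤ.- + β i j ≡ a i j ℤ.- b i j) →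
  Σ[ D ∈ Matrix ℕ m ] (∀ i j → α i j ℕ.+ antidiagonal D i j ≡ β i j ℕ.+ diagonal D i j)
exchange-doubly1 a b (ra , ca) (rb , cb) b≤a α β α-β = exchange α β
  (λ i → zero-sum (a i) (b i) (α-β i) (ra i) (rb i))
  (λ j → zero-sum (λ i → a i j) (λ i → b i j) (λ i → α-β i j) (ca j) (cb j))
  (λ i j → ≡.subst (0ℤ ℤ.≤_)
    (≡.sym (≡.trans (corner-cong α-β i j) (corner-- a b i j))) (ℤₚ.i≤j⇒0≤j-i (b≤a i j)))
  where
  zero-sum : ∀ {n} {c : Vector ℤ n} (f g : Vector ℤ n) → (∀ i → c i ≡ f i ℤ.- g i) → ∑ f ≡ 1ℤ → ∑ g ≡ 1ℤ → ∑ c ≡ 0ℤ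
  zero-sum f g c≡ f≡ g≡ = ≡.trans (∑-cong c≡) (≡.trans (∑-- f g) (≡.cong₂ ℤ._-_ f≡ g≡))

pos neg : ℤ → ℕ
pos (+ k)      = k
pos ℤ.-[1+ k ] = 0
neg (+ k)      = 0
neg ℤ.-[1+ k ] = suc k

pos-neg : ∀ z → + pos z ℤ.- + neg z ≡ z
pos-neg (+ k)      = ℤₚ.+-identityʳ (+ k)
pos-neg ℤ.-[1+ k ] = ≡.refl

distance² : ∀ {n} → Matrix ℕ n
distance² i j = ∣ toℕ i - toℕ j ∣ ℕ.^ 2

-- The second difference of a square is the constant 2. Written as `1 + 1`, it makes the accumulated
-- excess visibly a double `e + e`.
distance²-mixed-difference : ∀ {m} (i j : Fin m) →
  distance² (suc i) (inject₁ j) ℕ.+ distance² (inject₁ i) (suc j)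
    ≡ (distance² (inject₁ i) (inject₁ j) ℕ.+ distance² (suc i) (suc j)) ℕ.+ (1 ℕ.+ 1)
distance²-mixed-difference i j rewrite Finₚ.toℕ-inject₁ i | Finₚ.toℕ-inject₁ j = lemma (toℕ i) (toℕ j)
  where
  lemma : ∀ a b → ∣ suc a - b ∣ ℕ.^ 2 ℕ.+ ∣ a - suc b ∣ ℕ.^ 2
                    ≡ (∣ a - b ∣ ℕ.^ 2 ℕ.+ ∣ a - b ∣ ℕ.^ 2) ℕ.+ (1 ℕ.+ 1)
  lemma zero    zero    = ≡.refl
  lemma zero    (suc b) = eq b
    where
    eq : ∀ b → b ℕ.* (b ℕ.* 1) ℕ.+ (2 ℕ.+ b) ℕ.* ((2 ℕ.+ b) ℕ.* 1)
                 ≡ ((1 ℕ.+ b) ℕ.* ((1 ℕ.+ b) ℕ.* 1) ℕ.+ (1 ℕ.+ b) ℕ.* ((1 ℕ.+ b) ℕ.* 1)) ℕ.+ 2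
    eq = solveℕ
  lemma (suc a) zero    rewrite ℕₚ.∣-∣-identityʳ a = eq a
    where
    eq : ∀ a → (2 ℕ.+ a) ℕ.* ((2 ℕ.+ a) ℕ.* 1) ℕ.+ a ℕ.* (a ℕ.* 1)
                 ≡ ((1 ℕ.+ a) ℕ.* ((1 ℕ.+ a) ℕ.* 1) ℕ.+ (1 ℕ.+ a) ℕ.* ((1 ℕ.+ a) ℕ.* 1)) ℕ.+ 2
    eq = solveℕ
  lemma (suc a) (suc b) = lemma a b

exchange-weight : ∀ {m} (D : Matrix ℕ m) (α β : Matrix ℕ (suc m)) →
  (∀ i j → α i j ℕ.+ antidiagonal D i j ≡ β i j ℕ.+ diagonal D i j) →
  ∃[ e ] weighted β distance² ≡ weighted α distance² ℕ.+ (e ℕ.+ e)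
exchange-weight {m} D α β eq = e , ℕₚ.+-cancelʳ-≡ (weighted (diagonal D) distance²) _ _ (begin
  weighted β distance² ℕ.+ weighted (diagonal D) distance²
    ≡⟨ weighted-+ β (diagonal D) distance² ⟨
  weighted (λ i j → β i j ℕ.+ diagonal D i j) distance²
    ≡⟨ weighted-cong {y = distance²} (λ i j → ≡.sym (eq i j)) (λ _ _ → ≡.refl) ⟩
  weighted (λ i j → α i j ℕ.+ antidiagonal D i j) distance²
    ≡⟨ weighted-+ α (antidiagonal D) distance² ⟩
  weighted α distance² ℕ.+ weighted (antidiagonal D) distance²
    ≡⟨ ≡.cong (weighted α distance² ℕ.+_) antidiagonal-weight ⟩
  weighted α distance² ℕ.+ (weighted (diagonal D) distance² ℕ.+ (e ℕ.+ e))
    ≡⟨ swap (weighted α distance²) (weighted (diagonal D) distance²) (e ℕ.+ e) ⟩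
  weighted α distance² ℕ.+ (e ℕ.+ e) ℕ.+ weighted (diagonal D) distance² ∎)
  where
  open ≡.≡-Reasoning
  -- The total number of exchanged blocks, each of which contributes 2.
  e = weighted D (λ _ _ → 1)

  swap : ∀ a b c → a ℕ.+ (b ℕ.+ c) ≡ a ℕ.+ c ℕ.+ b
  swap = solveℕ

  w-diag : Matrix ℕ m
  w-diag i j = distance² (inject₁ i) (inject₁ j) ℕ.+ distance² (suc i) (suc j)

  antidiagonal-weight : weighted (antidiagonal D) distance² ≡ weighted (diagonal D) distance² ℕ.+ (e ℕ.+ e)
  antidiagonal-weight = begin
    weighted (antidiagonal D) distance²
      ≡⟨ weighted-antidiagonal D distance² ⟩
    weighted D _
      ≡⟨ weighted-cong {E = D} (λ _ _ → ≡.refl) distance²-mixed-difference ⟩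
    weighted D (λ i j → w-diag i j ℕ.+ (1 ℕ.+ 1))
      ≡⟨ weighted-∙ D w-diag (λ _ _ → 2) ⟩
    weighted D w-diag ℕ.+ weighted D (λ _ _ → 1 ℕ.+ 1)
      ≡⟨ ≡.cong₂ ℕ._+_ (≡.sym (weighted-diagonal D distance²)) (weighted-∙ D (λ _ _ → 1) (λ _ _ → 1)) ⟩
    weighted (diagonal D) distance² ℕ.+ (e ℕ.+ e) ∎

identity : ∀ {n} → Matrix ℕ n
identity zero    zero    = 1
identity zero    (suc j) = 0
identity (suc i) zero    = 0
identity (suc i) (suc j) = identity i j

identity-sym : ∀ {n} (i j : Fin n) → identity i j ≡ identity j i
identity-sym zero    zero    = ≡.refl
identity-sym zero    (suc j) = ≡.refl
identity-sym (suc i) zero    = ≡.refl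
identity-sym (suc i) (suc j) = identity-sym i j

∑-identity : ∀ {n} (i : Fin n) → ∑ (λ j → + identity i j) ≡ 1ℤ
∑-identity {suc n} zero    = ≡.cong (λ t → 1ℤ ℤ.+ t) (∑-zero n)
∑-identity {suc n} (suc i) = ≡.trans (ℤₚ.+-identityˡ _) (∑-identity i)

identity-doubly1 : ∀ {n} → Doubly1 (λ (i j : Fin n) → + identity i j)
identity-doubly1 = ∑-identity ,
  λ j → ≡.trans (∑-cong (λ i → ≡.cong +_ (identity-sym i j))) (∑-identity j)

partialSum-identity : ∀ {n} (p j : Fin n) → p Fin.≤ j → partialSum (λ q → + identity p q) j ≡ 1ℤ
partialSum-identity zero    zero    p≤j = ≡.refl
partialSum-identity zero    (suc j) p≤j = ≡.cong (λ t → 1ℤ ℤ.+ t) (partialSum-zero _ (λ _ → ≡.refl) j)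
partialSum-identity (suc p) (suc j) (ℕ.s≤s p≤j) =
  ≡.trans (ℤₚ.+-identityˡ _) (partialSum-identity p j p≤j)

weighted-identity : ∀ {n} → weighted {n} identity distance² ≡ 0
weighted-identity {n} = weighted-zero {n} identity distance² (λ i j → term i j)
  where
  open RawMonoidOps ℕ.+-0-rawMonoid using () renaming (_×_ to _×ₙ_)
  term : ∀ {n} (i j : Fin n) → identity i j ×ₙ distance² i j ≡ 0
  term zero    zero    = ≡.refl
  term zero    (suc j) = ≡.refl
  term (suc i) zero    = ≡.refl
  term (suc i) (suc j) = term i j

-- Exponent matrices of alternating sign matrices.

module _ {n} (A : ASM n) where
  open ASM A

  positivePart negativePart : Matrix ℕ n
  positivePart i j = pos (entry i j)
  negativePart i j = neg (entry i j)

  ASM-doubly1 : Doubly1 entry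
  ASM-doubly1 = row-sum , col-sum

  -- Each prefix of each row or column has sum at most 1, which the identity attains
  -- for the prefixes reaching the diagonal.
  corner≤identity : ∀ i j → corner entry i j ℤ.≤ corner (λ i j → + identity i j) i j
  corner≤identity i j = [ by-rows , by-cols ]′ (ℕₚ.≤-total (toℕ i) (toℕ j))
    where
    ≤1 : ∀ {z} → z ≡ 0ℤ ⊎ z ≡ 1ℤ → z ℤ.≤ 1ℤ
    ≤1 (inj₁ ≡.refl) = ℤ.+≤+ ℕ.z≤n
    ≤1 (inj₂ ≡.refl) = ℤₚ.≤-refl

    by-rows : i Fin.≤ j → corner entry i j ℤ.≤ corner (λ i j → + identity i j) i j
    by-rows i≤j = partialSum-mono _ _ i λ p p≤i →
      ℤₚ.≤-trans (≤1 (row-partial p j))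
        (ℤₚ.≤-reflexive (≡.sym (partialSum-identity p j (ℕₚ.≤-trans p≤i i≤j))))

    by-cols : j Fin.≤ i → corner entry i j ℤ.≤ corner (λ i j → + identity i j) i j
    by-cols j≤i = ≡.subst₂ ℤ._≤_ (≡.sym (partialSum-comm entry i j))
      (≡.sym (≡.trans (partialSum-comm (λ p q → + identity p q) i j)
        (partialSum-cong (λ q → partialSum-cong (λ p → ≡.cong +_ (identity-sym p q)) i) j)))
      (partialSum-mono _ _ j λ q q≤j →
        ℤₚ.≤-trans (≤1 (col-partial i q))
          (ℤₚ.≤-reflexive (≡.sym (partialSum-identity q i (ℕₚ.≤-trans q≤j j≤i)))))

  -- The exponent of q in the monomial x_q^A.
  q-exponent : ∃[ e ] weighted positivePart distance² ≡ weighted negativePart distance² ℕ.+ (e ℕ.+ e)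
  q-exponent = go n entry positivePart negativePart ASM-doubly1 corner≤identity (λ i j → pos-neg (entry i j))
    where
    -- The size is a variable here because an exchange needs it to be a successor.
    go : ∀ n (a : Matrix ℤ n) (p q : Matrix ℕ n) → Doubly1 a →
      (∀ i j → corner a i j ℤ.≤ corner (λ i j → + identity i j) i j) →
      (∀ i j → + p i j ℤ.- + q i j ≡ a i j) →
      ∃[ e ] weighted p distance² ≡ weighted q distance² ℕ.+ (e ℕ.+ e)
    go zero    a p q da ≤I p-q = 0 , ≡.refl
    go (suc m) a p q da ≤I p-q =
      -- The identity has the largest corner sums and weight 0, so exchanging from `identity + q` to
      -- `p` measures the weight of `p` against that of `q`.
      let D , eq = exchange-doubly1 (λ i j → + identity i j) a identity-doubly1 da ≤I
                     (λ i j → identity i j ℕ.+ q i j) p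
                     (λ i j → ≡.trans (lemma (+ identity i j) (+ p i j) (+ q i j))
                                (≡.cong (λ t → + identity i j ℤ.- t) (p-q i j)))
          e , eq′ = exchange-weight D (λ i j → identity i j ℕ.+ q i j) p eq
      in e , ≡.trans eq′ (≡.cong (ℕ._+ (e ℕ.+ e))
               (≡.trans (weighted-+ (identity {suc m}) q distance²)
                        (≡.cong (ℕ._+ weighted q distance²) (weighted-identity {suc m}))))
      where
      lemma : ∀ i p q → (i ℤ.+ q) ℤ.- p ≡ i ℤ.- (p ℤ.- q)
      lemma = solveℤ

-- Dividing x^A and x^B by x^(A⁻+B⁻) leaves the monomials with these exponents.
numerators : ∀ {n} → ASM n → ASM n → Matrix ℕ n
numerators A B i j = positivePart A i j ℕ.+ negativePart B i j

numerators-difference : ∀ {n} (A B : ASM n) i j →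
  + numerators A B i j ℤ.- + numerators B A i j ≡ ASM.entry A i j ℤ.- ASM.entry B i j
numerators-difference A B i j = ≡.trans
  (lemma (+ pos a) (+ neg a) (+ pos b) (+ neg b)) (≡.cong₂ ℤ._-_ (pos-neg a) (pos-neg b))
  where
  a = ASM.entry A i j
  b = ASM.entry B i j
  lemma : ∀ a a′ b b′ → (a ℤ.+ b′) ℤ.- (b ℤ.+ a′) ≡ (a ℤ.- a′) ℤ.- (b ℤ.- b′)
  lemma = solveℤ

≤ASM⇒exchange : ∀ {m} (A B : ASM (suc m)) → A ≤ASM B → Σ[ D ∈ Matrix ℕ m ]
  (∀ i j → numerators A B i j ℕ.+ antidiagonal D i j ≡ numerators B A i j ℕ.+ diagonal D i j)
≤ASM⇒exchange A B A≤B = exchange-doubly1 (ASM.entry A) (ASM.entry B) (ASM-doubly1 A) (ASM-doubly1 B)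
  A≤B (numerators A B) (numerators B A) (numerators-difference A B)

-- Exponents that separate two matrices at a corner.

-- The truth value of `i ≤ r`, by the same recursion as `partialSum`.
indicator : ∀ {n} → Fin n → Fin n → ℕ
indicator r       zero    = 1
indicator zero    (suc i) = 0
indicator (suc r) (suc i) = indicator r i

partialSum≡∑ : ∀ {n} (f : Vector ℤ n) r → partialSum f r ≡ ∑ (λ i → f i ℤ.* + indicator r i)
partialSum≡∑ {suc n} f zero = ≡.sym (≡.trans
  (≡.cong₂ ℤ._+_ (ℤₚ.*-identityʳ (f zero))
    (≡.trans (∑-cong λ i → ℤₚ.*-zeroʳ (f (suc i))) (∑-zero n))) (ℤₚ.+-identityʳ (f zero)))
partialSum≡∑ f (suc r) = ≡.cong₂ ℤ._+_ (≡.sym (ℤₚ.*-identityʳ (f zero))) (partialSum≡∑ (f ∘ suc) r)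

indicator-antitone : ∀ {n} (r : Fin n) {i i′} → i Fin.< i′ → indicator r i′ ℕ.≤ indicator r i
indicator-antitone zero    {zero}  {suc i′} _           = ℕ.z≤n
indicator-antitone (suc r) {zero}  {suc i′} _           = ≤1 r i′
  where
  ≤1 : ∀ {n} (r i : Fin n) → indicator r i ℕ.≤ 1
  ≤1 r       zero    = ℕₚ.≤-refl
  ≤1 zero    (suc i) = ℕ.z≤n
  ≤1 (suc r) (suc i) = ≤1 r i
indicator-antitone zero    {suc i} {suc i′} _           = ℕₚ.≤-refl
indicator-antitone (suc r) {suc i} {suc i′} (ℕ.s≤s i<i′) = indicator-antitone r i<i′

-- Strictly supermodular exponents, most of whose weight for large W is in the
-- corner of (r , s).
testExponent : ∀ {n} → Fin n → Fin n → ℕ → Matrix ℕ n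
testExponent r s W i j = toℕ i ℕ.* toℕ j ℕ.+ W ℕ.* (indicator r i ℕ.* indicator s j)

-- The mixed difference of `i * j` is (i′ - i)(j′ - j) ≥ 1. That of the product of two antitone
-- indicators is a product of two nonpositive increments, so adding it with any factor `W` keeps the
-- gap.
testExponent-supermodular : ∀ {n} (r s : Fin n) W {i i′ j j′} → i Fin.< i′ → j Fin.< j′ →
  suc (testExponent r s W i j′ ℕ.+ testExponent r s W i′ j)
    ℕ.≤ testExponent r s W i j ℕ.+ testExponent r s W i′ j′
testExponent-supermodular r s W {i} {i′} {j} {j′} i<i′ j<j′ = begin
  suc (testExponent r s W i j′ ℕ.+ testExponent r s W i′ j)
    ≡⟨ regroup (toℕ i ℕ.* toℕ j′) (toℕ i′ ℕ.* toℕ j) W (u ℕ.* v′) (u′ ℕ.* v) ⟩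
  suc (toℕ i ℕ.* toℕ j′ ℕ.+ toℕ i′ ℕ.* toℕ j) ℕ.+ W ℕ.* (u ℕ.* v′ ℕ.+ u′ ℕ.* v)
    ≤⟨ ℕₚ.+-mono-≤ (strictly (toℕ i) (toℕ i′) (toℕ j) (toℕ j′) i<i′ j<j′)
         (ℕₚ.*-monoʳ-≤ W (weak u u′ v v′ (indicator-antitone r i<i′) (indicator-antitone s j<j′))) ⟩
  (toℕ i ℕ.* toℕ j ℕ.+ toℕ i′ ℕ.* toℕ j′) ℕ.+ W ℕ.* (u ℕ.* v ℕ.+ u′ ℕ.* v′)
    ≡⟨ regroup′ (toℕ i ℕ.* toℕ j) (toℕ i′ ℕ.* toℕ j′) W (u ℕ.* v) (u′ ℕ.* v′) ⟩
  testExponent r s W i j ℕ.+ testExponent r s W i′ j′ ∎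
  where
  open ℕₚ.≤-Reasoning
  u = indicator r i
  u′ = indicator r i′
  v = indicator s j
  v′ = indicator s j′

  regroup : ∀ a b W c d → suc ((a ℕ.+ W ℕ.* c) ℕ.+ (b ℕ.+ W ℕ.* d)) ≡ suc (a ℕ.+ b) ℕ.+ W ℕ.* (c ℕ.+ d)
  regroup = solveℕ
  regroup′ : ∀ a b W c d → (a ℕ.+ b) ℕ.+ W ℕ.* (c ℕ.+ d) ≡ (a ℕ.+ W ℕ.* c) ℕ.+ (b ℕ.+ W ℕ.* d)
  regroup′ = solveℕ

  weak : ∀ u u′ v v′ → u′ ℕ.≤ u → v′ ℕ.≤ v → u ℕ.* v′ ℕ.+ u′ ℕ.* v ℕ.≤ u ℕ.* v ℕ.+ u′ ℕ.* v′
  weak u u′ v v′ u′≤u v′≤v with ℕₚ.m≤n⇒∃[o]m+o≡n u′≤u | ℕₚ.m≤n⇒∃[o]m+o≡n v′≤v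
  ... | a , ≡.refl | b , ≡.refl = ℕₚ.≤-trans (ℕₚ.m≤m+n _ (a ℕ.* b)) (ℕₚ.≤-reflexive (eq u′ v′ a b))
    where
    eq : ∀ u v a b → ((u ℕ.+ a) ℕ.* v ℕ.+ u ℕ.* (v ℕ.+ b)) ℕ.+ a ℕ.* b
                       ≡ (u ℕ.+ a) ℕ.* (v ℕ.+ b) ℕ.+ u ℕ.* v
    eq = solveℕ

  strictly : ∀ i i′ j j′ → i ℕ.< i′ → j ℕ.< j′ →
    suc (i ℕ.* j′ ℕ.+ i′ ℕ.* j) ℕ.≤ i ℕ.* j ℕ.+ i′ ℕ.* j′
  strictly i i′ j j′ i<i′ j<j′ with ℕₚ.m≤n⇒∃[o]m+o≡n i<i′ | ℕₚ.m≤n⇒∃[o]m+o≡n j<j′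
  ... | a , ≡.refl | b , ≡.refl = ℕₚ.≤-trans (ℕₚ.m≤m+n _ (a ℕ.+ b ℕ.+ a ℕ.* b)) (ℕₚ.≤-reflexive (eq i j a b))
    where
    eq : ∀ i j a b → suc (i ℕ.* (suc j ℕ.+ b) ℕ.+ (suc i ℕ.+ a) ℕ.* j) ℕ.+ (a ℕ.+ b ℕ.+ a ℕ.* b)
                       ≡ i ℕ.* j ℕ.+ (suc i ℕ.+ a) ℕ.* (suc j ℕ.+ b)
    eq = solveℕ

weightedℤ : ∀ {n} → Matrix ℤ n → Matrix ℤ n → ℤ
weightedℤ c y = ∑ λ i → ∑ λ j → c i j ℤ.* y i j

+weighted : ∀ {n} (E y : Matrix ℕ n) → + weighted E y ≡ weightedℤ (λ i j → + E i j) (λ i j → + y i j)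
+weighted E y = +-∑ _ _ λ i → +-∑ _ _ λ j → +-× (E i j) (y i j)
  where
  open RawMonoidOps ℕ.+-0-rawMonoid using () renaming (_×_ to _×ₙ_; sum to ∑ₙ)

  +-∑ : ∀ {k} (v : Vector ℕ k) (w : Vector ℤ k) → (∀ i → + v i ≡ w i) → + ∑ₙ v ≡ ∑ w
  +-∑ {zero}  v w v≗w = ≡.refl
  +-∑ {suc k} v w v≗w = ≡.cong₂ ℤ._+_ (v≗w zero) (+-∑ (v ∘ suc) (w ∘ suc) (v≗w ∘ suc))

  +-× : ∀ k l → + (k ×ₙ l) ≡ + k ℤ.* + l
  +-× zero    l = ≡.refl
  +-× (suc k) l = ≡.trans (≡.cong (λ t → + l ℤ.+ t) (+-× k l)) (≡.sym (ℤₚ.suc-* (+ k) (+ l)))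

weightedℤ-linear : ∀ {n} (c d f y z : Matrix ℤ n) W →
  (∀ i j → f i j ≡ y i j ℤ.+ W ℤ.* z i j) →
  weightedℤ c f ℤ.- weightedℤ d f ≡ weightedℤ (λ i j → c i j ℤ.- d i j) y
                                     ℤ.+ W ℤ.* weightedℤ (λ i j → c i j ℤ.- d i j) z
weightedℤ-linear c d f y z W f≡ = ∑-linear _ _ _ _ λ i → ∑-linear _ _ _ _ λ j →
  ≡.trans (≡.cong (λ t → c i j ℤ.* t ℤ.- d i j ℤ.* t) (f≡ i j)) (lemma (c i j) (d i j) (y i j) W (z i j))
  where
  lemma : ∀ c d y W z → c ℤ.* (y ℤ.+ W ℤ.* z) ℤ.- d ℤ.* (y ℤ.+ W ℤ.* z)
                          ≡ (c ℤ.- d) ℤ.* y ℤ.+ W ℤ.* ((c ℤ.- d) ℤ.* z)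
  lemma = solveℤ

  ∑-linear : ∀ {k} (p q u v : Vector ℤ k) → (∀ i → p i ℤ.- q i ≡ u i ℤ.+ W ℤ.* v i) →
             ∑ p ℤ.- ∑ q ≡ ∑ u ℤ.+ W ℤ.* ∑ v
  ∑-linear {zero}  p q u v hyp = ≡.sym (≡.trans (ℤₚ.+-identityˡ _) (ℤₚ.*-zeroʳ W))
  ∑-linear {suc k} p q u v hyp = ≡.trans (split (p zero) _ (q zero) _)
    (≡.trans (≡.cong₂ ℤ._+_ (hyp zero) (∑-linear (p ∘ suc) (q ∘ suc) (u ∘ suc) (v ∘ suc) (hyp ∘ suc)))
      (merge (u zero) _ W (v zero) _))
    where
    split : ∀ a b c d → (a ℤ.+ b) ℤ.- (c ℤ.+ d) ≡ (a ℤ.- c) ℤ.+ (b ℤ.- d)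
    split = solveℤ
    merge : ∀ a b W c d → (a ℤ.+ W ℤ.* c) ℤ.+ (b ℤ.+ W ℤ.* d) ≡ (a ℤ.+ b) ℤ.+ W ℤ.* (c ℤ.+ d)
    merge = solveℤ

weightedℤ-indicator : ∀ {n} (c : Matrix ℤ n) r s →
  weightedℤ c (λ i j → + (indicator r i ℕ.* indicator s j)) ≡ corner c r s
weightedℤ-indicator c r s = ≡.sym (≡.trans (partialSum≡∑ _ r) (∑-cong λ i →
  ≡.trans (≡.cong (ℤ._* + indicator r i) (partialSum≡∑ (c i) s))
    (≡.trans (*-distribʳ-sum (+ indicator r i) (λ j → c i j ℤ.* + indicator s j)) (∑-cong λ j →
      ≡.trans (lemma (c i j) (+ indicator s j) (+ indicator r i))
        (≡.cong (c i j ℤ.*_) (≡.sym (ℤₚ.pos-* (indicator r i) (indicator s j))))))))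
  where
  open Algebra.Properties.Semiring.Sum ℤₚ.+-*-semiring using (*-distribʳ-sum)
  lemma : ∀ c s r → c ℤ.* s ℤ.* r ≡ c ℤ.* (r ℤ.* s)
  lemma = solveℤ

-- The difference of the weights is affine in `W`, and its slope is the difference of the corner
-- sums, at most -1.
separating-exponent : ∀ {n} (A B : ASM n) r s → cornerSum A r s ℤ.< cornerSum B r s →
  ∃[ W ] weighted (numerators A B) (testExponent r s W) ℕ.< weighted (numerators B A) (testExponent r s W)
separating-exponent {n} A B r s A<B = W , ℤₚ.drop‿+<+ (≡.subst₂ ℤ._<_
    (≡.sym (+weighted (numerators A B) _)) (≡.sym (+weighted (numerators B A) _))
    (from-difference (≡.subst (ℤ._< 0ℤ) (≡.sym difference) negative)))
  where
  c : Matrix ℤ n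
  c i j = + numerators A B i j ℤ.- + numerators B A i j

  X = weightedℤ c (λ i j → + (toℕ i ℕ.* toℕ j))
  -- One more than needed to cancel the constant term, so that the difference is at most -1.
  W = suc ℤ.∣ X ∣

  difference : weightedℤ (λ i j → + numerators A B i j) (λ i j → + testExponent r s W i j)
                 ℤ.- weightedℤ (λ i j → + numerators B A i j) (λ i j → + testExponent r s W i j)
               ≡ X ℤ.+ + W ℤ.* (cornerSum A r s ℤ.- cornerSum B r s)
  difference = ≡.trans
    (weightedℤ-linear (λ i j → + numerators A B i j) (λ i j → + numerators B A i j) _
      (λ i j → + (toℕ i ℕ.* toℕ j)) (λ i j → + (indicator r i ℕ.* indicator s j)) (+ W)
      (λ i j → ≡.cong (λ t → + (toℕ i ℕ.* toℕ j) ℤ.+ t)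
        (ℤₚ.pos-* W (indicator r i ℕ.* indicator s j))))
    (≡.cong (λ t → X ℤ.+ + W ℤ.* t) (≡.trans (weightedℤ-indicator c r s)
      (≡.trans (corner-cong (numerators-difference A B) r s)
        (corner-- (ASM.entry A) (ASM.entry B) r s))))

  from-difference : ∀ {a b} → a ℤ.- b ℤ.< 0ℤ → a ℤ.< b
  from-difference {a} {b} a-b<0 = ≡.subst₂ ℤ._<_ (lemma a b) (ℤₚ.+-identityˡ b) (ℤₚ.+-monoˡ-< b a-b<0)
    where
    lemma : ∀ a b → a ℤ.- b ℤ.+ b ≡ a
    lemma = solveℤ

  gap : cornerSum A r s ℤ.- cornerSum B r s ℤ.≤ -1ℤ
  gap = ≡.subst₂ ℤ._≤_ (l₁ (cornerSum A r s) (cornerSum B r s)) (l₂ (cornerSum B r s))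
    (ℤₚ.+-monoˡ-≤ (ℤ.- (1ℤ ℤ.+ cornerSum B r s)) (ℤₚ.i<j⇒suc[i]≤j A<B))
    where
    l₁ : ∀ a b → (1ℤ ℤ.+ a) ℤ.+ ℤ.- (1ℤ ℤ.+ b) ≡ a ℤ.- b
    l₁ = solveℤ
    l₂ : ∀ b → b ℤ.+ ℤ.- (1ℤ ℤ.+ b) ≡ -1ℤ
    l₂ = solveℤ

  negative : X ℤ.+ + W ℤ.* (cornerSum A r s ℤ.- cornerSum B r s) ℤ.< 0ℤ
  negative = begin-strict
    X ℤ.+ + W ℤ.* (cornerSum A r s ℤ.- cornerSum B r s)
      ≤⟨ ℤₚ.+-monoʳ-≤ X (ℤₚ.*-monoˡ-≤-nonNeg (+ W) gap) ⟩
    X ℤ.+ + W ℤ.* -1ℤ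
      ≤⟨ ℤₚ.+-monoˡ-≤ (+ W ℤ.* -1ℤ) (i≤∣i∣ X) ⟩
    + ℤ.∣ X ∣ ℤ.+ + W ℤ.* -1ℤ
      ≡⟨ lemma (+ ℤ.∣ X ∣) ⟩
    -1ℤ
      <⟨ ℤ.-<+ ⟩
    0ℤ ∎
    where
    open ℤₚ.≤-Reasoning
    i≤∣i∣ : ∀ i → i ℤ.≤ + ℤ.∣ i ∣
    i≤∣i∣ (+ k)      = ℤₚ.≤-refl
    i≤∣i∣ ℤ.-[1+ k ] = ℤ.-≤+
    lemma : ∀ k → k ℤ.+ (1ℤ ℤ.+ k) ℤ.* -1ℤ ≡ -1ℤ
    lemma = solveℤ

-- Ring normalisation and small determinants.

module RingSolver {a ℓ} (R : CommutativeRing a ℓ) where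
  open CommutativeRing R
  open Algebra.Properties.Ring ring
  open Algebra.Properties.Semiring.Mult.TCOptimised semiring renaming (_×_ to _·_)
  open import Relation.Binary.Reasoning.Setoid setoid

  -- Integer coefficients have decidable equality, which elements of `R` need not have. The
  -- optimised multiple `1 · 1#` is `1#` by definition, so normalised terms match the goals as
  -- written.
  ⟦_⟧ℤ : ℤ → Carrier
  ⟦ + k ⟧ℤ      = k · 1#
  ⟦ ℤ.-[1+ k ] ⟧ℤ = - (suc k · 1#)

  -‿homo : ∀ z → ⟦ ℤ.- z ⟧ℤ ≈ - ⟦ z ⟧ℤ
  -‿homo (+ zero)     = sym -0#≈0#
  -‿homo (+ suc k)    = refl
  -‿homo ℤ.-[1+ k ] = sym (-‿involutive _)

  ⊖-homo : ∀ m n → ⟦ m ℤ.⊖ n ⟧ℤ ≈ m · 1# - n · 1#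
  ⊖-homo m       zero    = sym (trans (+-congˡ -0#≈0#) (+-identityʳ _))
  ⊖-homo zero    (suc n) = sym (+-identityˡ _)
  ⊖-homo (suc m) (suc n) = begin
    ⟦ suc m ℤ.⊖ suc n ⟧ℤ             ≡⟨ ≡.cong ⟦_⟧ℤ (ℤₚ.[1+m]⊖[1+n]≡m⊖n m n) ⟩
    ⟦ m ℤ.⊖ n ⟧ℤ                     ≈⟨ ⊖-homo m n ⟩
    m · 1# - n · 1#                  ≈⟨ xyx⁻¹≈y 1# (m · 1# - n · 1#) ⟨
    1# + (m · 1# - n · 1#) - 1#      ≈⟨ +-congʳ (+-assoc _ _ _) ⟨
    1# + m · 1# - n · 1# - 1#        ≈⟨ +-assoc _ _ _ ⟩
    1# + m · 1# + (- (n · 1#) - 1#)  ≈⟨ +-congˡ (-‿+-comm _ _) ⟩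
    1# + m · 1# - (n · 1# + 1#)      ≈⟨ +-cong (1+× m 1#) (-‿cong (trans (1+× n 1#) (+-comm _ _))) ⟨
    suc m · 1# - suc n · 1#          ∎

  +-homo : ∀ y z → ⟦ y ℤ.+ z ⟧ℤ ≈ ⟦ y ⟧ℤ + ⟦ z ⟧ℤ
  +-homo (+ m)      (+ n)      = ×-homo-+ 1# m n
  +-homo (+ m)      ℤ.-[1+ n ] = ⊖-homo m (suc n)
  +-homo ℤ.-[1+ m ] (+ n)      = trans (⊖-homo n (suc m)) (+-comm _ _)
  +-homo ℤ.-[1+ m ] ℤ.-[1+ n ] = begin
    - (suc (suc (m ℕ.+ n)) · 1#)       ≡⟨ ≡.cong (λ k → - (suc k · 1#)) (≡.sym (ℕₚ.+-suc m n)) ⟩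
    - ((suc m ℕ.+ suc n) · 1#)         ≈⟨ -‿cong (×-homo-+ 1# (suc m) (suc n)) ⟩
    - (suc m · 1# + suc n · 1#)        ≈⟨ -‿+-comm _ _ ⟨
    - (suc m · 1#) + - (suc n · 1#)    ∎

  *-homo : ∀ y z → ⟦ y ℤ.* z ⟧ℤ ≈ ⟦ y ⟧ℤ * ⟦ z ⟧ℤ
  *-homo = by-sign
    where
    positive : ∀ m n → ⟦ + m ℤ.* + n ⟧ℤ ≈ ⟦ + m ⟧ℤ * ⟦ + n ⟧ℤ
    positive m n = trans (reflexive (≡.cong ⟦_⟧ℤ (≡.sym (ℤₚ.pos-* m n)))) (×1-homo-* m n)

    by-signʳ : ∀ m z → ⟦ + m ℤ.* z ⟧ℤ ≈ ⟦ + m ⟧ℤ * ⟦ z ⟧ℤ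
    by-signʳ m (+ n)      = positive m n
    by-signʳ m ℤ.-[1+ n ] = begin
      ⟦ + m ℤ.* ℤ.- + suc n ⟧ℤ    ≡⟨ ≡.cong ⟦_⟧ℤ (≡.sym (ℤₚ.neg-distribʳ-* (+ m) (+ suc n))) ⟩
      ⟦ ℤ.- (+ m ℤ.* + suc n) ⟧ℤ  ≈⟨ -‿homo (+ m ℤ.* + suc n) ⟩
      - ⟦ + m ℤ.* + suc n ⟧ℤ      ≈⟨ -‿cong (positive m (suc n)) ⟩
      - (⟦ + m ⟧ℤ * ⟦ + suc n ⟧ℤ) ≈⟨ -‿distribʳ-* _ _ ⟩
      ⟦ + m ⟧ℤ * - ⟦ + suc n ⟧ℤ   ∎

    by-sign : ∀ y z → ⟦ y ℤ.* z ⟧ℤ ≈ ⟦ y ⟧ℤ * ⟦ z ⟧ℤ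
    by-sign (+ m)      z = by-signʳ m z
    by-sign ℤ.-[1+ m ] z = begin
      ⟦ ℤ.- + suc m ℤ.* z ⟧ℤ   ≡⟨ ≡.cong ⟦_⟧ℤ (≡.sym (ℤₚ.neg-distribˡ-* (+ suc m) z)) ⟩
      ⟦ ℤ.- (+ suc m ℤ.* z) ⟧ℤ ≈⟨ -‿homo (+ suc m ℤ.* z) ⟩
      - ⟦ + suc m ℤ.* z ⟧ℤ     ≈⟨ -‿cong (by-signʳ (suc m) z) ⟩
      - (⟦ + suc m ⟧ℤ * ⟦ z ⟧ℤ) ≈⟨ -‿distribˡ-* _ _ ⟩
      - ⟦ + suc m ⟧ℤ * ⟦ z ⟧ℤ  ∎

  ℤ-coefficients : ℤ.+-*-rawRing -Raw-AlmostCommutative⟶ fromCommutativeRing R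
  ℤ-coefficients = record
    { ⟦_⟧ = ⟦_⟧ℤ ; +-homo = +-homo ; *-homo = *-homo ; -‿homo = -‿homo ; 0-homo = refl ; 1-homo = refl }

  coefficient≟ : ∀ y z → Maybe (⟦ y ⟧ℤ ≈ ⟦ z ⟧ℤ)
  coefficient≟ y z with y ℤₚ.≟ z
  ... | yes y≡z = just (reflexive (≡.cong ⟦_⟧ℤ y≡z))
  ... | no  _   = nothing

  open Algebra.Solver.Ring ℤ.+-*-rawRing (fromCommutativeRing R) ℤ-coefficients coefficient≟ public
    using (solve; _:=_; _:+_; _:*_; _:-_; :-_; con)

module SmallMinors {a ℓ} (R : CommutativeRing a ℓ) where
  open CommutativeRing R hiding (zero)
  open Determinant R
  open RingSolver R
  open RawSemiringOps (Semiring.rawSemiring semiring) using (sum; _^_)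

  det-cong : ∀ {k} {M N : Matrix Carrier k} → (∀ i j → M i j ≈ N i j) → det M ≈ det N
  det-cong {zero}  M≈N = refl
  det-cong {suc k} M≈N = sum-cong λ j →
    *-congˡ {(- 1#) ^ toℕ j} (*-cong (M≈N zero j) (det-cong λ r c → M≈N (suc r) (punchIn j c)))
    where
    sum-cong : ∀ {n} {f g : Vector Carrier n} → (∀ i → f i ≈ g i) → sum f ≈ sum g
    sum-cong {zero}  f≈g = refl
    sum-cong {suc n} f≈g = +-cong (f≈g zero) (sum-cong (f≈g ∘ suc))

  det₁ : (M : Matrix Carrier 1) → det M ≈ M zero zero
  det₁ M = solve 1 (λ a → con 1ℤ :* (a :* con 1ℤ) :+ con 0ℤ := a) refl (M zero zero)

  det₂ : (M : Matrix Carrier 2) →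
    det M ≈ M zero zero * M (suc zero) (suc zero) - M zero (suc zero) * M (suc zero) zero
  det₂ M = solve 4 (λ a b c d → con 1ℤ :* (a :* (con 1ℤ :* (d :* con 1ℤ) :+ con 0ℤ))
      :+ (:- con 1ℤ :* con 1ℤ :* (b :* (con 1ℤ :* (c :* con 1ℤ) :+ con 0ℤ)) :+ con 0ℤ)
      := a :* d :- b :* c) refl
    (M zero zero) (M zero (suc zero)) (M (suc zero) zero) (M (suc zero) (suc zero))

-- Constructive arithmetic of an ordered field.

module OrderedField {c ℓ₁ ℓ₂} (ℝ : Reals c ℓ₁ ℓ₂) where
  open Reals ℝ public using (commutativeRing; _<_; _≤_; _#_; _^_) renaming (*-pos to pos-*; #⇒< to sign)
  open Reals ℝ using (isStrictPartialOrder; <⇒#; +-monoʳ-<;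
                      #-cotrans; #-sym; #⇒invertible; invertible⇒#; tight)
  open CommutativeRing commutativeRing public hiding (zero)
  open RingSolver commutativeRing public
  open IsStrictPartialOrder isStrictPartialOrder public
    using () renaming (irrefl to <-irrefl; trans to <-trans; <-respʳ-≈ to <-respʳ; <-respˡ-≈ to <-respˡ)
  open Sum +-commutativeMonoid public
    using (sum; sum-cong-≋; ∑-comm; ∑-distrib-+)
  open Algebra.Properties.Semiring.Sum semiring public using (*-distribˡ-sum; *-distribʳ-sum)

  +-cancel-< : ∀ x {y z} → x + y < x + z → y < z
  +-cancel-< x {y} {z} x+y<x+z = <-respˡ (lemma x y) (<-respʳ (lemma x z) (+-monoʳ-< (- x) x+y<x+z))
    where
    lemma : ∀ x y → - x + (x + y) ≈ y
    lemma = solve 2 (λ x y → :- x :+ (x :+ y) := y) refl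

  <⇒0<- : ∀ {x y} → x < y → 0# < y - x
  <⇒0<- {x} {y} x<y = <-respˡ (-‿inverseˡ x) (<-respʳ (+-comm _ _) (+-monoʳ-< (- x) x<y))

  0<-⇒< : ∀ {x y} → 0# < y - x → x < y
  0<-⇒< {x} {y} 0<y-x = <-respˡ (+-identityʳ x) (<-respʳ (lemma x y) (+-monoʳ-< x 0<y-x))
    where
    lemma : ∀ x y → x + (y - x) ≈ y
    lemma = solve 2 (λ x y → x :+ (y :- x) := y) refl

  neg⇒0<- : ∀ {x} → x < 0# → 0# < - x
  neg⇒0<- x<0 = <-respʳ (+-identityˡ _) (<⇒0<- x<0)

  0<-⇒neg : ∀ {x} → 0# < - x → x < 0#
  0<-⇒neg 0<-x = 0<-⇒< (<-respʳ (sym (+-identityˡ _)) 0<-x)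

  nonneg-resp : ∀ {x y} → x ≈ y → 0# ≤ x → 0# ≤ y
  nonneg-resp x≈y 0≤x y<0 = 0≤x (<-respˡ (sym x≈y) y<0)

  pos⇒nonneg : ∀ {x} → 0# < x → 0# ≤ x
  pos⇒nonneg 0<x x<0 = <-irrefl refl (<-trans 0<x x<0)

  nonneg-0 : 0# ≤ 0#
  nonneg-0 = <-irrefl refl

  invertible⇒#0 : ∀ {x y} → x * y ≈ 1# → x # 0#
  invertible⇒#0 {x} {y} xy≈1 = invertible⇒# (y , trans (*-congˡ x-0) (trans (*-comm y x) xy≈1) ,
                                                 trans (*-congʳ x-0) xy≈1)
    where
    x-0 : x - 0# ≈ x
    x-0 = solve 1 (λ x → x :- con 0ℤ := x) refl x

  #0⇒invertible : ∀ {x} → x # 0# → ∃[ y ] x * y ≈ 1#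
  #0⇒invertible {x} x#0 with #⇒invertible x#0
  ... | y , _ , xy≈1 = y , trans (*-congʳ (solve 1 (λ x → x := x :- con 0ℤ) refl x)) xy≈1

  -- Apartness from zero is invertibility, and an inverse of the product yields inverses of both
  -- factors. Once this is known, their signs can be decided.
  *-#0 : ∀ {x y} → (x * y) # 0# → x # 0# × y # 0#
  *-#0 {x} {y} xy#0 with #0⇒invertible xy#0
  ... | z , xyz≈1 = invertible⇒#0 {y = y * z} (trans (sym (*-assoc x y z)) xyz≈1) ,
                    invertible⇒#0 {y = x * z} (trans (lemma x y z) xyz≈1)
    where
    lemma : ∀ x y z → y * (x * z) ≈ x * y * z
    lemma = solve 3 (λ x y z → y :* (x :* z) := x :* y :* z) refl

  neg-* : ∀ {x y} → x < 0# → y < 0# → 0# < x * y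
  neg-* {x} {y} x<0 y<0 = <-respʳ (solve 2 (λ x y → :- x :* :- y := x :* y) refl x y)
    (pos-* (neg⇒0<- x<0) (neg⇒0<- y<0))

  square-pos : ∀ {x} → x # 0# → 0# < x * x
  square-pos x#0 = [ (λ x<0 → neg-* x<0 x<0) , (λ 0<x → pos-* 0<x 0<x) ]′ (sign x#0)

  square-nonneg : ∀ x → 0# ≤ x * x
  square-nonneg x x²<0 = pos⇒nonneg (square-pos (proj₁ (*-#0 (<⇒# x²<0)))) x²<0

  0<1 : 0# < 1#
  0<1 = <-respʳ (*-identityˡ 1#) (square-pos (invertible⇒#0 (*-identityˡ 1#)))

  pos⇒#0 : ∀ {x} → 0# < x → x # 0#
  pos⇒#0 0<x = #-sym (<⇒# 0<x)

  private
    neg-summand : ∀ {x y} → x + y < 0# → 0# < x → y < 0#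
    neg-summand {x} {y} x+y<0 0<x =
      <-trans (+-cancel-< x (<-respʳ (sym (-‿inverseʳ x)) x+y<0)) (0<-⇒neg (<-respʳ x≈--x 0<x))
      where
      x≈--x : x ≈ - - x
      x≈--x = solve 1 (λ x → x := :- :- x) refl x

  -- The sign of `x` cannot be decided in advance, but `x + y < 0#` gives `x + y # x` or `x # 0#` by
  -- cotransitivity, and each apartness can be resolved into an order.
  nonneg-+ : ∀ {x y} → 0# ≤ x → 0# ≤ y → 0# ≤ x + y
  nonneg-+ {x} {y} 0≤x 0≤y x+y<0 = [ by-y , by-x ]′ (#-cotrans (<⇒# x+y<0) x)
    where
    by-x : ¬ (x # 0#)
    by-x x#0 = [ 0≤x , (λ 0<x → 0≤y (neg-summand x+y<0 0<x)) ]′ (sign x#0)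
    by-y : ¬ ((x + y) # x)
    by-y x+y#x = [ (λ lt → 0≤y (+-cancel-< x (<-respʳ (sym (+-identityʳ x)) lt)))
                 , (λ gt → 0≤x (neg-summand (<-respˡ (+-comm x y) x+y<0)
                                 (+-cancel-< x (<-respˡ (sym (+-identityʳ x)) gt)))) ]′ (sign x+y#x)

  nonneg-* : ∀ {x y} → 0# ≤ x → 0# ≤ y → 0# ≤ x * y
  nonneg-* 0≤x 0≤y xy<0 with *-#0 (<⇒# xy<0)
  ... | x#0 , y#0 with sign x#0 | sign y#0
  ... | inj₁ x<0 | _        = 0≤x x<0
  ... | inj₂ 0<x | inj₁ y<0 = 0≤y y<0
  ... | inj₂ 0<x | inj₂ 0<y = pos⇒nonneg (pos-* 0<x 0<y) xy<0

  pos-+-nonneg : ∀ {x y} → 0# < x → 0# ≤ y → 0# < x + y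
  pos-+-nonneg {x} {y} 0<x 0≤y = [ by-sum , by-y ]′ (#-cotrans (<⇒# 0<x) (x + y))
    where
    by-sum : 0# # (x + y) → 0# < x + y
    by-sum 0#x+y = [ (λ pos → pos) , (λ x+y<0 → contradiction x+y<0 (nonneg-+ (pos⇒nonneg 0<x) 0≤y)) ]′ (sign 0#x+y)
    by-y : (x + y) # x → 0# < x + y
    by-y x+y#x = [ (λ lt → contradiction (+-cancel-< x (<-respʳ (sym (+-identityʳ x)) lt)) 0≤y)
                 , <-trans 0<x ]′ (sign x+y#x)

  nonneg-+-pos : ∀ {x y} → 0# ≤ x → 0# < y → 0# < x + y
  nonneg-+-pos 0≤x 0<y = <-respʳ (+-comm _ _) (pos-+-nonneg 0<y 0≤x)

  nonneg-cancel : ∀ {d x} → 0# < d → 0# ≤ d * x → 0# ≤ x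
  nonneg-cancel {d} {x} 0<d 0≤dx x<0 = 0≤dx (0<-⇒neg (<-respʳ
    (solve 2 (λ d x → d :* :- x := :- (d :* x)) refl d x) (pos-* 0<d (neg⇒0<- x<0))))

  pos-cancel : ∀ {d x} → 0# < d → 0# < d * x → 0# < x
  pos-cancel {d} {x} 0<d 0<dx =
    [ (λ x<0 → contradiction x<0 (nonneg-cancel 0<d (pos⇒nonneg 0<dx))) , (λ 0<x → 0<x) ]′
      (sign (proj₂ (*-#0 (pos⇒#0 0<dx))))

  nonneg-halve : ∀ {x} → 0# ≤ x + x → 0# ≤ x
  nonneg-halve {x} 0≤x+x = nonneg-cancel {1# + 1#} (pos-+-nonneg 0<1 (pos⇒nonneg 0<1))
    (nonneg-resp (solve 1 (λ x → x :+ x := (con 1ℤ :+ con 1ℤ) :* x) refl x) 0≤x+x)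

  reciprocal : ∀ {x} → 0# < x → ∃[ y ] 0# < y × x * y ≈ 1#
  reciprocal {x} 0<x with #0⇒invertible (pos⇒#0 0<x)
  ... | y , xy≈1 = y , pos-cancel 0<x (<-respʳ (sym xy≈1) 0<1) , xy≈1

  nonneg-¬pos⇒≈0 : ∀ {x} → 0# ≤ x → ¬ (0# < x) → x ≈ 0#
  nonneg-¬pos⇒≈0 {x} 0≤x ¬0<x = proj₁ (tight x 0#) λ x#0 → [ 0≤x , ¬0<x ]′ (sign x#0)

  pos-^ : ∀ {x} k → 0# < x → 0# < x ^ k
  pos-^ zero    0<x = 0<1
  pos-^ (suc k) 0<x = pos-* 0<x (pos-^ k 0<x)

  nonneg-sum : ∀ {n} (f : Vector Carrier n) → (∀ i → 0# ≤ f i) → 0# ≤ sum f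
  nonneg-sum {zero}  f 0≤f = nonneg-0
  nonneg-sum {suc n} f 0≤f = nonneg-+ (0≤f zero) (nonneg-sum (f ∘ suc) (0≤f ∘ suc))

  pos-sum : ∀ {n} (f : Vector Carrier n) → (∀ i → 0# ≤ f i) → ∀ i → 0# < f i → 0# < sum f
  pos-sum {suc n} f 0≤f zero    0<fi = pos-+-nonneg 0<fi (nonneg-sum (f ∘ suc) (0≤f ∘ suc))
  pos-sum {suc n} f 0≤f (suc i) 0<fi = nonneg-+-pos (0≤f zero) (pos-sum (f ∘ suc) (0≤f ∘ suc) i 0<fi)

  -- The bound |x| ≤ b without an absolute value.
  Within : Carrier → Carrier → Set ℓ₂
  Within b x = 0# ≤ b + x × 0# ≤ b - x

  within-resp : ∀ {b b′ x x′} → b ≈ b′ → x ≈ x′ → Within b x → Within b′ x′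
  within-resp b≈ x≈ (l , u) = nonneg-resp (+-cong b≈ x≈) l , nonneg-resp (+-cong b≈ (-‿cong x≈)) u

  within-mono : ∀ {b b′ x} → 0# ≤ b′ - b → Within b x → Within b′ x
  within-mono {b} {b′} {x} b≤b′ (l , u) =
    nonneg-resp (solve 3 (λ b b′ x → b′ :- b :+ (b :+ x) := b′ :+ x) refl b b′ x) (nonneg-+ b≤b′ l) ,
    nonneg-resp (solve 3 (λ b b′ x → b′ :- b :+ (b :- x) := b′ :- x) refl b b′ x) (nonneg-+ b≤b′ u)

  within-+ : ∀ {a b x y} → Within a x → Within b y → Within (a + b) (x + y)
  within-+ {a} {b} {x} {y} (l , u) (l′ , u′) =
    nonneg-resp (solve 4 (λ a b x y → (a :+ x) :+ (b :+ y) := (a :+ b) :+ (x :+ y)) refl a b x y) (nonneg-+ l l′) ,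
    nonneg-resp (solve 4 (λ a b x y → (a :- x) :+ (b :- y) := (a :+ b) :- (x :+ y)) refl a b x y) (nonneg-+ u u′)

  within-neg : ∀ {b x} → Within b x → Within b (- x)
  within-neg {b} {x} (l , u) =
    u , nonneg-resp (solve 2 (λ b x → b :+ x := b :- (:- x)) refl b x) l

  -- 2(ab ± xy) is a sum of two products of factors of the form a ± x, b ± y.
  within-* : ∀ {a b x y} → Within a x → Within b y → Within (a * b) (x * y)
  within-* {a} {b} {x} {y} (l , u) (l′ , u′) =
    nonneg-halve (nonneg-resp (solve 4 (λ a b x y → (a :+ x) :* (b :+ y) :+ (a :- x) :* (b :- y)
      := (a :* b :+ x :* y) :+ (a :* b :+ x :* y)) refl a b x y) (nonneg-+ (nonneg-* l l′) (nonneg-* u u′))) ,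
    nonneg-halve (nonneg-resp (solve 4 (λ a b x y → (a :- x) :* (b :+ y) :+ (a :+ x) :* (b :- y)
      := (a :* b :- x :* y) :+ (a :* b :- x :* y)) refl a b x y) (nonneg-+ (nonneg-* u l′) (nonneg-* l u′)))

  within-nonneg : ∀ {x} → 0# ≤ x → Within x x
  within-nonneg 0≤x = nonneg-+ 0≤x 0≤x , nonneg-resp (sym (-‿inverseʳ _)) nonneg-0

  -- A bound computed from `x` alone: 2(x² + 1 ± x) = x² + 1 + (x ± 1)².
  within-square+1 : ∀ x → Within (x * x + 1#) x
  within-square+1 x = nonneg-halve (nonneg-resp
      (solve 1 (λ x → x :* x :+ con 1ℤ :+ (x :+ con 1ℤ) :* (x :+ con 1ℤ)
                  := (x :* x :+ con 1ℤ :+ x) :+ (x :* x :+ con 1ℤ :+ x)) refl x)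
      (nonneg-+ x²+1 (square-nonneg (x + 1#)))) ,
    nonneg-halve (nonneg-resp
      (solve 1 (λ x → x :* x :+ con 1ℤ :+ (x :- con 1ℤ) :* (x :- con 1ℤ)
                  := (x :* x :+ con 1ℤ :- x) :+ (x :* x :+ con 1ℤ :- x)) refl x)
      (nonneg-+ x²+1 (square-nonneg (x - 1#))))
    where
    x²+1 : 0# ≤ x * x + 1#
    x²+1 = nonneg-+ (square-nonneg x) (pos⇒nonneg 0<1)

-- Limits with a linear rate.

module Limits {c ℓ₁ ℓ₂} (ℝ : Reals c ℓ₁ ℓ₂) where
  open OrderedField ℝ
  open Reals ℝ using (archimedean; _·_)

  Bounded : (Carrier → Carrier) → Set (c ⊔ ℓ₂)
  Bounded r = ∃[ b ] (∀ ε → 0# < ε → 0# < 1# - ε → Within b (r ε))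

  infix 4 _⇝_

  -- f ε converges to a at a linear rate as ε > 0 tends to 0.
  _⇝_ : (Carrier → Carrier) → Carrier → Set (c ⊔ ℓ₁ ⊔ ℓ₂)
  f ⇝ a = Σ[ r ∈ (Carrier → Carrier) ] Bounded r × (∀ ε → f ε ≈ a + ε * r ε)

  ⇝-resp : ∀ {f a b} → a ≈ b → f ⇝ a → f ⇝ b
  ⇝-resp a≈b (r , bounded , f≈) = r , bounded , λ ε → trans (f≈ ε) (+-congʳ a≈b)

  ⇝-const : ∀ a → (λ _ → a) ⇝ a
  ⇝-const a = (λ _ → 0#) , (0# , λ ε _ _ → within-nonneg nonneg-0) ,
    λ ε → solve 2 (λ a ε → a := a :+ ε :* con 0ℤ) refl a ε

  ⇝-+ : ∀ {f g a b} → f ⇝ a → g ⇝ b → (λ ε → f ε + g ε) ⇝ (a + b)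
  ⇝-+ {a = a} {b} (r , (k , r≤k) , f≈) (s , (l , s≤l) , g≈) = (λ ε → r ε + s ε) ,
    (k + l , λ ε 0<ε ε<1 → within-+ (r≤k ε 0<ε ε<1) (s≤l ε 0<ε ε<1)) ,
    λ ε → trans (+-cong (f≈ ε) (g≈ ε)) (collect a b ε (r ε) (s ε))
    where
    collect : ∀ a b ε r s → (a + ε * r) + (b + ε * s) ≈ (a + b) + ε * (r + s)
    collect = solve 5 (λ a b ε r s → (a :+ ε :* r) :+ (b :+ ε :* s) := (a :+ b) :+ ε :* (r :+ s)) refl

  ⇝-neg : ∀ {f a} → f ⇝ a → (λ ε → - f ε) ⇝ (- a)
  ⇝-neg {a = a} (r , (k , r≤k) , f≈) = (λ ε → - r ε) ,
    (k , λ ε 0<ε ε<1 → within-neg (r≤k ε 0<ε ε<1)) ,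
    λ ε → trans (-‿cong (f≈ ε))
      (solve 3 (λ a ε r → :- (a :+ ε :* r) := :- a :+ ε :* (:- r)) refl a ε (r ε))

  within-ε : ∀ {ε} → 0# < ε → 0# < 1# - ε → Within 1# ε
  within-ε 0<ε ε<1 = within-mono (pos⇒nonneg ε<1) (within-nonneg (pos⇒nonneg 0<ε))

  ⇝-* : ∀ {f g a b} → f ⇝ a → g ⇝ b → (λ ε → f ε * g ε) ⇝ (a * b)
  ⇝-* {a = a} {b} (r , (k , r≤k) , f≈) (s , (l , s≤l) , g≈) = (λ ε → r ε * (b + ε * s ε) + a * s ε) ,
    -- Uses |a| ≤ a² + 1, |b| ≤ b² + 1 and |ε| ≤ 1.
    (k * (b * b + 1# + 1# * l) + (a * a + 1#) * l , λ ε 0<ε ε<1 → within-+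
      (within-* (r≤k ε 0<ε ε<1)
        (within-+ (within-square+1 b) (within-* (within-ε 0<ε ε<1) (s≤l ε 0<ε ε<1))))
      (within-* (within-square+1 a) (s≤l ε 0<ε ε<1))) ,
    λ ε → trans (*-cong (f≈ ε) (g≈ ε)) (expand a b ε (r ε) (s ε))
    where
    expand : ∀ a b ε r s → (a + ε * r) * (b + ε * s) ≈ a * b + ε * (r * (b + ε * s) + a * s)
    expand = solve 5 (λ a b ε r s → (a :+ ε :* r) :* (b :+ ε :* s)
      := a :* b :+ ε :* (r :* (b :+ ε :* s) :+ a :* s)) refl

  ⇝-sum : ∀ {n} (f : Fin n → Carrier → Carrier) (a : Vector Carrier n) → (∀ i → f i ⇝ a i) →
          (λ ε → sum λ i → f i ε) ⇝ sum a
  ⇝-sum {zero}  f a f⇝a = ⇝-const 0#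
  ⇝-sum {suc n} f a f⇝a = ⇝-+ (f⇝a zero) (⇝-sum (f ∘ suc) (a ∘ suc) (f⇝a ∘ suc))

  ⇝-ε : (λ ε → ε) ⇝ 0#
  ⇝-ε = (λ _ → 1#) , (1# , λ ε _ _ → within-nonneg (pos⇒nonneg 0<1)) ,
    λ ε → solve 1 (λ ε → ε := con 0ℤ :+ ε :* con 1ℤ) refl ε

  -- The limit of `ε ^ k`; applied to |i - j| it gives the identity matrix, the limit of the
  -- smoothing kernel.
  0^_ : ℕ → Carrier
  0^ zero  = 1#
  0^ suc k = 0#

  ⇝-^ : ∀ k → (_^ k) ⇝ 0^ k
  ⇝-^ zero    = ⇝-const 1#
  ⇝-^ (suc k) = ⇝-resp (zeroˡ (0^ k)) (⇝-* ⇝-ε (⇝-^ k))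

  nonneg-κ : ∀ k → 0# ≤ k · 1#
  nonneg-κ zero    = nonneg-0
  nonneg-κ (suc k) = nonneg-+ (pos⇒nonneg 0<1) (nonneg-κ k)

  private
    below-1 : ∀ k ε → (1# + k) * ε ≈ (1# + 1# + k) * ε - ε
    below-1 = solve 2 (λ k ε → (con 1ℤ :+ k) :* ε := (con 1ℤ :+ con 1ℤ :+ k) :* ε :- ε) refl

    below-y : ∀ y ε k b y⁻¹ → y * ε * (1# + 1# + (k - b * y⁻¹)) ≈ y * ((1# + 1# + k) * ε) - ε * b * (y * y⁻¹)
    below-y = solve 5 (λ y ε k b y⁻¹ → y :* ε :* (con 1ℤ :+ con 1ℤ :+ (k :- b :* y⁻¹)) :=
      y :* ((con 1ℤ :+ con 1ℤ :+ k) :* ε) :- ε :* b :* (y :* y⁻¹)) refl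

  small : ∀ b {y} → 0# < y → ∃[ ε ] 0# < ε × 0# < 1# - ε × 0# < y - ε * b
  small b {y} 0<y =
    let y⁻¹ , 0<y⁻¹ , yy⁻¹≈1 = reciprocal 0<y
        k , by⁻¹<k = archimedean (b * y⁻¹)
        -- As `k` exceeds b / y, the choice ε = 1 / (2 + k) gives ε b < y; the summand 2 also forces
        -- ε < 1.
        ε , 0<ε , Kε≈1 = reciprocal {1# + 1# + k · 1#} (pos-+-nonneg 0<2 (nonneg-κ k))
    in ε , 0<ε ,
       <-respʳ (trans (below-1 (k · 1#) ε) (+-congʳ Kε≈1)) (pos-* (pos-+-nonneg 0<1 (nonneg-κ k)) 0<ε) ,
       <-respʳ (trans (below-y y ε (k · 1#) b y⁻¹)
           (+-cong (trans (*-congˡ Kε≈1) (*-identityʳ y))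
                   (-‿cong (trans (*-congˡ yy⁻¹≈1) (*-identityʳ (ε * b))))))
         (pos-* (pos-* 0<y 0<ε) (nonneg-+-pos (pos⇒nonneg 0<2) (<⇒0<- by⁻¹<k)))
    where
    0<2 : 0# < 1# + 1#
    0<2 = pos-+-nonneg 0<1 (pos⇒nonneg 0<1)

  -- If `a < 0#`, the linear rate supplies an explicit ε with ε b < - a, and there `f ε` is still
  -- negative.
  limit-nonneg : ∀ {f a} → f ⇝ a → (∀ ε → 0# < ε → 0# < 1# - ε → 0# ≤ f ε) → 0# ≤ a
  limit-nonneg {f} {a} (r , (b , r≤b) , f≈) 0≤f a<0 =
    let ε , 0<ε , ε<1 , εb<-a = small b (neg⇒0<- a<0)
    in 0≤f ε 0<ε ε<1 (0<-⇒neg (<-respʳ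
         (trans (combine a ε b (r ε)) (-‿cong (sym (f≈ ε))))
         (pos-+-nonneg εb<-a (nonneg-* (pos⇒nonneg 0<ε) (proj₂ (r≤b ε 0<ε ε<1))))))
    where
    combine : ∀ a ε b r → (- a - ε * b) + ε * (b - r) ≈ - (a + ε * r)
    combine = solve 4 (λ a ε b r → (:- a :- ε :* b) :+ ε :* (b :- r) := :- (a :+ ε :* r)) refl

-- Nonnegativity up to 2×2 minors, and approximation by positive matrices.

module TotallyNonnegative₂ {c ℓ₁ ℓ₂} (ℝ : Reals c ℓ₁ ℓ₂) where
  open OrderedField ℝ
  open Limits ℝ
  open Algebra.Properties.Semiring.Exp semiring using (^-homo-*)

  -- Sizes 1 and 2 are all that subtraction-free polynomials evaluate, and they are preserved by
  -- products through the 2×2 Cauchy-Binet formula alone.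
  record TN₂ {n} (M : Matrix Carrier n) : Set ℓ₂ where
    field
      entries : ∀ i j → 0# ≤ M i j
      minors  : ∀ {i i′ j j′} → i Fin.< i′ → j Fin.< j′ → 0# ≤ M i j * M i′ j′ - M i j′ * M i′ j
  open TN₂ public

  infixl 7 _⊡_
  _⊡_ : ∀ {n} → Matrix Carrier n → Matrix Carrier n → Matrix Carrier n
  (M ⊡ N) i j = sum λ k → M i k * N k j

  sum-*-sum : ∀ {m n} (f : Vector Carrier m) (g : Vector Carrier n) →
    sum f * sum g ≈ sum λ k → sum λ l → f k * g l
  sum-*-sum f g = trans (*-distribʳ-sum (sum g) f)
    (sum-cong-≋ {x = λ k → f k * sum g} λ k → *-distribˡ-sum (f k) g)

  sum-+ : ∀ {n} (f g : Vector Carrier n) {h : Vector Carrier n} → (∀ k → h k ≈ f k + g k) →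
    sum h ≈ sum f + sum g
  sum-+ f g {h} h≈ = trans (sum-cong-≋ {x = h} h≈) (∑-distrib-+ f g)

  sum-- : ∀ {n} (f g : Vector Carrier n) {h : Vector Carrier n} → (∀ k → f k - g k ≈ h k) →
    sum f - sum g ≈ sum h
  sum-- {zero}  f g h≈ = -‿inverseʳ 0#
  sum-- {suc n} f g h≈ = trans
    (solve 4 (λ a b c d → (a :+ b) :- (c :+ d) := (a :- c) :+ (b :- d)) refl
      (f zero) (sum (f ∘ suc)) (g zero) (sum (g ∘ suc)))
    (+-cong (h≈ zero) (sum-- (f ∘ suc) (g ∘ suc) (h≈ ∘ suc)))

  -- The 2×2 Cauchy–Binet formula, with the sum over pairs k < l replaced by half of the
  -- sum over all pairs.
  TN₂-⊡ : ∀ {n} {M N : Matrix Carrier n} → TN₂ M → TN₂ N → TN₂ (M ⊡ N)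
  TN₂-⊡ {n} {M} {N} tM tN = record
    { entries = λ i j → nonneg-sum _ λ k → nonneg-* (entries tM i k) (entries tN k j)
    ; minors  = λ {i} {i′} {j} {j′} i<i′ j<j′ → nonneg-resp (sym (expand i i′ j j′)) (double-sum i<i′ j<j′)
    }
    where
    f : Fin n → Fin n → Fin n → Fin n → Fin n → Fin n → Carrier
    f i i′ j j′ k l = (M i k * M i′ l) * (N k j * N l j′ - N k j′ * N l j)

    term : ∀ a p d s q r → (a * p) * (d * s) - (a * q) * (d * r) ≈ (a * d) * (p * s - q * r)
    term = solve 6 (λ a p d s q r → (a :* p) :* (d :* s) :- (a :* q) :* (d :* r)
                                      := (a :* d) :* (p :* s :- q :* r)) refl

    expand : ∀ i i′ j j′ → (M ⊡ N) i j * (M ⊡ N) i′ j′ - (M ⊡ N) i j′ * (M ⊡ N) i′ j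
                             ≈ sum λ k → sum λ l → f i i′ j j′ k l
    expand i i′ j j′ = trans
      (+-cong (sum-*-sum (λ k → M i k * N k j) (λ l → M i′ l * N l j′))
              (-‿cong (sum-*-sum (λ k → M i k * N k j′) (λ l → M i′ l * N l j))))
      (sum-- (λ k → sum λ l → (M i k * N k j) * (M i′ l * N l j′))
             (λ k → sum λ l → (M i k * N k j′) * (M i′ l * N l j))
        λ k → sum-- (λ l → (M i k * N k j) * (M i′ l * N l j′))
                    (λ l → (M i k * N k j′) * (M i′ l * N l j))
        λ l → term (M i k) (N k j) (M i′ l) (N l j′) (N k j′) (N l j))

    swap : ∀ u v p s q r → (u - v) * (p * s - q * r) ≈ u * (p * s - q * r) + v * (r * q - s * p)
    swap = solve 6 (λ u v p s q r → (u :- v) :* (p :* s :- q :* r)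
                      := u :* (p :* s :- q :* r) :+ v :* (r :* q :- s :* p)) refl

    flip-signs : ∀ u v p s q r → (v - u) * (r * q - s * p) ≈ u * (p * s - q * r) + v * (r * q - s * p)
    flip-signs = solve 6 (λ u v p s q r → (v :- u) :* (r :* q :- s :* p)
                      := u :* (p :* s :- q :* r) :+ v :* (r :* q :- s :* p)) refl

    -- For k ≠ l the two terms add up to a minor of `M` times a minor of `N`; for k = l they add up
    -- to zero.
    symmetrised-nonneg : ∀ {i i′ j j′} → i Fin.< i′ → j Fin.< j′ → ∀ k l →
      0# ≤ f i i′ j j′ k l + f i i′ j j′ l k
    symmetrised-nonneg {i} {i′} {j} {j′} i<i′ j<j′ k l with Finₚ.<-cmp k l
    ... | tri< k<l _ _ = nonneg-resp
      (swap (M i k * M i′ l) (M i l * M i′ k) (N k j) (N l j′) (N k j′) (N l j))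
      (nonneg-* (minors tM i<i′ k<l) (minors tN k<l j<j′))
    ... | tri≈ _ ≡.refl _ = nonneg-resp
      (trans (sym (zeroˡ (N k j * N k j′ - N k j′ * N k j))) (trans (*-congʳ (sym (-‿inverseʳ (M i k * M i′ k))))
        (swap (M i k * M i′ k) (M i k * M i′ k) (N k j) (N k j′) (N k j′) (N k j))))
      nonneg-0
    ... | tri> _ _ l<k = nonneg-resp
      (flip-signs (M i k * M i′ l) (M i l * M i′ k) (N k j) (N l j′) (N k j′) (N l j))
      (nonneg-* (minors tM i<i′ l<k) (minors tN l<k j<j′))

    double-sum : ∀ {i i′ j j′} → i Fin.< i′ → j Fin.< j′ → 0# ≤ sum λ k → sum λ l → f i i′ j j′ k l
    double-sum {i} {i′} {j} {j′} i<i′ j<j′ = nonneg-halve (nonneg-resp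
      (trans (sum-+ (λ k → sum λ l → F k l) (λ k → sum λ l → F l k) λ k → sum-+ (F k) (λ l → F l k) λ l → refl)
             (+-congˡ (∑-comm λ k l → F l k)))
      (nonneg-sum (λ k → sum λ l → F k l + F l k) λ k → nonneg-sum (λ l → F k l + F l k) λ l →
        symmetrised-nonneg i<i′ j<j′ k l))
      where
      F = f i i′ j j′

  smoothing : ∀ {n} → Carrier → Matrix Carrier n
  smoothing ε i j = ε ^ ∣ toℕ i - toℕ j ∣

  -- The Monge property of the distance on a line. Successors are stripped until `a` or `b` is 0;
  -- then it is the triangle inequality.
  distance-submodular : ∀ {a a′ b b′} → a ℕ.≤ a′ → b ℕ.≤ b′ →
    ∣ a - b ∣ ℕ.+ ∣ a′ - b′ ∣ ℕ.≤ ∣ a - b′ ∣ ℕ.+ ∣ a′ - b ∣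
  distance-submodular {a′ = a′} {b} {b′} ℕ.z≤n b≤b′ = begin
    b ℕ.+ ∣ a′ - b′ ∣                 ≤⟨ ℕₚ.+-monoʳ-≤ b (ℕₚ.∣-∣-triangle a′ b b′) ⟩
    b ℕ.+ (∣ a′ - b ∣ ℕ.+ ∣ b - b′ ∣) ≡⟨ ≡.cong (λ d → b ℕ.+ (∣ a′ - b ∣ ℕ.+ d)) (ℕₚ.m≤n⇒∣m-n∣≡n∸m b≤b′) ⟩
    b ℕ.+ (∣ a′ - b ∣ ℕ.+ (b′ ℕ.∸ b)) ≡⟨ rearrange b ∣ a′ - b ∣ (b′ ℕ.∸ b) ⟩
    b′ ℕ.∸ b ℕ.+ b ℕ.+ ∣ a′ - b ∣     ≡⟨ ≡.cong (ℕ._+ ∣ a′ - b ∣) (ℕₚ.m∸n+n≡m b≤b′) ⟩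
    b′ ℕ.+ ∣ a′ - b ∣                 ∎
    where
    open ℕₚ.≤-Reasoning
    rearrange : ∀ b d e → b ℕ.+ (d ℕ.+ e) ≡ e ℕ.+ b ℕ.+ d
    rearrange = solveℕ
  distance-submodular {suc a} {suc a′} {b′ = b′} (ℕ.s≤s a≤a′) ℕ.z≤n = begin
    suc a ℕ.+ ∣ suc a′ - b′ ∣                    ≤⟨ ℕₚ.+-monoʳ-≤ (suc a) (ℕₚ.∣-∣-triangle (suc a′) (suc a) b′) ⟩
    suc a ℕ.+ (∣ a′ - a ∣ ℕ.+ ∣ suc a - b′ ∣)    ≡⟨ ≡.cong (λ d → suc a ℕ.+ (d ℕ.+ ∣ suc a - b′ ∣)) (ℕₚ.m≤n⇒∣n-m∣≡n∸m a≤a′) ⟩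
    suc a ℕ.+ (a′ ℕ.∸ a ℕ.+ ∣ suc a - b′ ∣)      ≡⟨ rearrange a (a′ ℕ.∸ a) ∣ suc a - b′ ∣ ⟩
    ∣ suc a - b′ ∣ ℕ.+ suc (a′ ℕ.∸ a ℕ.+ a)      ≡⟨ ≡.cong (λ d → ∣ suc a - b′ ∣ ℕ.+ suc d) (ℕₚ.m∸n+n≡m a≤a′) ⟩
    ∣ suc a - b′ ∣ ℕ.+ suc a′                    ∎
    where
    open ℕₚ.≤-Reasoning
    rearrange : ∀ a d e → suc a ℕ.+ (d ℕ.+ e) ≡ e ℕ.+ suc (d ℕ.+ a)
    rearrange = solveℕ
  distance-submodular (ℕ.s≤s a≤a′) (ℕ.s≤s b≤b′) = distance-submodular a≤a′ b≤b′

  -- For 0 < ε < 1 powers decrease with the exponent, so the Monge inequality between exponents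
  -- becomes nonnegativity of a minor.
  TN₂-smoothing : ∀ {n ε} → 0# < ε → 0# < 1# - ε → TN₂ (smoothing {n} ε)
  TN₂-smoothing {ε = ε} 0<ε ε<1 = record
    { entries = λ i j → pos⇒nonneg (pos-^ ∣ toℕ i - toℕ j ∣ 0<ε)
    ; minors  = λ {i} {i′} {j} {j′} i<i′ j<j′ → nonneg-resp
        (+-cong (^-homo-* ε ∣ toℕ i - toℕ j ∣ _) (-‿cong (^-homo-* ε ∣ toℕ i - toℕ j′ ∣ _)))
        (^-antitone (distance-submodular (ℕₚ.<⇒≤ i<i′) (ℕₚ.<⇒≤ j<j′)))
    }
    where
    ^≤1 : ∀ k → 0# ≤ 1# - ε ^ k
    ^≤1 zero    = nonneg-resp (sym (-‿inverseʳ 1#)) nonneg-0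
    ^≤1 (suc k) = nonneg-resp (solve 2 (λ ε p → con 1ℤ :- ε :+ ε :* (con 1ℤ :- p) := con 1ℤ :- ε :* p) refl ε (ε ^ k))
      (nonneg-+ (pos⇒nonneg ε<1) (nonneg-* (pos⇒nonneg 0<ε) (^≤1 k)))

    ^-antitone : ∀ {k l} → k ℕ.≤ l → 0# ≤ ε ^ k - ε ^ l
    ^-antitone {l = l} ℕ.z≤n   = ^≤1 l
    ^-antitone {suc k} {suc l} (ℕ.s≤s k≤l) = nonneg-resp
      (solve 3 (λ ε p q → ε :* (p :- q) := ε :* p :- ε :* q) refl ε (ε ^ k) (ε ^ l))
      (nonneg-* (pos⇒nonneg 0<ε) (^-antitone k≤l))

  sum-0^-distance : ∀ {n} (i : Fin n) (v : Vector Carrier n) →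
    sum (λ k → 0^ ∣ toℕ i - toℕ k ∣ * v k) ≈ v i
  sum-0^-distance {suc n} zero    v = trans (+-cong (*-identityˡ _) (zeros (v ∘ suc))) (+-identityʳ _)
    where
    zeros : ∀ {n} (v : Vector Carrier n) → sum (λ k → 0# * v k) ≈ 0#
    zeros v = trans (sym (*-distribˡ-sum 0# v)) (zeroˡ _)
  sum-0^-distance {suc n} (suc i) v = trans (+-congʳ (zeroˡ _)) (trans (+-identityˡ _) (sum-0^-distance i (v ∘ suc)))

  Positive : ∀ {n} → Matrix Carrier n → Set ℓ₂
  Positive M = ∀ i j → 0# < M i j

  record Approximation {n} (M : Matrix Carrier n) : Set (c ⊔ ℓ₁ ⊔ ℓ₂) where
    field
      family      : Carrier → Matrix Carrier n
      converges   : ∀ i j → (λ ε → family ε i j) ⇝ M i j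
      family-TN₂  : ∀ ε → 0# < ε → 0# < 1# - ε → TN₂ (family ε)
      family-pos  : ∀ ε → 0# < ε → 0# < 1# - ε → Positive (family ε)

  -- Smoothing leaves the zero matrix zero, so it is approximated by constant matrices, whose 2×2
  -- minors vanish.
  approximation-zero : ∀ {n} {M : Matrix Carrier n} → (∀ i j → M i j ≈ 0#) → Approximation M
  approximation-zero M≈0 = record
    { family     = λ ε _ _ → ε
    ; converges  = λ i j → ⇝-resp (sym (M≈0 i j)) ⇝-ε
    ; family-TN₂ = λ ε 0<ε _ → record
        { entries = λ _ _ → pos⇒nonneg 0<ε
        ; minors  = λ _ _ → nonneg-resp (sym (-‿inverseʳ _)) nonneg-0 }
    ; family-pos = λ ε 0<ε _ _ _ → 0<ε
    }

  -- Every entry of the kernel is positive, so a single positive entry of `M` spreads to all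
  -- positions of the two-sided product.
  approximation-nonzero : ∀ {n} {M : Matrix Carrier n} → TN₂ M → ∀ {k l} → 0# < M k l → Approximation M
  approximation-nonzero {n} {M} tM {k} {l} 0<Mkl = record
    { family     = λ ε → smoothing ε ⊡ (M ⊡ smoothing ε)
    ; converges  = λ i j → ⇝-resp (limit i j) (⇝-sum _ (λ p → 0^ ∣ toℕ i - toℕ p ∣ * limit-inner p j) λ p →
        ⇝-* (⇝-^ ∣ toℕ i - toℕ p ∣) (⇝-sum _ (λ q → M p q * 0^ ∣ toℕ q - toℕ j ∣) λ q →
          ⇝-* (⇝-const (M p q)) (⇝-^ ∣ toℕ q - toℕ j ∣)))
    ; family-TN₂ = λ ε 0<ε ε<1 → TN₂-⊡ (TN₂-smoothing 0<ε ε<1) (TN₂-⊡ tM (TN₂-smoothing 0<ε ε<1))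
    ; family-pos = λ ε 0<ε ε<1 i j →
        let tS = TN₂-smoothing 0<ε ε<1
            pS = λ i j → pos-^ ∣ toℕ i - toℕ j ∣ 0<ε
        in pos-sum _ (λ p → nonneg-* (entries tS i p) (entries (TN₂-⊡ tM tS) p j)) k
             (pos-* (pS i k) (pos-sum _ (λ q → nonneg-* (entries tM k q) (entries tS q j)) l
               (pos-* 0<Mkl (pS l j))))
    }
    where
    limit-inner : Matrix Carrier n
    limit-inner p j = sum λ q → M p q * 0^ ∣ toℕ q - toℕ j ∣

    limit : ∀ i j → sum (λ p → 0^ ∣ toℕ i - toℕ p ∣ * limit-inner p j) ≈ M i j
    limit i j = trans (sum-0^-distance i (λ p → limit-inner p j))
      (trans (sum-cong-≋ {x = λ q → M i q * 0^ ∣ toℕ q - toℕ j ∣} λ q → trans (*-comm (M i q) _)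
               (*-congʳ {M i q} (reflexive (≡.cong 0^_ (ℕₚ.∣-∣-comm (toℕ q) (toℕ j))))))
             (sum-0^-distance j (M i)))

  -- It is undecidable whether some entry is positive; if none is, tightness of apartness makes `M`
  -- zero.
  approximation : ∀ {n} {M : Matrix Carrier n} → TN₂ M → ¬ ¬ Approximation M
  approximation tM ¬a = ¬a (approximation-zero λ i j →
    nonneg-¬pos⇒≈0 (entries tM i j) λ 0<M → ¬a (approximation-nonzero tM 0<M))

-- Total positivity from strongly dominant diagonals of 2×2 minors.

module DominantDiagonal {c ℓ₁ ℓ₂} (ℝ : Reals c ℓ₁ ℓ₂) where
  open OrderedField ℝ
  open Reals ℝ using (_·_)
  open Limits ℝ using (nonneg-κ)
  open Determinant commutativeRing
  open Algebra.Properties.Semiring.Exp semiring using (^-homo-*)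
  open Algebra.Properties.Semiring.Mult semiring using (×-homo-+; ×-congˡ; ×-comm-*; ×-assoc-*)
  open Mult +-commutativeMonoid using (×-distrib-+)

  diagonalProduct : ∀ {k} → Matrix Carrier k → Carrier
  diagonalProduct {zero}  M = 1#
  diagonalProduct {suc k} M = M zero zero * diagonalProduct λ i j → M (suc i) (suc j)

  cofactor : ∀ {k} → Matrix Carrier (suc k) → Fin (suc k) → Matrix Carrier k
  cofactor M j r c = M (suc r) (punchIn j c)

  -- Demanding the gap for all pairs of rows and columns, not only adjacent ones, makes the property
  -- hereditary for submatrices.
  record Dominant (T : Carrier) {k} (M : Matrix Carrier k) : Set ℓ₂ where
    field
      positive : ∀ i j → 0# < M i j
      gap      : ∀ {i i′ j j′} → i Fin.< i′ → j Fin.< j′ →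
                 0# ≤ M i j * M i′ j′ - T * (M i j′ * M i′ j)
  open Dominant

  dominant-submatrix : ∀ {T n k} {M : Matrix Carrier n} (rows cols : Fin k → Fin n) →
    (∀ {i j} → i Fin.< j → rows i Fin.< rows j) → (∀ {i j} → i Fin.< j → cols i Fin.< cols j) →
    Dominant T M → Dominant T (λ r c → M (rows r) (cols c))
  dominant-submatrix rows cols rows-inc cols-inc dM = record
    { positive = λ i j → positive dM (rows i) (cols j)
    ; gap      = λ i<i′ j<j′ → gap dM (rows-inc i<i′) (cols-inc j<j′) }

  punchIn-increasing : ∀ {k} (j : Fin (suc k)) {i i′} → i Fin.< i′ → punchIn j i Fin.< punchIn j i′
  punchIn-increasing zero    {i}     {i′}     i<i′         = ℕ.s≤s i<i′
  punchIn-increasing (suc j) {zero}  {suc i′} i<i′         = ℕ.s≤s ℕ.z≤n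
  punchIn-increasing (suc j) {suc i} {suc i′} (ℕ.s≤s i<i′) = ℕ.s≤s (punchIn-increasing j i<i′)

  dominant-cofactor : ∀ {T k} {M : Matrix Carrier (suc k)} → Dominant T M → ∀ j → Dominant T (cofactor M j)
  dominant-cofactor dM j = dominant-submatrix suc (punchIn j) ℕ.s≤s (punchIn-increasing j) dM

  diagonalProduct-pos : ∀ {T k} {M : Matrix Carrier k} → Dominant T M → 0# < diagonalProduct M
  diagonalProduct-pos {k = zero}  dM = 0<1
  diagonalProduct-pos {k = suc k} dM =
    pos-* (positive dM zero zero) (diagonalProduct-pos (dominant-cofactor dM zero))

  private
    peel : ∀ T m₀ m₁ m₂ m₃ d d′ → m₀ * (d - m₁ * d′) + (m₀ * m₁ - T * (m₂ * m₃)) * d′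
                                     ≈ m₀ * d - T * (m₂ * (m₃ * d′))
    peel = solve 7 (λ T m₀ m₁ m₂ m₃ d d′ → m₀ :* (d :- m₁ :* d′) :+ (m₀ :* m₁ :- T :* (m₂ :* m₃)) :* d′
                       := m₀ :* d :- T :* (m₂ :* (m₃ :* d′))) refl

    weaken : ∀ T d x → d - T * x + (T - 1#) * x ≈ d - x
    weaken = solve 3 (λ T d x → d :- T :* x :+ (T :- con 1ℤ) :* x := d :- x) refl

  module _ {T : Carrier} (1≤T : 0# ≤ T - 1#) where

    -- Induction simultaneous with `off-diagonal`. There, uncrossing the entries (0 , j + 1) and (1
    -- , 0) gains the factor `T`; the new entry (1 , j + 1) lies in the first row of the smaller
    -- matrix, where this weak form suffices. It follows from the strong form because `T` is at
    -- least 1.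
    cofactor-diagonal : ∀ {k} {M : Matrix Carrier (suc k)} → Dominant T M → ∀ j →
      0# ≤ diagonalProduct M - M zero j * diagonalProduct (cofactor M j)
    off-diagonal : ∀ {k} {M : Matrix Carrier (suc k)} → Dominant T M → ∀ j →
      0# ≤ diagonalProduct M - T * (M zero (suc j) * diagonalProduct (cofactor M (suc j)))

    cofactor-diagonal dM zero = nonneg-resp (sym (-‿inverseʳ _)) nonneg-0
    cofactor-diagonal {M = M} dM (suc j) = nonneg-resp
      (weaken T (diagonalProduct M) (M zero (suc j) * diagonalProduct (cofactor M (suc j))))
      (nonneg-+ (off-diagonal dM j) (nonneg-* 1≤T (pos⇒nonneg
        (pos-* (positive dM zero (suc j)) (diagonalProduct-pos (dominant-cofactor dM (suc j)))))))

    off-diagonal {suc k} {M} dM j = nonneg-resp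
      (peel T (M zero zero) (M (suc zero) (suc j)) (M zero (suc j)) (M (suc zero) zero)
        (diagonalProduct M′) (diagonalProduct (cofactor M′ j)))
      (nonneg-+
        (nonneg-* (pos⇒nonneg (positive dM zero zero)) (cofactor-diagonal dM′ j))
        (nonneg-* (gap dM (ℕ.s≤s ℕ.z≤n) (ℕ.s≤s ℕ.z≤n))
                  (pos⇒nonneg (diagonalProduct-pos (dominant-cofactor dM′ j)))))
      where
      M′ = cofactor M zero
      dM′ = dominant-cofactor dM zero

  within-sum : ∀ {b k} (f : Vector Carrier k) → (∀ i → Within b (f i)) → Within (k · b) (sum f)
  within-sum {k = zero}  f f≤b = within-nonneg nonneg-0
  within-sum {k = suc k} f f≤b = within-+ (f≤b zero) (within-sum (f ∘ suc) (f≤b ∘ suc))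

  within-sign : ∀ k → Within 1# ((- 1#) ^ k)
  within-sign zero    = within-nonneg (pos⇒nonneg 0<1)
  within-sign (suc k) = within-resp (*-identityˡ 1#) refl
    (within-* (within-neg (within-nonneg (pos⇒nonneg 0<1))) (within-sign k))

  private
    split-det : ∀ T m D S d → T * ((1# * (m * D) + S) - m * d) ≈ m * (T * (D - d)) + T * S
    split-det = solve 5 (λ T m D S d → T :* ((con 1ℤ :* (m :* D) :+ S) :- m :* d)
                           := m :* (T :* (D :- d)) :+ T :* S) refl

    collect-sign : ∀ T s m D → s * ((T * m) * D) ≈ T * (s * (m * D))
    collect-sign = solve 4 (λ T s m D → s :* ((T :* m) :* D) := T :* (s :* (m :* D))) refl

    double : ∀ p T m d → (p - T * (m * d)) + (p - T * (m * d)) ≈ (p + p) - 1# * ((T * m) * (d + d))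
    double = solve 4 (λ p T m d → (p :- T :* (m :* d)) :+ (p :- T :* (m :* d))
                        := (p :+ p) :- con 1ℤ :* ((T :* m) :* (d :+ d))) refl

    add-back : ∀ d D → d + (D - d) ≈ D
    add-back = solve 2 (λ d D → d :+ (D :- d) := D) refl

    margin⁺ : ∀ T κ d x → (T - κ) * d + (κ * d + T * x) ≈ T * (d + x)
    margin⁺ = solve 4 (λ T κ d x → (T :- κ) :* d :+ (κ :* d :+ T :* x) := T :* (d :+ x)) refl

    margin⁻ : ∀ T κ d x → (T - κ) * d + (κ * d - T * x) ≈ T * (d - x)
    margin⁻ = solve 4 (λ T κ d x → (T :- κ) :* d :+ (κ :* d :- T :* x) := T :* (d :- x)) refl

    ·-* : ∀ k x → k · x ≈ (k · 1#) * x
    ·-* k x = sym (trans (×-assoc-* k 1# x) (×-congʳ′ k (*-identityˡ x)))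
      where open Algebra.Properties.Semiring.Mult semiring using () renaming (×-congʳ to ×-congʳ′)

    next-square : ∀ k d → (suc k ℕ.* suc k) · d ≈ ((k ℕ.* k) · d + k · (d + d)) + d
    next-square k d = trans (×-congˡ {d} (eq k)) (trans (+-congˡ {d} (trans
      (×-homo-+ d (k ℕ.* k) (k ℕ.+ k))
      (+-congˡ (trans (×-homo-+ d k k) (sym (×-distrib-+ d d k)))))) (+-comm d _))
      where
      eq : ∀ k → suc k ℕ.* suc k ≡ suc (k ℕ.* k ℕ.+ (k ℕ.+ k))
      eq = solveℕ

  -- Every permutation other than the identity contributes at most a T-th of the diagonal
  -- product to det M; Laplace expansion yields k² as a crude count of such contributions.
  module _ {T : Carrier} (n : ℕ) (T-large : ∀ k → k ℕ.≤ n → 0# < T - (k ℕ.* k) · 1#) (1≤T : 0# ≤ T - 1#) where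

    private
      0<T : 0# < T
      0<T = <-respʳ (solve 1 (λ T → T :- con 0ℤ := T) refl T) (T-large 0 ℕ.z≤n)

    -- In the step from k to k + 1, with diagonal product p, the leading cofactor contributes k² p
    -- by induction and each of the k others at most 2 p; and k² + 2 k ≤ (k + 1)².
    det-near-diagonal : ∀ {k} {M : Matrix Carrier k} → Dominant T M → k ℕ.≤ n →
      Within ((k ℕ.* k) · diagonalProduct M) (T * (det M - diagonalProduct M))

    -- As `T` exceeds k², the deviation from the diagonal product is at most that product itself.
    det-within : ∀ {k} {M : Matrix Carrier k} → Dominant T M → k ℕ.≤ n →
      Within (diagonalProduct M + diagonalProduct M) (det M)
    det-within {k} {M} dM k≤n = within-resp refl (add-back d (det M)) (within-+ (within-nonneg 0≤d)
        ( nonneg-cancel 0<T (nonneg-resp (margin⁺ T κ d (det M - d))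
            (nonneg-+ gap-d (nonneg-resp (+-congʳ (·-* (k ℕ.* k) d)) (proj₁ near))))
        , nonneg-cancel 0<T (nonneg-resp (margin⁻ T κ d (det M - d))
            (nonneg-+ gap-d (nonneg-resp (+-congʳ (·-* (k ℕ.* k) d)) (proj₂ near))))))
      where
      d = diagonalProduct M
      κ = (k ℕ.* k) · 1#
      near = det-near-diagonal dM k≤n
      0≤d = pos⇒nonneg (diagonalProduct-pos dM)
      gap-d = nonneg-* (pos⇒nonneg (T-large k k≤n)) 0≤d

    det-near-diagonal {zero}  {M} dM k≤n = within-resp refl
      (sym (trans (*-congˡ (-‿inverseʳ 1#)) (zeroʳ T))) (within-nonneg nonneg-0)
    det-near-diagonal {suc k} {M} dM k<n = within-mono
      (nonneg-resp (trans (solve 2 (λ a d → d := a :+ d :- a) refl ((k ℕ.* k) · p + k · (p + p)) p)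
                          (+-congʳ (sym (next-square k p))))
        (pos⇒nonneg (diagonalProduct-pos dM)))
      (within-resp refl (sym (trans (split-det T (M zero zero) (det (cofactor M zero)) (sum rest) d₀)
                                    (+-congˡ (*-distribˡ-sum T rest))))
        (within-+ first (within-sum (λ j → T * rest j) others)))
      where
      p = diagonalProduct M
      d₀ = diagonalProduct (cofactor M zero)
      k≤n = ℕₚ.<⇒≤ k<n

      rest : Vector Carrier k
      rest j = (- 1#) ^ suc (toℕ j) * (M zero (suc j) * det (cofactor M (suc j)))

      first : Within ((k ℕ.* k) · p) (M zero zero * (T * (det (cofactor M zero) - d₀)))
      first = within-resp (×-comm-* (k ℕ.* k) (M zero zero) d₀) refl
        (within-* (within-nonneg (pos⇒nonneg (positive dM zero zero)))
                  (det-near-diagonal (dominant-cofactor dM zero) k≤n))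

      others : ∀ j → Within (p + p) (T * rest j)
      others j = within-resp refl (collect-sign T _ (M zero (suc j)) (det (cofactor M (suc j))))
        (within-mono
          (nonneg-resp (double p T (M zero (suc j)) (diagonalProduct (cofactor M (suc j))))
            (nonneg-+ (off-diagonal 1≤T dM j) (off-diagonal 1≤T dM j)))
          (within-* (within-sign (suc (toℕ j)))
            (within-* (within-nonneg (pos⇒nonneg (pos-* 0<T (positive dM zero (suc j)))))
                      (det-within (dominant-cofactor dM (suc j)) k≤n))))

    det-pos : ∀ {k} {M : Matrix Carrier k} → Dominant T M → k ℕ.≤ n → 0# < det M
    det-pos {k} {M} dM k≤n = pos-cancel 0<T (<-respʳ
      (trans (margin⁺ T κ d (det M - d)) (*-congˡ (add-back d (det M))))
      (pos-+-nonneg (pos-* (T-large k k≤n) (diagonalProduct-pos dM))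
        (nonneg-resp (+-congʳ (·-* (k ℕ.* k) d)) (proj₁ (det-near-diagonal dM k≤n)))))
      where
      d = diagonalProduct M
      κ = (k ℕ.* k) · 1#

  increasing⇒injective : ∀ {k n} (f : Fin k → Fin n) → (∀ {i j} → i Fin.< j → f i Fin.< f j) →
    ∀ {i j} → f i ≡ f j → i ≡ j
  increasing⇒injective f f-inc {i} {j} fi≡fj with Finₚ.<-cmp i j
  ... | tri< i<j _ _ = contradiction (f-inc i<j) (Finₚ.<-irrefl fi≡fj)
  ... | tri≈ _ i≡j _ = i≡j
  ... | tri> _ _ j<i = contradiction (f-inc j<i) (Finₚ.<-irrefl (≡.sym fi≡fj))

  module _ {n : ℕ} (e : Matrix ℕ n)
           (supermodular : ∀ {i i′ j j′} → i Fin.< i′ → j Fin.< j′ →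
              suc (e i j′ ℕ.+ e i′ j) ℕ.≤ e i j ℕ.+ e i′ j′) where

    -- n² + 1 exceeds every k² with k ≤ n, as the determinant estimate demands.
    base : Carrier
    base = suc (n ℕ.* n) · 1#

    powers : Matrix Carrier n
    powers i j = base ^ e i j

    private
      base-large : ∀ k → k ℕ.≤ n → 0# < base - (k ℕ.* k) · 1#
      base-large k k≤n = <-respʳ (trans
          (solve 2 (λ a b → con 1ℤ :+ a := con 1ℤ :+ (b :+ a) :- b) refl ((n ℕ.* n ℕ.∸ k ℕ.* k) · 1#) ((k ℕ.* k) · 1#))
          (+-congʳ (+-congˡ (trans (sym (×-homo-+ 1# (k ℕ.* k) (n ℕ.* n ℕ.∸ k ℕ.* k)))
                                   (×-congˡ (ℕₚ.m+[n∸m]≡n (ℕₚ.*-mono-≤ k≤n k≤n)))))))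
        (pos-+-nonneg 0<1 (nonneg-κ (n ℕ.* n ℕ.∸ k ℕ.* k)))

      1≤base : 0# ≤ base - 1#
      1≤base = nonneg-resp (solve 1 (λ a → a := con 1ℤ :+ a :- con 1ℤ) refl ((n ℕ.* n) · 1#)) (nonneg-κ (n ℕ.* n))

      0<base : 0# < base
      0<base = pos-+-nonneg 0<1 (nonneg-κ (n ℕ.* n))

      ^-monotone : ∀ {k l} → k ℕ.≤ l → 0# ≤ base ^ l - base ^ k
      ^-monotone {l = zero}  ℕ.z≤n = nonneg-resp (sym (-‿inverseʳ 1#)) nonneg-0
      ^-monotone {l = suc l} ℕ.z≤n = nonneg-resp
        (solve 2 (λ b x → (b :- con 1ℤ) :* x :+ (x :- con 1ℤ) := b :* x :- con 1ℤ) refl base (base ^ l))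
        (nonneg-+ (nonneg-* 1≤base (pos⇒nonneg (pos-^ l 0<base))) (^-monotone {l = l} ℕ.z≤n))
      ^-monotone {suc k} {suc l} (ℕ.s≤s k≤l) = nonneg-resp
        (solve 3 (λ b x y → b :* (x :- y) := b :* x :- b :* y) refl base (base ^ l) (base ^ k))
        (nonneg-* (pos⇒nonneg 0<base) (^-monotone k≤l))

    -- If n = 0 the base is 1, so strictness needs a row.
    ^-strictly-monotone : Fin n → ∀ {k l} → k ℕ.< l → 0# < base ^ l - base ^ k
    ^-strictly-monotone i {k} {l} k<l = <-respʳ
      (solve 3 (λ b x y → (b :- con 1ℤ) :* x :+ (y :- b :* x) := y :- x) refl base (base ^ k) (base ^ l))
      (pos-+-nonneg (pos-* 1<base (pos-^ k 0<base)) (^-monotone k<l))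
      where
      1<base : 0# < base - 1#
      1<base = <-respʳ (+-congˡ (-‿cong (+-identityʳ 1#))) (base-large 1 (ℕₚ.≤-trans (ℕ.s≤s ℕ.z≤n) (Finₚ.toℕ<n i)))

    -- The unit gap in the supermodularity of the exponents is exactly one factor `base`.
    powers-dominant : Dominant base powers
    powers-dominant = record
      { positive = λ i j → pos-^ (e i j) 0<base
      ; gap      = λ {i} {i′} {j} {j′} i<i′ j<j′ → nonneg-resp
          (+-cong (^-homo-* base (e i j) (e i′ j′)) (-‿cong (*-congˡ (^-homo-* base (e i j′) (e i′ j)))))
          (^-monotone (supermodular i<i′ j<j′))
      }

    powers-TP : ∀ (Δ : MinorIndex n) → 0# < minor powers Δ
    powers-TP Δ = det-pos n base-large 1≤base
      (dominant-submatrix rows cols rows-inc cols-inc powers-dominant)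
      -- A minor has at most n rows, so the estimate for sizes up to n applies.
      (Finₚ.injective⇒≤ (increasing⇒injective rows rows-inc))
      where open MinorIndex Δ

-- Ring identities for products of differences and for Horner's rule.

module Identities {a ℓ} (R : CommutativeRing a ℓ) where
  open CommutativeRing R
  open RingSolver R

  -- `u′` is written as `w′ + (u′ - w′)` so that only the lower terms and the differences occur, the
  -- ones known to be subtraction-free.
  product-difference : ∀ u w u′ w′ → (u - w) * (w′ + (u′ - w′)) + w * (u′ - w′) ≈ u * u′ - w * w′
  product-difference = solve 4 (λ u w u′ w′ →
    (u :- w) :* (w′ :+ (u′ :- w′)) :+ w :* (u′ :- w′) := u :* u′ :- w :* w′) refl

  -- Applied with `α`, `β` the numerator monomials and `u`, `v` the diagonal and antidiagonal ones.
  difference-exchange : ∀ α β u v → α * v ≈ β * u → β * (u - v) ≈ v * (α - β)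
  difference-exchange α β u v αv≈βu = trans
    (solve 3 (λ β u v → β :* (u :- v) := β :* u :- v :* β) refl β u v)
    (trans (+-congʳ (sym αv≈βu))
      (solve 3 (λ α β v → α :* v :- v :* β := v :* (α :- β)) refl α β v))

  cross : ∀ p k d → p * (k * d) ≈ (k * p) * d
  cross = solve 3 (λ p k d → p :* (k :* d) := (k :* p) :* d) refl

  difference-swap : ∀ u v p q → u * v - p * q ≈ u * v - q * p
  difference-swap u v p q = +-congˡ (-‿cong (*-comm p q))

  -- `polynomialIn` multiplies denominators up without reducing: `N / e` is its value on the tail,
  -- while `H / d` is the same fraction over the common denominator.
  horner-step : ∀ h d e q N H → N * d ≈ H * e →
    (h * (1# * e) + (q * N) * d) * d ≈ (h + q * H) * (d * (1# * e))
  horner-step h d e q N H Nd≈He = trans (lhs h d e q N) (trans (+-congˡ (*-congˡ (*-congˡ Nd≈He))) (rhs h d e q H))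
    where
    lhs : ∀ h d e q N → (h * (1# * e) + (q * N) * d) * d ≈ h * d * e + q * (d * (N * d))
    lhs = solve 5 (λ h d e q N → (h :* (con 1ℤ :* e) :+ (q :* N) :* d) :* d := h :* d :* e :+ q :* (d :* (N :* d))) refl
    rhs : ∀ h d e q H → h * d * e + q * (d * (H * e)) ≈ (h + q * H) * (d * (1# * e))
    rhs = solve 5 (λ h d e q H → h :* d :* e :+ q :* (d :* (H :* e)) := (h :+ q :* H) :* (d :* (con 1ℤ :* e))) refl

  proportional : ∀ κ H d N e → N * d ≈ H * e → (κ * H) * e ≈ N * (κ * d)
  proportional κ H d N e Nd≈He = trans (*-assoc κ H e) (trans (*-congˡ (sym Nd≈He))
    (solve 3 (λ κ N d → κ :* (N :* d) := N :* (κ :* d)) refl κ N d))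

  horner-+ : ∀ c d q H H′ → (c + d) + q * (H + H′) ≈ (c + q * H) + (d + q * H′)
  horner-+ = solve 5 (λ c d q H H′ → (c :+ d) :+ q :* (H :+ H′) := (c :+ q :* H) :+ (d :+ q :* H′)) refl

-- Minors of size 1 and 2, and subtraction-free polynomials in them.

module _ {n : ℕ} where

  minor₁ : Fin n → Fin n → MinorIndex n
  minor₁ i j = record
    { rows = λ (_ : Fin 1) → i ; cols = λ _ → j
    ; rows-inc = λ { {zero} {zero} () } ; cols-inc = λ { {zero} {zero} () } }

  pair : Fin n → Fin n → Fin 2 → Fin n
  pair i i′ zero    = i
  pair i i′ (suc _) = i′

  pair-increasing : ∀ {i i′} → i Fin.< i′ → ∀ {k l} → k Fin.< l → pair i i′ k Fin.< pair i i′ l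
  pair-increasing i<i′ {zero}     {suc zero} _         = i<i′
  pair-increasing i<i′ {suc zero} {suc zero} (ℕ.s≤s ())

  minor₂ : ∀ {i i′ j j′} → i Fin.< i′ → j Fin.< j′ → MinorIndex n
  minor₂ {i} {i′} {j} {j′} i<i′ j<j′ = record
    { rows = pair i i′ ; cols = pair j j′
    ; rows-inc = pair-increasing i<i′ ; cols-inc = pair-increasing j<j′ }

module SubtractionFree {c ℓ₁ ℓ₂} (ℝ : Reals c ℓ₁ ℓ₂) {n : ℕ} where
  open RationalFunctions ℝ
  open CommutativeRing (ℝ[x] n) hiding (zero)
  open Identities (ℝ[x] n)
  open SmallMinors (ℝ[x] n)
  open Combination *-commutativeMonoid using (combination)
  open Mult *-commutativeMonoid using () renaming (_×_ to _×ₘ_)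

  -- An inductive predicate, so that the expansion into products of minors and the nonnegativity at
  -- `TN₂` matrices are both plain recursions.
  data SF : Poly n → Set (c ⊔ ℓ₁) where
    sf-≋     : ∀ {P Q} → P ≋ Q → SF P → SF Q
    sf-0     : SF 0ₚ
    sf-1     : SF 1ₚ
    sf-+     : ∀ {P Q} → SF P → SF Q → SF (P ⊕ Q)
    sf-*     : ∀ {P Q} → SF P → SF Q → SF (P ⊗ Q)
    sf-entry : ∀ i j → SF (x i j)
    sf-minor : ∀ {i i′ j j′} → i Fin.< i′ → j Fin.< j′ → SF (x i j ⊗ x i′ j′ ⊕ ⊝ (x i j′ ⊗ x i′ j))

  product : List (MinorIndex n) → Poly n
  product Δs = ∏ₚ (List.map Δ⟨_⟩ Δs)

  -- Coefficients are expressed by repetition, which makes the product of two sums a Cartesian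
  -- product of lists.
  sumOfProducts : List (List (MinorIndex n)) → Poly n
  sumOfProducts Δss = ∑ₚ (List.map product Δss)

  product-++ : ∀ Δs Δs′ → product (Δs ++ Δs′) ≋ product Δs ⊗ product Δs′
  product-++ []       Δs′ = sym (*-identityˡ _)
  product-++ (Δ ∷ Δs) Δs′ = trans (*-congˡ (product-++ Δs Δs′)) (sym (*-assoc _ _ _))

  sumOfProducts-++ : ∀ Δss Δss′ → sumOfProducts (Δss ++ Δss′) ≋ sumOfProducts Δss ⊕ sumOfProducts Δss′
  sumOfProducts-++ []         Δss′ = sym (+-identityˡ _)
  sumOfProducts-++ (Δs ∷ Δss) Δss′ = trans (+-congˡ (sumOfProducts-++ Δss Δss′)) (sym (+-assoc _ _ _))

  sumOfProducts-map : ∀ Δs Δss → sumOfProducts (List.map (Δs ++_) Δss) ≋ product Δs ⊗ sumOfProducts Δss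
  sumOfProducts-map Δs []          = sym (zeroʳ _)
  sumOfProducts-map Δs (Δs′ ∷ Δss) = trans
    (+-cong (product-++ Δs Δs′) (sumOfProducts-map Δs Δss)) (sym (distribˡ _ _ _))

  sumOfProducts-cartesian : ∀ Δss Δss′ →
    sumOfProducts (List.cartesianProductWith _++_ Δss Δss′) ≋ sumOfProducts Δss ⊗ sumOfProducts Δss′
  sumOfProducts-cartesian []         Δss′ = sym (zeroˡ _)
  sumOfProducts-cartesian (Δs ∷ Δss) Δss′ = trans (sumOfProducts-++ (List.map (Δs ++_) Δss′) _)
    (trans (+-cong (sumOfProducts-map Δs Δss′) (sumOfProducts-cartesian Δss Δss′)) (sym (distribʳ _ _ _)))

  singleton-minor : ∀ Δ → sumOfProducts ((Δ ∷ []) ∷ []) ≋ Δ⟨ Δ ⟩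
  singleton-minor Δ = trans (+-identityʳ _) (*-identityʳ _)

  SF⇒sumOfProducts : ∀ {P} → SF P → ∃[ Δss ] P ≋ sumOfProducts Δss
  SF⇒sumOfProducts (sf-≋ P≋Q sP) = let Δss , P≋ = SF⇒sumOfProducts sP in Δss , trans (sym P≋Q) P≋
  SF⇒sumOfProducts sf-0 = [] , refl
  SF⇒sumOfProducts sf-1 = ([] ∷ []) , sym (+-identityʳ _)
  SF⇒sumOfProducts (sf-+ sP sQ) =
    let Δss , P≋ = SF⇒sumOfProducts sP ; Δss′ , Q≋ = SF⇒sumOfProducts sQ
    in Δss ++ Δss′ , trans (+-cong P≋ Q≋) (sym (sumOfProducts-++ Δss Δss′))
  SF⇒sumOfProducts (sf-* sP sQ) =
    let Δss , P≋ = SF⇒sumOfProducts sP ; Δss′ , Q≋ = SF⇒sumOfProducts sQ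
    in List.cartesianProductWith _++_ Δss Δss′ , trans (*-cong P≋ Q≋) (sym (sumOfProducts-cartesian Δss Δss′))
  SF⇒sumOfProducts (sf-entry i j) = ((minor₁ i j ∷ []) ∷ []) ,
    sym (trans (singleton-minor (minor₁ i j)) (det₁ λ _ _ → x i j))
  SF⇒sumOfProducts (sf-minor {i} {i′} {j} {j′} i<i′ j<j′) = ((minor₂ i<i′ j<j′ ∷ []) ∷ []) ,
    sym (trans (singleton-minor (minor₂ i<i′ j<j′)) (det₂ λ r s → x (pair i i′ r) (pair j j′ s)))

  SF⇒minorSum : ∀ {P} → SF P → ∃[ ts ] P ≋ minorSum ts
  SF⇒minorSum sP = let Δss , P≋ = SF⇒sumOfProducts sP in
    List.map (1 ,_) Δss , trans P≋ (unit-coefficients Δss)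
    where
    unit-coefficients : ∀ Δss → sumOfProducts Δss ≋ minorSum (List.map (1 ,_) Δss)
    unit-coefficients []         = refl
    unit-coefficients (Δs ∷ Δss) = +-cong (sym (+-identityʳ _)) (unit-coefficients Δss)

  MinorProduct : Poly n → Set (c ⊔ ℓ₁)
  MinorProduct P = ∃[ ds ] P ≋ minorProduct ds

  minorProduct-⊗ : ∀ {P Q} → MinorProduct P → MinorProduct Q → MinorProduct (P ⊗ Q)
  minorProduct-⊗ (ds , P≋) (ds′ , Q≋) = ds ++ ds′ , trans (*-cong P≋ Q≋) (append ds)
    where
    append : ∀ ds → minorProduct ds ⊗ minorProduct ds′ ≋ minorProduct (ds ++ ds′)
    append []       = *-identityˡ _
    append (d ∷ ds) = trans (*-assoc _ _ _) (*-congˡ (append ds))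

  minorProduct-entry^ : ∀ i j k → MinorProduct (x i j ^ₚ k)
  minorProduct-entry^ i j k = ((minor₁ i j , k) ∷ []) , sym (trans (*-identityʳ _)
    (^-congˡ k (det₁ λ _ _ → x i j)))
    where open Algebra.Properties.Semiring.Exp semiring using (^-congˡ)

  fold-closed : ∀ {p} (S : Poly n → Set p) → S 1ₚ → (∀ {P Q} → S P → S Q → S (P ⊗ Q)) →
    ∀ {k} (v : Vector (Poly n) k) → (∀ i → S (v i)) → S (foldr _⊗_ 1ₚ v)
  fold-closed S S1 S⊗ {zero}  v Sv = S1
  fold-closed S S1 S⊗ {suc k} v Sv = S⊗ (Sv zero) (fold-closed S S1 S⊗ (v ∘ suc) (Sv ∘ suc))

  monomial : Matrix ℕ n → Poly n
  monomial E = combination E x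

  minorProduct-monomial : ∀ E → MinorProduct (monomial E)
  minorProduct-monomial E = fold-closed MinorProduct ([] , refl) minorProduct-⊗ _ λ i →
    fold-closed MinorProduct ([] , refl) minorProduct-⊗ _ λ j → minorProduct-entry^ i j (E i j)

  sf-^ : ∀ {P} k → SF P → SF (k ×ₘ P)
  sf-^ zero    sP = sf-1
  sf-^ (suc k) sP = sf-* sP (sf-^ k sP)

  sf-monomial : ∀ E → SF (monomial E)
  sf-monomial E = fold-closed SF sf-1 sf-* _ λ i → fold-closed SF sf-1 sf-* _ λ j → sf-^ (E i j) (sf-entry i j)

  infix 4 _≽_
  -- Recording that `w` is subtraction-free is what makes the relation multiplicative.
  record _≽_ (u w : Poly n) : Set (c ⊔ ℓ₁) where
    constructor dominates
    field
      lower      : SF w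
      difference : SF (u ⊕ ⊝ w)
  open _≽_ public

  ≽-1 : 1ₚ ≽ 1ₚ
  ≽-1 = dominates sf-1 (sf-≋ (sym (-‿inverseʳ 1ₚ)) sf-0)

  ≽-⊗ : ∀ {u w u′ w′} → u ≽ w → u′ ≽ w′ → u ⊗ u′ ≽ w ⊗ w′
  ≽-⊗ {u} {w} {u′} {w′} u≽w u′≽w′ = dominates (sf-* (lower u≽w) (lower u′≽w′))
    (sf-≋ (product-difference u w u′ w′)
      (sf-+ (sf-* (difference u≽w) (sf-+ (lower u′≽w′) (difference u′≽w′)))
            (sf-* (lower u≽w) (difference u′≽w′))))

  ≽-fold : ∀ {k} (v w : Vector (Poly n) k) → (∀ i → v i ≽ w i) → foldr _⊗_ 1ₚ v ≽ foldr _⊗_ 1ₚ w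
  ≽-fold {zero}  v w v≽w = ≽-1
  ≽-fold {suc k} v w v≽w = ≽-⊗ (v≽w zero) (≽-fold (v ∘ suc) (w ∘ suc) (v≽w ∘ suc))

  ≽-× : ∀ {u w} k → u ≽ w → k ×ₘ u ≽ k ×ₘ w
  ≽-× zero    u≽w = ≽-1
  ≽-× (suc k) u≽w = ≽-⊗ u≽w (≽-× k u≽w)

  ≽-combination : ∀ {m} (D : Matrix ℕ m) {u w : Matrix (Poly n) m} → (∀ i j → u i j ≽ w i j) →
    combination D u ≽ combination D w
  ≽-combination D u≽w = ≽-fold _ _ λ i → ≽-fold _ _ λ j → ≽-× (D i j) (u≽w i j)

-- From exchanges of exponents to differences of monomials.

module ExchangePolynomial {c ℓ₁ ℓ₂} (ℝ : Reals c ℓ₁ ℓ₂) where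
  open RationalFunctions ℝ
  open SubtractionFree ℝ

  diagonal≽antidiagonal : ∀ {m} (D : Matrix ℕ m) →
    SF (monomial (diagonal D) ⊕ ⊝ monomial (antidiagonal D))
  diagonal≽antidiagonal {m} D = sf-≋
    (+-cong (sym (combination-diagonal D x)) (-‿cong (sym (combination-antidiagonal D x))))
    (difference (≽-combination D λ i j → dominates
      (sf-* (sf-entry (suc i) (inject₁ j)) (sf-entry (inject₁ i) (suc j)))
      (sf-≋ (difference-swap (x (inject₁ i) (inject₁ j)) (x (suc i) (suc j))
                             (x (inject₁ i) (suc j)) (x (suc i) (inject₁ j)))
        (sf-minor (inject₁<suc i) (inject₁<suc j)))))
    where
    open CommutativeRing (ℝ[x] (suc m)) using (sym; +-cong; -‿cong; *-commutativeMonoid)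
    open Combination *-commutativeMonoid
    open Identities (ℝ[x] (suc m))
    inject₁<suc : ∀ {m} (i : Fin m) → inject₁ i Fin.< suc i
    inject₁<suc i = ℕ.s≤s (ℕₚ.≤-reflexive (Finₚ.toℕ-inject₁ i))

  monomial-+ : ∀ {n} (E E′ : Matrix ℕ n) → monomial (λ i j → E i j ℕ.+ E′ i j) ≋ monomial E ⊗ monomial E′
  monomial-+ {n} E E′ = Combination.combination-+ (CommutativeRing.*-commutativeMonoid (ℝ[x] n)) E E′ x

  numerator-difference : ∀ {n} → ASM n → ASM n → Poly n
  numerator-difference A B = monomial (numerators A B) ⊕ ⊝ monomial (numerators B A)

  clearing-factor : ∀ {n} (A B : ASM n) → A ≤ASM B → ∃[ K ] SF (monomial K ⊗ numerator-difference A B)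
  -- Without rows both monomials are 1 and their difference vanishes; an exchange needs a successor.
  clearing-factor {zero}  A B A≤B = (λ ()) , sf-≋ (sym (trans (*-congˡ (-‿inverseʳ 1ₚ)) (zeroʳ 1ₚ))) sf-0
    where open CommutativeRing (ℝ[x] 0) using (sym; trans; *-congˡ; zeroʳ; -‿inverseʳ)
  clearing-factor {suc m} A B A≤B =
    let D , eq = ≤ASM⇒exchange A B A≤B
        α = numerators A B ; β = numerators B A
    in antidiagonal D , sf-≋
      (difference-exchange (monomial α) (monomial β) (monomial (diagonal D)) (monomial (antidiagonal D))
        (trans (sym (monomial-+ α (antidiagonal D)))
          (trans (combination-cong {y = x} eq (λ i j → refl)) (monomial-+ β (diagonal D)))))
      (sf-* (sf-monomial β) (diagonal≽antidiagonal D))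
    where
    open CommutativeRing (ℝ[x] (suc m)) using (refl; sym; trans; *-commutativeMonoid)
    open Combination *-commutativeMonoid
    open Identities (ℝ[x] (suc m))

  module _ {n : ℕ} where
    open CommutativeRing (ℝ[x] n) using (refl; sym; trans; *-congˡ; +-cong; -‿cong; *-cong)

    num-∏ : ∀ {k} (v : Vector (Frac n) k) (w : Vector (Poly n) k) → (∀ i → num (v i) ≋ w i) →
      num (∏ᶠ v) ≋ foldr _⊗_ 1ₚ w
    num-∏ {zero}  v w v≋w = refl
    num-∏ {suc k} v w v≋w = *-cong (v≋w zero) (num-∏ (v ∘ suc) (w ∘ suc) (v≋w ∘ suc))

    den-∏ : ∀ {k} (v : Vector (Frac n) k) (w : Vector (Poly n) k) → (∀ i → den (v i) ≋ w i) →
      den (∏ᶠ v) ≋ foldr _⊗_ 1ₚ w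
    den-∏ {zero}  v w v≋w = refl
    den-∏ {suc k} v w v≋w = *-cong (v≋w zero) (den-∏ (v ∘ suc) (w ∘ suc) (v≋w ∘ suc))

    num-power : ∀ P z → num (power {n} P z) ≋ P ^ₚ pos z
    num-power P (+ k)      = refl
    num-power P ℤ.-[1+ k ] = refl

    den-power : ∀ P z → den (power {n} P z) ≋ P ^ₚ neg z
    den-power P (+ k)      = refl
    den-power P ℤ.-[1+ k ] = refl

    num-x^ : ∀ A → num (x^ A) ≋ monomial (positivePart A)
    num-x^ A = num-∏ _ _ λ i → num-∏ _ _ λ j → num-power (x i j) (ASM.entry A i j)

    den-x^ : ∀ A → den (x^ A) ≋ monomial (negativePart A)
    den-x^ A = den-∏ _ _ λ i → den-∏ _ _ λ j → den-power (x i j) (ASM.entry A i j)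

    denominators : ASM n → ASM n → Matrix ℕ n
    denominators A B i j = negativePart A i j ℕ.+ negativePart B i j

    num-difference : ∀ A B → num (x^ A -ᶠ x^ B) ≋ numerator-difference A B
    num-difference A B = +-cong (num-⊗-den A B) (-‿cong (num-⊗-den B A))
      where
      num-⊗-den : ∀ A B → num (x^ A) ⊗ den (x^ B) ≋ monomial (numerators A B)
      num-⊗-den A B = trans (*-cong (num-x^ A) (den-x^ B)) (sym (monomial-+ (positivePart A) (negativePart B)))

    den-difference : ∀ A B → den (x^ A -ᶠ x^ B) ≋ monomial (denominators A B)
    den-difference A B = trans (*-cong (den-x^ A) (den-x^ B)) (sym (monomial-+ (negativePart A) (negativePart B)))

-- Evaluation at real matrices: qTNN, and the converse implications.

module Evaluation {c ℓ₁ ℓ₂} (ℝ : Reals c ℓ₁ ℓ₂) where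
  open RationalFunctions ℝ
  open OrderedField ℝ
  open Limits ℝ
  open TotallyNonnegative₂ ℝ
  open SubtractionFree ℝ
  open ExchangePolynomial ℝ
  open Algebra.Properties.Semiring.Exp semiring using (^-homo-*)
  open Combination *-commutativeMonoid using (combination)
  module ℝdet = Determinant commutativeRing

  eval-≋ : ∀ {n} {P Q : Poly n} M → P ≋ Q → eval P M ≈ eval Q M
  eval-≋ M ≋-refl             = refl
  eval-≋ M (≋-sym P≋Q)        = sym (eval-≋ M P≋Q)
  eval-≋ M (≋-trans P≋Q Q≋S)  = trans (eval-≋ M P≋Q) (eval-≋ M Q≋S)
  eval-≋ M (⊕-cong P≋ Q≋)     = +-cong (eval-≋ M P≋) (eval-≋ M Q≋)
  eval-≋ M (⊗-cong P≋ Q≋)     = *-cong (eval-≋ M P≋) (eval-≋ M Q≋)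
  eval-≋ M (⊝-cong P≋)        = -‿cong (eval-≋ M P≋)
  eval-≋ M (con-cong a≈b)     = a≈b
  eval-≋ M (con-+ a b)        = refl
  eval-≋ M (con-* a b)        = refl
  eval-≋ M (⊕-assoc P Q S)    = +-assoc _ _ _
  eval-≋ M (⊕-comm P Q)       = +-comm _ _
  eval-≋ M (⊕-identityˡ P)    = +-identityˡ _
  eval-≋ M (⊝-inverseˡ P)     = -‿inverseˡ _
  eval-≋ M (⊗-assoc P Q S)    = *-assoc _ _ _
  eval-≋ M (⊗-comm P Q)       = *-comm _ _
  eval-≋ M (⊗-identityˡ P)    = *-identityˡ _
  eval-≋ M (⊗-distribˡ P Q S) = distribˡ _ _ _

  eval-cong : ∀ {n} (P : Poly n) {M N : Matrix Carrier n} → (∀ i j → M i j ≈ N i j) → eval P M ≈ eval P N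
  eval-cong (con a) M≈N = refl
  eval-cong (x i j) M≈N = M≈N i j
  eval-cong (P ⊕ Q) M≈N = +-cong (eval-cong P M≈N) (eval-cong Q M≈N)
  eval-cong (P ⊗ Q) M≈N = *-cong (eval-cong P M≈N) (eval-cong Q M≈N)
  eval-cong (⊝ P)   M≈N = -‿cong (eval-cong P M≈N)

  eval-⇝ : ∀ {n} (P : Poly n) {f : Carrier → Matrix Carrier n} {M : Matrix Carrier n} →
    (∀ i j → (λ ε → f ε i j) ⇝ M i j) → (λ ε → eval P (f ε)) ⇝ eval P M
  eval-⇝ (con a) f⇝M = ⇝-const a
  eval-⇝ (x i j) f⇝M = f⇝M i j
  eval-⇝ (P ⊕ Q) f⇝M = ⇝-+ (eval-⇝ P f⇝M) (eval-⇝ Q f⇝M)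
  eval-⇝ (P ⊗ Q) f⇝M = ⇝-* (eval-⇝ P f⇝M) (eval-⇝ Q f⇝M)
  eval-⇝ (⊝ P)   f⇝M = ⇝-neg (eval-⇝ P f⇝M)

  eval-monomial : ∀ {n} (E : Matrix ℕ n) M → eval (monomial E) M ≈ combination E M
  eval-monomial {n} E M = homo-combination (CommutativeRing.*-commutativeMonoid (ℝ[x] n)) *-commutativeMonoid
    (λ P → eval P M) refl (λ _ _ → refl) E x

  eval-^ : ∀ {n} (P : Poly n) k M → eval (P ^ₚ k) M ≈ eval P M ^ k
  eval-^ P zero    M = refl
  eval-^ P (suc k) M = *-congˡ (eval-^ P k M)

  eval-det : ∀ {n k} (Q : Matrix (Poly n) k) M →
    eval (Determinant.det (ℝ[x] n) Q) M ≈ ℝdet.det λ i j → eval (Q i j) M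
  eval-det {n} {zero}  Q M = refl
  eval-det {n} {suc k} Q M = eval-sum
    (λ j → ((⊝ 1ₚ) ^ₚ toℕ j) ⊗ (Q zero j ⊗ Determinant.det (ℝ[x] n) λ r s → Q (suc r) (punchIn j s)))
    (λ j → (- 1#) ^ toℕ j * (eval (Q zero j) M * ℝdet.det λ r s → eval (Q (suc r) (punchIn j s)) M))
    λ j → *-cong (eval-^ (⊝ 1ₚ) (toℕ j) M)
      (*-congˡ {eval (Q zero j) M} (eval-det (λ r s → Q (suc r) (punchIn j s)) M))
    where
    eval-sum : ∀ {l} (v : Vector (Poly n) l) (w : Vector Carrier l) → (∀ i → eval (v i) M ≈ w i) →
      eval (foldr _⊕_ 0ₚ v) M ≈ sum w
    eval-sum {zero}  v w v≈w = refl
    eval-sum {suc l} v w v≈w = +-cong (v≈w zero) (eval-sum (v ∘ suc) (w ∘ suc) (v≈w ∘ suc))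

  eval-Δ : ∀ {n} (Δ : MinorIndex n) M → eval Δ⟨ Δ ⟩ M ≈ ℝdet.minor M Δ
  eval-Δ Δ M = eval-det (λ r s → x (rows r) (cols s)) M
    where open MinorIndex Δ

  eval-monomial-pos : ∀ {n} (E : Matrix ℕ n) {M} → Positive M → 0# < eval (monomial E) M
  eval-monomial-pos E {M} 0<M = <-respʳ (sym (eval-monomial E M))
    (pos-product _ λ i → pos-product _ λ j → pos-^ (E i j) (0<M i j))
    where
    pos-product : ∀ {k} (v : Vector Carrier k) → (∀ i → 0# < v i) → 0# < foldr _*_ 1# v
    pos-product {zero}  v 0<v = 0<1
    pos-product {suc k} v 0<v = pos-* (0<v zero) (pos-product (v ∘ suc) (0<v ∘ suc))

  eval-SF : ∀ {n} {P : Poly n} {M} → TN₂ M → SF P → 0# ≤ eval P M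
  eval-SF {M = M} tM (sf-≋ P≋Q sP)      = nonneg-resp (eval-≋ M P≋Q) (eval-SF tM sP)
  eval-SF tM sf-0               = nonneg-0
  eval-SF tM sf-1               = pos⇒nonneg 0<1
  eval-SF tM (sf-+ sP sQ)       = nonneg-+ (eval-SF tM sP) (eval-SF tM sQ)
  eval-SF tM (sf-* sP sQ)       = nonneg-* (eval-SF tM sP) (eval-SF tM sQ)
  eval-SF tM (sf-entry i j)     = entries tM i j
  eval-SF tM (sf-minor i<i′ j<j′) = minors tM i<i′ j<j′

  TotallyPositive : ∀ {n} → Matrix Carrier n → Set ℓ₂
  TotallyPositive M = ∀ Δ → 0# < ℝdet.minor M Δ

  eval-minorSum : ∀ {n} {M : Matrix Carrier n} → TotallyPositive M → ∀ ts → 0# ≤ eval (minorSum ts) M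
  eval-minorSum {n} {M} tp []              = nonneg-0
  eval-minorSum {n} {M} tp ((k , Δs) ∷ ts) = nonneg-+ (multiple k) (eval-minorSum tp ts)
    where
    products : ∀ Δs → 0# ≤ eval (∏ₚ (List.map Δ⟨_⟩ Δs)) M
    products []       = pos⇒nonneg 0<1
    products (Δ ∷ Δs) = nonneg-* (pos⇒nonneg (<-respʳ (sym (eval-Δ Δ M)) (tp Δ))) (products Δs)

    multiple : ∀ k → 0# ≤ eval (k ·ₚ ∏ₚ (List.map Δ⟨_⟩ Δs)) M
    multiple zero    = nonneg-0
    multiple (suc k) = nonneg-+ (products Δs) (multiple k)

  eval-minorProduct : ∀ {n} {M : Matrix Carrier n} → TotallyPositive M → ∀ ds → 0# < eval (minorProduct ds) M
  eval-minorProduct tp []             = 0<1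
  eval-minorProduct {M = M} tp ((Δ , k) ∷ ds) = pos-*
    (<-respʳ (sym (eval-^ Δ⟨ Δ ⟩ k M)) (pos-^ k (<-respʳ (sym (eval-Δ Δ M)) (tp Δ))))
    (eval-minorProduct tp ds)

  TNN⇒TN₂ : ∀ {n} {M : Matrix Carrier n} → (∀ Δ → 0# ≤ ℝdet.minor M Δ) → TN₂ M
  TNN⇒TN₂ {M = M} tnn = record
    { entries = λ i j → nonneg-resp (det₁ λ _ _ → M i j) (tnn (minor₁ i j))
    ; minors  = λ {i} {i′} {j} {j′} i<i′ j<j′ → nonneg-resp
        (det₂ λ r s → M (pair i i′ r) (pair j j′ s)) (tnn (minor₂ i<i′ j<j′)) }
    where open SmallMinors commutativeRing

  -- Only the multiple by x^K is subtraction-free; positive entries allow the factor to be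
  -- cancelled.
  numerator-difference-nonneg : ∀ {n} (A B : ASM n) → A ≤ASM B → ∀ {M} → TN₂ M → Positive M →
    0# ≤ eval (num (x^ A -ᶠ x^ B)) M
  numerator-difference-nonneg A B A≤B {M} tM 0<M =
    let K , sf = clearing-factor A B A≤B
    in nonneg-resp (sym (eval-≋ M (num-difference A B)))
         (nonneg-cancel (eval-monomial-pos K 0<M) (eval-SF tM sf))

  denominator-pos : ∀ {n} (A B : ASM n) {M} → Positive M → 0# < eval (den (x^ A -ᶠ x^ B)) M
  denominator-pos A B {M} 0<M = <-respʳ (sym (eval-≋ M (den-difference A B)))
    (eval-monomial-pos (denominators A B) 0<M)

  -- `Q` may have either sign, so the product `P * Q` is followed instead of the fraction. It is
  -- nonnegative at the approximations, where `den g` is positive, and at the limit it equals `v`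
  -- times the positive square of `Q`.
  ≤ASM⇒qTNN : ∀ {n} (A B : ASM n) → A ≤ASM B → qTNN (x^ A -ᶠ x^ B)
  ≤ASM⇒qTNN A B A≤B q₀>0 M tnn v (P , Q , g≃P/Q , Q#0 , vQ≈P) v<0 =
    -- The goal is now absurdity, so the doubly negated approximation is available.
    approximation (TNN⇒TN₂ tnn) λ approx → limit-step approx v<0
    where
    N = scale q₀>0 M
    g = x^ A -ᶠ x^ B

    module _ (approx : Approximation N) where
      open Approximation approx

      step : ∀ n d p q → n * q ≈ p * d → n * (q * q) ≈ d * (p * q)
      step n d p q nq≈pd = trans (sym (*-assoc n q q)) (trans (*-congʳ nq≈pd)
        (solve 3 (λ d p q → p :* d :* q := d :* (p :* q)) refl d p q))

      PQ-nonneg : ∀ ε → 0# < ε → 0# < 1# - ε → 0# ≤ eval P (family ε) * eval Q (family ε)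
      PQ-nonneg ε 0<ε ε<1 = nonneg-cancel (denominator-pos A B (family-pos ε 0<ε ε<1))
        (nonneg-resp
          (step (eval (num g) (family ε)) (eval (den g) (family ε)) (eval P (family ε)) (eval Q (family ε))
            (eval-≋ (family ε) g≃P/Q))
          (nonneg-* (numerator-difference-nonneg A B A≤B (family-TN₂ ε 0<ε ε<1) (family-pos ε 0<ε ε<1))
                    (square-nonneg (eval Q (family ε)))))

      limit-step : 0# ≤ v
      limit-step = nonneg-cancel (square-pos Q#0) (nonneg-resp
        (trans (*-congʳ (sym vQ≈P)) (solve 2 (λ v q → v :* q :* q := q :* q :* v) refl v (eval Q N)))
        (limit-nonneg (⇝-* (eval-⇝ P converges) (eval-⇝ Q converges)) PQ-nonneg))

  record Separating {n} (A B : ASM n) : Set (c ⊔ ℓ₂) where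
    field
      matrix   : Matrix Carrier n
      positive : Positive matrix
      tp       : TotallyPositive matrix
      negative : eval (num (x^ A -ᶠ x^ B)) matrix < 0#

  -- At a matrix of powers each monomial is a single power of the base, so comparing the two weights
  -- decides the sign.
  separating : ∀ {n} (A B : ASM n) r s → cornerSum A r s ℤ.< cornerSum B r s → Separating A B
  separating {n} A B r s A<B with separating-exponent A B r s A<B
  ... | W , α<β = record
    { matrix   = powers e supermodular
    ; positive = Dominant.positive (powers-dominant e supermodular)
    ; tp       = powers-TP e supermodular
    ; negative = 0<-⇒neg (<-respʳ
        (trans (solve 2 (λ a b → b :- a := :- (a :- b)) refl (b ^ weighted α e) (b ^ weighted β e)) (-‿cong
          (sym (trans (eval-≋ (powers e supermodular) (num-difference A B))
            (+-cong (eval-powers α) (-‿cong (eval-powers β)))))))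
        (^-strictly-monotone e supermodular r α<β))
    }
    where
    open DominantDiagonal ℝ
    e = testExponent r s W
    supermodular : ∀ {i i′ j j′} → i Fin.< i′ → j Fin.< j′ → suc (e i j′ ℕ.+ e i′ j) ℕ.≤ e i j ℕ.+ e i′ j′
    supermodular = testExponent-supermodular r s W
    b = base e supermodular
    α = numerators A B
    β = numerators B A

    eval-powers : ∀ E → eval (monomial E) (powers e supermodular) ≈ b ^ weighted E e
    eval-powers E = trans (eval-monomial E _) (sym
      (homo-combination ℕₚ.+-0-commutativeMonoid *-commutativeMonoid (b ^_) refl (^-homo-* b) E e))

  -- The order of integers is decidable, so arguing by contradiction is constructive here.
  ¬separating⇒≤ASM : ∀ {n} (A B : ASM n) → ¬ Separating A B → A ≤ASM B
  ¬separating⇒≤ASM A B ¬sep i j = decidable-stable (cornerSum B i j ℤₚ.≤? cornerSum A i j)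
    λ B≰A → ¬sep (separating A B i j (ℤₚ.≰⇒> B≰A))

  -- At a separating matrix `num * G` equals `F * den` with `F` nonnegative and `G`, `den` positive,
  -- so the numerator could not be negative.
  qSFL⇒≤ASM : ∀ {n} (A B : ASM n) → qSFL (x^ A -ᶠ x^ B) → A ≤ASM B
  qSFL⇒≤ASM A B qsfl = ¬separating⇒≤ASM A B contradict
    where
    open qSFL qsfl
    contradict : ¬ Separating A B
    contradict sep = nonneg-cancel
      (<-respʳ (sym (eval-≋ matrix G-product)) (eval-minorProduct tp G-factors))
      (nonneg-resp (trans (sym (eval-≋ matrix g≃F/G)) (*-comm _ _))
        (nonneg-* (nonneg-resp (sym (eval-≋ matrix F-sum)) (eval-minorSum tp F-terms))
                  (pos⇒nonneg (denominator-pos A B positive))))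
      negative
      where open Separating sep

  -- The root is specified only by its positivity and its square: (s - 1)(1 + s) = 0, and 1 + s is
  -- invertible.
  √1≈1 : Reals.√ ℝ 0<1 ≈ 1#
  √1≈1 = trans (add-1 s) (trans (+-congˡ s-1≈0) (+-identityʳ 1#))
    where
    s = Reals.√ ℝ 0<1
    inverse = reciprocal {1# + s} (pos-+-nonneg 0<1 (pos⇒nonneg (Reals.√-pos ℝ 0<1)))
    t = proj₁ inverse

    add-1 : ∀ s → s ≈ 1# + (s - 1#)
    add-1 = solve 1 (λ s → s := con 1ℤ :+ (s :- con 1ℤ)) refl

    factor : ∀ s t → (s - 1#) * ((1# + s) * t) ≈ (s * s - 1#) * t
    factor = solve 2 (λ s t → (s :- con 1ℤ) :* ((con 1ℤ :+ s) :* t) := (s :* s :- con 1ℤ) :* t) refl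

    s-1≈0 : s - 1# ≈ 0#
    s-1≈0 = trans (sym (*-identityʳ (s - 1#))) (trans (*-congˡ (sym (proj₂ (proj₂ inverse))))
      (trans (factor s t) (trans (*-congʳ (trans (+-congʳ (Reals.√-square ℝ 0<1)) (-‿inverseʳ 1#))) (zeroˡ t))))

  scale-1 : ∀ {n} (M : Matrix Carrier n) i j → scale 0<1 M i j ≈ M i j
  scale-1 M i j = trans (*-congʳ (power-1 (∣ toℕ i - toℕ j ∣ ℕ.^ 2))) (*-identityˡ (M i j))
    where
    power-1 : ∀ k → Reals.√ ℝ 0<1 ^ k ≈ 1#
    power-1 zero    = refl
    power-1 (suc k) = trans (*-cong √1≈1 (power-1 k)) (*-identityˡ 1#)

  -- Taken at `q₀ = 1`, where scaling changes nothing, so the totally positive matrix is admissible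
  -- as it stands.
  qTNN⇒≤ASM : ∀ {n} (A B : ASM n) → qTNN (x^ A -ᶠ x^ B) → A ≤ASM B
  qTNN⇒≤ASM A B qtnn = ¬separating⇒≤ASM A B contradict
    where
    contradict : ¬ Separating A B
    contradict sep =
      let d⁻¹ , 0<d⁻¹ , dd⁻¹≈1 = reciprocal 0<d
      in nonneg-cancel 0<d⁻¹
           (qtnn 0<1 matrix (λ Δ → nonneg-resp (sym (minor-scale-1 Δ)) (pos⇒nonneg (tp Δ)))
             (d⁻¹ * eval (num g) N)
             (num g , den g , ≋-refl , pos⇒#0 0<d ,
               trans (solve 3 (λ i n d → i :* n :* d := n :* (d :* i)) refl d⁻¹ (eval (num g) N) (eval (den g) N))
                 (trans (*-congˡ dd⁻¹≈1) (*-identityʳ _))))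
           (<-respˡ (sym (eval-cong (num g) (scale-1 matrix))) negative)
      where
      open Separating sep
      open SmallMinors commutativeRing using (det-cong)
      g = x^ A -ᶠ x^ B
      N = scale 0<1 matrix
      minor-scale-1 : ∀ Δ → ℝdet.minor N Δ ≈ ℝdet.minor matrix Δ
      minor-scale-1 Δ = det-cong {N = λ r s → matrix (rows r) (cols s)} λ r s → scale-1 matrix (rows r) (cols s)
        where open MinorIndex Δ
      0<d : 0# < eval (den g) N
      0<d = <-respʳ (sym (eval-cong (den g) (scale-1 matrix))) (denominator-pos A B positive)

-- Polynomial dependence on q, and qSFL.

module QPolynomial {c ℓ₁ ℓ₂} (ℝ : Reals c ℓ₁ ℓ₂) where
  open RationalFunctions ℝ
  open SubtractionFree ℝ
  open ExchangePolynomial ℝ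
  open Evaluation ℝ using (eval-≋; eval-monomial-pos)
  private module F = OrderedField ℝ
  open Algebra.Properties.Semiring.Exp F.semiring using (^-homo-*; ^-congʳ)

  substitute-≋ : ∀ {n} {P Q : Poly n} σ → P ≋ Q → P [ σ ] ≋ Q [ σ ]
  substitute-≋ σ ≋-refl             = ≋-refl
  substitute-≋ σ (≋-sym P≋Q)        = ≋-sym (substitute-≋ σ P≋Q)
  substitute-≋ σ (≋-trans P≋Q Q≋S)  = ≋-trans (substitute-≋ σ P≋Q) (substitute-≋ σ Q≋S)
  substitute-≋ σ (⊕-cong P≋ Q≋)     = ⊕-cong (substitute-≋ σ P≋) (substitute-≋ σ Q≋)
  substitute-≋ σ (⊗-cong P≋ Q≋)     = ⊗-cong (substitute-≋ σ P≋) (substitute-≋ σ Q≋)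
  substitute-≋ σ (⊝-cong P≋)        = ⊝-cong (substitute-≋ σ P≋)
  substitute-≋ σ (con-cong a≈b)     = con-cong a≈b
  substitute-≋ σ (con-+ a b)        = con-+ a b
  substitute-≋ σ (con-* a b)        = con-* a b
  substitute-≋ σ (⊕-assoc P Q S)    = ⊕-assoc _ _ _
  substitute-≋ σ (⊕-comm P Q)       = ⊕-comm _ _
  substitute-≋ σ (⊕-identityˡ P)    = ⊕-identityˡ _
  substitute-≋ σ (⊝-inverseˡ P)     = ⊝-inverseˡ _
  substitute-≋ σ (⊗-assoc P Q S)    = ⊗-assoc _ _ _
  substitute-≋ σ (⊗-comm P Q)       = ⊗-comm _ _
  substitute-≋ σ (⊗-identityˡ P)    = ⊗-identityˡ _
  substitute-≋ σ (⊗-distribˡ P Q S) = ⊗-distribˡ _ _ _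

  -- `_≋_` is a generated congruence, so refuting it takes a model: evaluation at the all-ones
  -- matrix.
  monomial-nonzero : ∀ {n} (E : Matrix ℕ n) → Nonzero (monomial E)
  monomial-nonzero E E≋0 = F.<-irrefl (F.sym (eval-≋ ones E≋0)) (eval-monomial-pos E λ _ _ → F.0<1)
    where
    ones = λ _ _ → F.1#

  module _ {n : ℕ} where
    open CommutativeRing (ℝ[x] n) using
      ( refl; sym; trans; +-congˡ; *-congˡ; *-congʳ; +-identityʳ; +-identityˡ; zeroˡ; zeroʳ
      ; *-assoc; *-commutativeMonoid )
    open Identities (ℝ[x] n)
    open Combination *-commutativeMonoid using (combination; combination-∙)

    horner : F.Carrier → List (Poly n) → Poly n
    horner q []       = 0ₚ
    horner q (c ∷ cs) = c ⊕ con q ⊗ horner q cs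

    -- Coefficients of the single term P q^e.
    monic : ℕ → Poly n → List (Poly n)
    monic zero    P = P ∷ []
    monic (suc e) P = 0ₚ ∷ monic e P

    horner-monic : ∀ q e P → horner q (monic e P) ≋ con (q F.^ e) ⊗ P
    horner-monic q zero    P = trans (+-congˡ (zeroʳ (con q)))
      (trans (+-identityʳ P) (sym (⊗-identityˡ P)))
    horner-monic q (suc e) P = trans (+-identityˡ _) (trans (*-congˡ (horner-monic q e P))
      (trans (sym (*-assoc (con q) (con (q F.^ e)) P)) (*-congʳ (sym (con-* q (q F.^ e))))))

    add : List (Poly n) → List (Poly n) → List (Poly n)
    add []       ds       = ds
    add (c ∷ cs) []       = c ∷ cs
    add (c ∷ cs) (d ∷ ds) = (c ⊕ d) ∷ add cs ds

    horner-add : ∀ q cs ds → horner q (add cs ds) ≋ horner q cs ⊕ horner q ds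
    horner-add q []       ds       = sym (+-identityˡ _)
    horner-add q (c ∷ cs) []       = sym (+-identityʳ _)
    horner-add q (c ∷ cs) (d ∷ ds) = trans (+-congˡ (*-congˡ (horner-add q cs ds)))
      (horner-+ c d (con q) (horner q cs) (horner q ds))

    module _ (d : Poly n) (d≉0 : Nonzero d) where

      over : List (Poly n) → List (RatFun n)
      over = List.map λ c → (c / d) , d≉0

      polynomialIn-over : ∀ q cs →
        num (polynomialIn q (over cs)) ⊗ d ≋ horner q cs ⊗ den (polynomialIn q (over cs))
      polynomialIn-over q []       = trans (zeroˡ d) (sym (zeroˡ 1ₚ))
      polynomialIn-over q (c ∷ cs) = horner-step c d (den p) (con q) (num p) (horner q cs) (polynomialIn-over q cs)
        where p = polynomialIn q (over cs)

    module _ {q} (q>0 : F.0# F.< q) where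
      private
        s = Reals.√ ℝ q>0

      √-^-double : ∀ e → s F.^ (e ℕ.+ e) F.≈ q F.^ e
      √-^-double zero    = F.refl
      √-^-double (suc e) = F.trans (F.reflexive (≡.cong (λ k → s F.* s F.^ k) (ℕₚ.+-suc e e)))
        (F.trans (F.sym (F.*-assoc s s (s F.^ (e ℕ.+ e)))) (F.*-cong (Reals.√-square ℝ q>0) (√-^-double e)))

      monomial-x_q : ∀ E → monomial E [ x_q q>0 ] ≋ con (s F.^ weighted E distance²) ⊗ monomial E
      monomial-x_q E = trans
        (homo-combination *-commutativeMonoid *-commutativeMonoid (_[ x_q q>0 ]) refl (λ _ _ → refl) E x)
        (trans (combination-∙ E (λ i j → con (weight q>0 i j)) x) (*-congʳ (sym
          (homo-combination ℕₚ.+-0-commutativeMonoid *-commutativeMonoid (λ k → con (s F.^ k)) refl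
            (λ k l → trans (con-cong (^-homo-* s k l)) (con-* (s F.^ k) (s F.^ l))) E distance²))))

      -- Isolates the power `s ^ w` of √q, possibly half-integral in q, which both numerators share
      -- with the denominator and which cancels.
      monomial-x_q-split : ∀ E w e → weighted E distance² ≡ w ℕ.+ (e ℕ.+ e) →
        monomial E [ x_q q>0 ] ≋ con (s F.^ w) ⊗ (con (q F.^ e) ⊗ monomial E)
      monomial-x_q-split E w e eq = trans (monomial-x_q E) (trans
        (*-congʳ (trans
          (con-cong (F.trans (^-congʳ s eq) (F.trans (^-homo-* s w (e ℕ.+ e)) (F.*-congˡ (√-^-double e)))))
          (con-* (s F.^ w) (q F.^ e))))
        (*-assoc _ _ _))

    numerators-weight : ∀ (A B : ASM n) → let e = proj₁ (q-exponent A) in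
      weighted (numerators A B) distance² ≡ weighted (denominators A B) distance² ℕ.+ (e ℕ.+ e)
    numerators-weight A B = ≡.trans (weighted-+ (positivePart A) (negativePart B) distance²)
      (≡.trans (≡.cong (ℕ._+ weighted (negativePart B) distance²) (proj₂ (q-exponent A)))
        (≡.trans (swap (weighted (negativePart A) distance²) _ (weighted (negativePart B) distance²))
          (≡.cong (ℕ._+ (e ℕ.+ e)) (≡.sym (weighted-+ (negativePart A) (negativePart B) distance²)))))
      where
      e = proj₁ (q-exponent A)
      swap : ∀ a e b → a ℕ.+ e ℕ.+ b ≡ a ℕ.+ b ℕ.+ e
      swap = solveℕ

    denominators-comm : ∀ (A B : ASM n) →
      weighted (denominators B A) distance² ≡ weighted (denominators A B) distance²
    denominators-comm A B = ≡.trans (weighted-+ (negativePart B) (negativePart A) distance²)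
      (≡.trans (ℕₚ.+-comm (weighted (negativePart B) distance²) _)
        (≡.sym (weighted-+ (negativePart A) (negativePart B) distance²)))

  -- Substituting x_q puts the same factor `κ` on `F` and on `G`. It absorbs the image of x^K and
  -- the common power of √q, and what remains is (q^a x^α - q^b x^β) / x^δ.
  ≤ASM⇒qSFL : ∀ {n} (A B : ASM n) → A ≤ASM B → qSFL (x^ A -ᶠ x^ B)
  ≤ASM⇒qSFL {n} A B A≤B = record
    { F            = monomial K ⊗ numerator-difference A B
    ; G            = G
    ; G-nonzero    = λ G≋0 → monomial-nonzero (λ i j → K i j ℕ.+ δ i j) (trans (monomial-+ K δ) G≋0)
    ; g≃F/G        = trans (*-congʳ (num-difference A B))
                       (trans (cross (numerator-difference A B) (monomial K) (monomial δ))
                         (*-congˡ (sym (den-difference A B))))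
    ; F-terms      = proj₁ minorSum-F
    ; F-sum        = proj₂ minorSum-F
    ; G-factors    = proj₁ minorProduct-G
    ; G-product    = proj₂ minorProduct-G
    ; q-coeffs     = over (monomial δ) (monomial-nonzero δ) coefficients
    ; q-polynomial = q-polynomial
    }
    where
    open CommutativeRing (ℝ[x] n) using (sym; trans; +-congˡ; *-congˡ; *-congʳ; +-cong; -‿cong; *-assoc; ring)
    open Identities (ℝ[x] n)
    open import Algebra.Properties.Ring ring using (-‿distribʳ-*)

    α = numerators A B
    β = numerators B A
    δ = denominators A B
    a = proj₁ (q-exponent A)
    b = proj₁ (q-exponent B)
    w = weighted δ distance²

    K : Matrix ℕ n
    K = proj₁ (clearing-factor A B A≤B)

    G : Poly n
    G = monomial K ⊗ monomial δ

    minorSum-F = SF⇒minorSum (proj₂ (clearing-factor A B A≤B))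
    minorProduct-G = minorProduct-⊗ (minorProduct-monomial K) (minorProduct-monomial δ)

    coefficients : List (Poly n)
    coefficients = add (monic a (monomial α)) (monic b (⊝ monomial β))

    horner-coefficients : ∀ q → horner q coefficients
      ≋ con (q F.^ a) ⊗ monomial α ⊕ ⊝ (con (q F.^ b) ⊗ monomial β)
    horner-coefficients q = trans (horner-add q (monic a (monomial α)) (monic b (⊝ monomial β)))
      (+-cong (horner-monic q a (monomial α))
              (trans (horner-monic q b (⊝ monomial β)) (sym (-‿distribʳ-* (con (q F.^ b)) (monomial β)))))

    q-polynomial : ∀ {q} (q>0 : F.0# F.< q) →
      ((monomial K ⊗ numerator-difference A B) [ x_q q>0 ]) / (G [ x_q q>0 ])
        ≃ polynomialIn q (over (monomial δ) (monomial-nonzero δ) coefficients)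
    q-polynomial {q} q>0 = trans (*-congʳ F-factored)
      (trans (proportional κ (horner q coefficients) (monomial δ) (num p) (den p)
               (polynomialIn-over (monomial δ) (monomial-nonzero δ) q coefficients))
             (*-congˡ (sym G-factored)))
      where
      p = polynomialIn q (over (monomial δ) (monomial-nonzero δ) coefficients)
      s = Reals.√ ℝ q>0
      Kq = monomial K [ x_q q>0 ]
      κ = Kq ⊗ con (s F.^ w)

      G-factored : G [ x_q q>0 ] ≋ κ ⊗ monomial δ
      G-factored = trans (*-congˡ (monomial-x_q q>0 δ)) (sym (*-assoc Kq (con (s F.^ w)) (monomial δ)))

      F-factored : (monomial K ⊗ numerator-difference A B) [ x_q q>0 ] ≋ κ ⊗ horner q coefficients
      F-factored = trans (*-congˡ (trans
          (+-cong (monomial-x_q-split q>0 α w a (numerators-weight A B))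
            (-‿cong (monomial-x_q-split q>0 β w b (≡.trans (numerators-weight B A)
              (≡.cong (ℕ._+ (b ℕ.+ b)) (denominators-comm A B))))))
          (sym (distrib-con (con (s F.^ w)) (con (q F.^ a) ⊗ monomial α) (con (q F.^ b) ⊗ monomial β)))))
        (trans (sym (*-assoc Kq (con (s F.^ w)) _)) (*-congˡ (sym (horner-coefficients q))))
        where
        distrib-con : ∀ k P Q → k ⊗ (P ⊕ ⊝ Q) ≋ k ⊗ P ⊕ ⊝ (k ⊗ Q)
        distrib-con k P Q = trans (⊗-distribˡ k P (⊝ Q)) (+-congˡ (sym (-‿distribʳ-* k Q)))

theorem5p2 : ∀ {c ℓ₁ ℓ₂} (ℝ : Reals c ℓ₁ ℓ₂) (n : ℕ) (A B : ASM n) →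
    let open RationalFunctions ℝ in
    (A ≤ASM B ⇔ qTNN (x^ A -ᶠ x^ B)) × (qTNN (x^ A -ᶠ x^ B) ⇔ qSFL (x^ A -ᶠ x^ B))
theorem5p2 ℝ n A B =
  mk⇔ (≤ASM⇒qTNN A B) (λ (qtnn : qTNN g) → qTNN⇒≤ASM A B qtnn) ,
  mk⇔ (λ (qtnn : qTNN g) → ≤ASM⇒qSFL A B (qTNN⇒≤ASM A B qtnn)) (λ qsfl → ≤ASM⇒qTNN A B (qSFL⇒≤ASM A B qsfl))
  where
  open RationalFunctions ℝ
  open Evaluation ℝ
  open QPolynomial ℝ
  g = x^ A -ᶠ x^ B
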